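{- For every positive integer $m$ there exists an integer $N$ such that for all $n\geq N$ with $n$ divisible by $3m$, every $3$-graph $H$ on $n$ vertices with $$\delta_2(H)\geq\begin{cases}\lfloor n/2\rfloor-1, & \text{if } n\equiv 1 \pmod 4,\\ \lceil n/2\rceil-1, & \text{otherwise},\end{cases}$$ contains a $K^3_{m,m}$-factor.
   Context: A $3$-graph is a pair $(V,E)$ with $E$ a set of $3$-element subsets of $V$; $\delta_2(H)$ is the minimum, over all $2$-element vertex sets $S$, of the number of edges of $H$ containing $S$. For positive integers $s,t$, let $X_1,\dots,X_t$ be pairwise disjoint sets of size $2$ and $Y$ a set of $s$ elements disjoint from $\bigcup_i X_i$; $K^3_{s,t}$ is the $3$-graph with vertex set $(\bigcup_{i\in[t]}X_i)\cup Y$ and edge set $\{X_i\cup\{y\}: i\in[t], y\in Y\}$ (so $K^3_{2,2}$ is the generalized $4$-cycle $C_4^3$). A $K^3_{m,m}$-factor of $H$ is a collection of vertex-disjoint copies of $K^3_{m,m}$ in $H$ covering all vertices of $H$. -}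

module Defs where

open import Data.Nat using (ℕ; _+_; _∸_; _/_; _%_; _≥_; _*_)
open import Data.Nat.Divisibility using (_∣_)
open import Data.Bool using (Bool; true)
open import Data.Fin using (Fin; zero; suc)
open import Data.Fin.Subset using (∣_∣)
open import Data.Vec using (tabulate)
open import Data.Product using (Σ; _×_; ∃; _,_)
open import Data.Sum using (_⊎_; inj₁; inj₂)
open import Relation.Binary.PropositionalEquality using (_≡_; _≢_)

record ThreeGraph (n : ℕ) : Set where
  field
    edge     : Fin n → Fin n → Fin n → Bool
    sym₁₂    : ∀ x y z → edge x y z ≡ edge y x z
    sym₂₃    : ∀ x y z → edge x y z ≡ edge x z y
    distinct : ∀ x y z → edge x y z ≡ true → (x ≢ y) × (y ≢ z) × (x ≢ z)
open ThreeGraph public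

codeg : ∀ {n} → ThreeGraph n → Fin n → Fin n → ℕ
codeg H x y = ∣ tabulate (edge H x y) ∣

minCodegAtLeast : ∀ {n} → ThreeGraph n → ℕ → Set
minCodegAtLeast {n} H d = ∀ (x y : Fin n) → x ≢ y → codeg H x y ≥ d

-- Vertices of K³_{m,m}: X-vertices (i , b) with i ∈ [m], b ∈ {0,1}
-- (X_i = {(i,0),(i,1)}), and Y-vertices y ∈ [m].
KVert : ℕ → Set
KVert m = (Fin m × Fin 2) ⊎ Fin m

-- A K³_{m,m}-factor: k vertex-disjoint copies covering V(H), given as a
-- bijection φ from k disjoint copies of V(K³_{m,m}) onto V(H) sending every
-- edge X_i ∪ {y} of each copy to an edge of H.
KmmFactor : ∀ {n} → ℕ → ThreeGraph n → Set
KmmFactor {n} m H =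
  Σ ℕ λ k → Σ (Fin k × KVert m → Fin n) λ φ →
    (∀ p q → φ p ≡ φ q → p ≡ q) ×
    (∀ v → ∃ λ p → φ p ≡ v) ×
    (∀ (c : Fin k) (i : Fin m) (y : Fin m) →
       edge H (φ (c , inj₁ (i , zero))) (φ (c , inj₁ (i , suc zero))) (φ (c , inj₂ y)) ≡ true)

threshold : ℕ → ℕ
threshold n with n % 4
... | 1 = (n / 2) ∸ 1
... | _ = ((n + 1) / 2) ∸ 1

{-# OPTIONS --safe #-}
module Submission where

-- Call u and a similar if their links share a positive fraction of all pairs. Then many (2m-1)-sets complete both
-- u and a to a copy of K³_{m,m}, so one vertex can be exchanged for the other; two exchanges in a row lead from u
-- to any v which is reachable from u, i.e. has many vertices similar to both. If every tuple of 3m vertices is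
-- reachable, position by position, from many copies of K³_{m,m}, a greedy choice (each step serving a constant
-- fraction of the n^{3m} tuples not yet served) gives a small absorber. Outside it all but boundedly many vertices
-- are tiled: a pair of leftover vertices is joined to at least half of the vertices of a positive fraction of the
-- pairs of tiles, whence two tiles and some leftover pairs can be traded for three tiles.
--
-- If some u, v are not reachable from each other, their links are almost complementary and almost every link is
-- close to one of the two. The symmetry of the edge relation then forces a colouring χ such that almost all
-- triples are edges exactly if they contain an even number of vertices with χ = true, and vertices of equal colour
-- are reachable from each other. The leftover can be absorbed if it contains an even number of true vertices.
-- A copy of K³_{m,m} with an odd number of them, kept or dissolved as needed, corrects the parity. If there is no
-- such copy, the number of true vertices of H is even: otherwise the exact degree condition gives a vertex whose
-- wrong link contains a matching of size m, and this matching extends to such a copy.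

open import Defs
open import Data.Nat using (ℕ; zero; suc; _+_; _*_; _∸_; _^_; _/_; _%_; _≤_; _<_; _≥_; z≤n; s≤s; s≤s⁻¹; _≤ᵇ_; _≤?_; NonZero; >-nonZero)
open import Data.Nat.Properties hiding (_≟_)
open import Data.Nat.DivMod using (m≡m%n+[m/n]*n; m%n<n; m/n*n≤m; [m+kn]%n≡m%n; +-distrib-/-∣ʳ; m*n/n≡m; /-monoˡ-≤)
open import Data.Nat.Divisibility using (_∣_; divides)
open import Data.Nat.Tactic.RingSolver using (solve-∀)
open import Data.Bool using (Bool; true; false; T; _∧_; _∨_; not; _xor_)
open import Data.Bool.Properties using (T?; not-involutive; xor-comm; xor-assoc)
open import Data.Fin using (Fin; zero; suc; _≟_)
import Data.Fin.Properties as Finₚ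
import Data.Fin.Subset as Subset
open import Data.List using (tabulate; List; []; _∷_; _++_; length; map; concatMap; allFin; cartesianProduct; lookup)
open import Data.List.Properties using (concatMap-cong; concatMap-++; map-concatMap; length-++; length-map; length-tabulate; ++-assoc; ++-identityʳ; map-tabulate; tabulate-lookup; concatMap-map; map-++; map-∘)
open import Data.List.Membership.Propositional using (_∈_)
open import Data.List.Membership.Propositional.Properties using (∈-concatMap⁺; ∈-allFin; ∈-cartesianProduct⁺; ∈-map⁺; ∈-map⁻; ∈-++⁺ˡ; ∈-++⁺ʳ; ∈-++⁻; ∈-lookup)
open import Data.List.Relation.Unary.All using (All; []; _∷_)
import Data.List.Relation.Unary.All as All
import Data.List.Relation.Unary.All.Properties as Allₚ
open import Data.List.Relation.Unary.Any using (Any; here; there)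
import Data.List.Relation.Unary.Any as Any
open import Data.List.Relation.Unary.AllPairs using ([]; _∷_; allPairs?)
open import Data.List.Relation.Unary.Unique.Propositional using (Unique)
open import Data.List.Relation.Unary.Unique.Propositional.Properties using (allFin⁺)
open import Data.List.Relation.Binary.Permutation.Propositional using (_↭_; ↭-refl; ↭-sym; ↭-trans; ↭-reflexive; prep; swap; ↭⇒↭ₛ; module PermutationReasoning)
open import Data.List.Relation.Binary.Permutation.Propositional.Properties using (++⁺; ++⁺ˡ; ++⁺ʳ; ++-comm; shift; shifts; ↭-length; ∈-resp-↭; All-resp-↭; ++-isCommutativeMonoid)
open import Data.Vec using (Vec; []; _∷_; toList)
import Data.Vec as Vec
import Data.Vec.Properties as Vecₚ
open import Data.Product using (Σ; ∃; _×_; _,_; proj₁; proj₂)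
open import Data.Sum using (_⊎_; inj₁; inj₂)
open import Data.Empty using (⊥; ⊥-elim)
open import Data.Unit using (⊤; tt)
open import Function using (_∘_; id)
open import Level using (0ℓ)
open import Relation.Nullary using (¬_; Dec; yes; no)
open import Relation.Nullary.Decidable using (⌊_⌋; ¬?; _×-dec_)
open import Relation.Binary.PropositionalEquality using (_≡_; _≢_; refl; sym; trans; cong; cong₂; subst; module ≡-Reasoning; setoid)
open import Algebra.Bundles using (CommutativeMonoid)
import Algebra.Solver.CommutativeMonoid
import Data.List.Relation.Binary.Permutation.Setoid.Properties as Permₛ

-- The obstacle is parity. If every edge contains an even number of true vertices, then in a copy of
-- K³_{m,m} each y has the parity of each X_i, so the copy contains an even number of true vertices,
-- and a factor forces their total number to be even. With α false and β true vertices this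
-- construction has minimum codegree min(α - 2, β - 1), so it reaches codegree t only if α ≥ t + 2
-- and β ≥ t + 1, whence n ≥ 2t + 3. The threshold t always satisfies n ≤ 2t + 3, so the class sizes
-- are forced: β = t + 1, n = 2t + 3. This happens only for n ≡ 1 (mod 4), and then t + 1 is even.
-- Hence the parity correction has to work with exact class sizes, whereas every other step
-- tolerates a small proportion of errors.
--
-- Random choices are replaced by averaging: a choice that serves a 1/k fraction of the targets
-- exists as soon as each target is served by a 1/k fraction of the choices.

-- Inequalities are certified as linear combinations of the hypotheses: a ≤ b is the combination, s the slack,
-- and the equation is left to the ring solver.
lin : ∀ {a b c d} s → a ≤ b → c + b + s ≡ d + a → c ≤ d
lin {a} {b} {c} {d} s a≤b eq = +-cancelʳ-≤ b c d (begin
  c + b  ≤⟨ m≤m+n (c + b) s ⟩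
  c + b + s  ≡⟨ eq ⟩
  d + a  ≤⟨ +-monoʳ-≤ d a≤b ⟩
  d + b  ∎)
  where open ≤-Reasoning

+-rotate : ∀ a b c → a + b + c ≡ b + (a + c)
+-rotate = solve-∀

∧-intro : ∀ {a b} → T a → T b → T (a ∧ b)
∧-intro {true} {true} _ _ = tt

∧-fst : ∀ {a b} → T (a ∧ b) → T a
∧-fst {true} _ = tt

∧-snd : ∀ {a b} → T (a ∧ b) → T b
∧-snd {true} {true} _ = tt

T⇒≡ : ∀ {b} → T b → b ≡ true
T⇒≡ {true} _ = refl

≡⇒T : ∀ {b} → b ≡ true → T b
≡⇒T refl = tt

¬T⇒≡ : ∀ {b} → ¬ T b → b ≡ false
¬T⇒≡ {true} ¬t = ⊥-elim (¬t tt)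
¬T⇒≡ {false} _ = refl

clash : ∀ {b} → T b → ¬ T (not b)
clash {true} _ ()

∀Bool : (Bool → Bool) → Bool
∀Bool f = f true ∧ f false

∀Bool-elim : (f : Bool → Bool) → T (∀Bool f) → ∀ b → T (f b)
∀Bool-elim f h true = ∧-fst h
∀Bool-elim f h false = ∧-snd {f true} h

⟦_⟧ : Bool → ℕ
⟦ true ⟧ = 1
⟦ false ⟧ = 0

⟦⟧≤1 : ∀ b → ⟦ b ⟧ ≤ 1
⟦⟧≤1 true = ≤-refl
⟦⟧≤1 false = z≤n

⟦⟧-mono : ∀ {a b} → (T a → T b) → ⟦ a ⟧ ≤ ⟦ b ⟧
⟦⟧-mono {false} _ = z≤n
⟦⟧-mono {true} {true} _ = ≤-refl
⟦⟧-mono {true} {false} h = ⊥-elim (h tt)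

⟦⟧-not : ∀ b → ⟦ b ⟧ + ⟦ not b ⟧ ≡ 1
⟦⟧-not true = refl
⟦⟧-not false = refl

-- Sums and counts over lists

module _ {A : Set} where

  ∑ : List A → (A → ℕ) → ℕ
  ∑ [] f = 0
  ∑ (x ∷ xs) f = f x + ∑ xs f

  # : List A → (A → Bool) → ℕ
  # xs P = ∑ xs (λ x → ⟦ P x ⟧)

  ∑-mono : ∀ xs {f g : A → ℕ} → (∀ x → f x ≤ g x) → ∑ xs f ≤ ∑ xs g
  ∑-mono [] h = z≤n
  ∑-mono (x ∷ xs) h = +-mono-≤ (h x) (∑-mono xs h)

  ∑-mono-∈ : ∀ xs {f g : A → ℕ} → (∀ {x} → x ∈ xs → f x ≤ g x) → ∑ xs f ≤ ∑ xs g
  ∑-mono-∈ [] h = z≤n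
  ∑-mono-∈ (x ∷ xs) h = +-mono-≤ (h (here refl)) (∑-mono-∈ xs (h ∘ there))

  ∑-cong : ∀ xs {f g : A → ℕ} → (∀ x → f x ≡ g x) → ∑ xs f ≡ ∑ xs g
  ∑-cong [] h = refl
  ∑-cong (x ∷ xs) h = cong₂ _+_ (h x) (∑-cong xs h)

  ∑-+ : ∀ xs (f g : A → ℕ) → ∑ xs (λ x → f x + g x) ≡ ∑ xs f + ∑ xs g
  ∑-+ [] f g = refl
  ∑-+ (x ∷ xs) f g rewrite ∑-+ xs f g = lemma (f x) (g x) (∑ xs f) (∑ xs g)
    where
    lemma : ∀ a b c d → (a + b) + (c + d) ≡ (a + c) + (b + d)
    lemma = solve-∀

  ∑-*ˡ : ∀ xs k (f : A → ℕ) → ∑ xs (λ x → k * f x) ≡ k * ∑ xs f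
  ∑-*ˡ [] k f = sym (*-zeroʳ k)
  ∑-*ˡ (x ∷ xs) k f rewrite ∑-*ˡ xs k f = sym (*-distribˡ-+ k (f x) (∑ xs f))

  ∑-const : ∀ xs k → ∑ xs (λ _ → k) ≡ length xs * k
  ∑-const [] k = refl
  ∑-const (x ∷ xs) k = cong (k +_) (∑-const xs k)

  ∑-++ : ∀ xs ys (f : A → ℕ) → ∑ (xs ++ ys) f ≡ ∑ xs f + ∑ ys f
  ∑-++ [] ys f = refl
  ∑-++ (x ∷ xs) ys f rewrite ∑-++ xs ys f = sym (+-assoc (f x) _ _)

  ∑-↭ : ∀ {xs ys} (f : A → ℕ) → xs ↭ ys → ∑ xs f ≡ ∑ ys f
  ∑-↭ f _↭_.refl = refl
  ∑-↭ f (prep x p) = cong (f x +_) (∑-↭ f p)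
  ∑-↭ {xs = _ ∷ _ ∷ xs} f (swap x y p) rewrite ∑-↭ f p = lemma (f x) (f y) _
    where
    lemma : ∀ a b c → a + (b + c) ≡ b + (a + c)
    lemma = solve-∀
  ∑-↭ f (_↭_.trans p q) = trans (∑-↭ f p) (∑-↭ f q)

  #-mono : ∀ xs {P Q : A → Bool} → (∀ x → T (P x) → T (Q x)) → # xs P ≤ # xs Q
  #-mono xs h = ∑-mono xs (λ x → ⟦⟧-mono (h x))

  #≤length : ∀ xs (P : A → Bool) → # xs P ≤ length xs
  #≤length xs P = ≤-trans (∑-mono xs (λ x → ⟦⟧≤1 (P x)))
    (≤-reflexive (trans (∑-const xs 1) (*-identityʳ _)))

  #-not : ∀ xs (P : A → Bool) → # xs P + # xs (not ∘ P) ≡ length xs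
  #-not xs P = trans (sym (∑-+ xs _ _)) (trans (∑-cong xs (λ x → ⟦⟧-not (P x)))
    (trans (∑-const xs 1) (*-identityʳ _)))

  #-all : ∀ {xs} (P : A → Bool) → All (T ∘ P) xs → # xs P ≡ length xs
  #-all P [] = refl
  #-all P (px ∷ pxs) rewrite T⇒≡ px = cong suc (#-all P pxs)

  #-find : ∀ xs (P : A → Bool) → 0 < # xs P → ∃ λ x → x ∈ xs × T (P x)
  #-find (x ∷ xs) P h with P x in eq
  ... | true = x , here refl , ≡⇒T eq
  ... | false with #-find xs P h
  ...  | y , y∈ , py = y , there y∈ , py

  ∑-max : ∀ xs (f : A → ℕ) → 0 < length xs → ∃ λ x → x ∈ xs × ∑ xs f ≤ length xs * f x
  ∑-max (x ∷ []) f _ = x , here refl , ≤-refl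
  ∑-max (x ∷ xs@(_ ∷ _)) f _ with ∑-max xs f (s≤s z≤n)
  ... | y , y∈ , h with ≤-total (f x) (f y)
  ...  | inj₁ fx≤fy = y , there y∈ , +-mono-≤ fx≤fy h
  ...  | inj₂ fy≤fx = x , here refl , +-monoʳ-≤ (f x) (≤-trans h (*-monoʳ-≤ (length xs) fy≤fx))

  ∑-min : ∀ xs (f : A → ℕ) → 0 < length xs → ∃ λ x → x ∈ xs × length xs * f x ≤ ∑ xs f
  ∑-min (x ∷ []) f _ = x , here refl , ≤-refl
  ∑-min (x ∷ xs@(_ ∷ _)) f _ with ∑-min xs f (s≤s z≤n)
  ... | y , y∈ , h with ≤-total (f x) (f y)
  ...  | inj₂ fy≤fx = y , there y∈ , +-mono-≤ fy≤fx h
  ...  | inj₁ fx≤fy = x , here refl , +-monoʳ-≤ (f x) (≤-trans (*-monoʳ-≤ (length xs) fx≤fy) h)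

  keep : (A → Bool) → List A → List A
  keep P [] = []
  keep P (x ∷ xs) with P x
  ... | true = x ∷ keep P xs
  ... | false = keep P xs

  length-keep : ∀ P xs → length (keep P xs) ≡ # xs P
  length-keep P [] = refl
  length-keep P (x ∷ xs) with P x
  ... | true = cong suc (length-keep P xs)
  ... | false = length-keep P xs

  ∈-keep⁺ : ∀ P {xs x} → x ∈ xs → T (P x) → x ∈ keep P xs
  ∈-keep⁺ P {x ∷ xs} (here refl) px with P x
  ... | true = here refl
  ∈-keep⁺ P {y ∷ xs} (there x∈) px with P y
  ... | true = there (∈-keep⁺ P x∈ px)
  ... | false = ∈-keep⁺ P x∈ px

  keep-all : ∀ P xs → All (T ∘ P) (keep P xs)
  keep-all P [] = []
  keep-all P (x ∷ xs) with P x in eq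
  ... | true = ≡⇒T eq ∷ keep-all P xs
  ... | false = keep-all P xs

  keep-All : ∀ P {Q : A → Set} {xs} → All Q xs → All Q (keep P xs)
  keep-All P [] = []
  keep-All P {xs = x ∷ _} (q ∷ qs) with P x
  ... | true = q ∷ keep-All P qs
  ... | false = keep-All P qs

  keep-↭ : ∀ P xs → xs ↭ keep P xs ++ keep (not ∘ P) xs
  keep-↭ P [] = ↭-refl
  keep-↭ P (x ∷ xs) with P x
  ... | true = prep x (keep-↭ P xs)
  ... | false = ↭-trans (prep x (keep-↭ P xs)) (↭-sym (shift x (keep P xs) _))

  #-keep : ∀ P Q xs → # (keep P xs) Q ≡ # xs (λ x → P x ∧ Q x)
  #-keep P Q [] = refl
  #-keep P Q (x ∷ xs) with P x
  ... | true = cong (⟦ Q x ⟧ +_) (#-keep P Q xs)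
  ... | false = #-keep P Q xs

∑-swap : ∀ {A B : Set} (xs : List A) (ys : List B) (f : A → B → ℕ) →
  ∑ xs (λ x → ∑ ys (f x)) ≡ ∑ ys (λ y → ∑ xs (λ x → f x y))
∑-swap [] ys f = sym (trans (∑-const ys 0) (*-zeroʳ (length ys)))
∑-swap (x ∷ xs) ys f = trans (cong (∑ ys (f x) +_) (∑-swap xs ys f)) (sym (∑-+ ys (f x) _))

-- The point of Ω maximising the number of satisfied predicates satisfies a 1/k fraction of them.
select : ∀ {W X : Set} k (ws : List W) (Ω : List X) (P : W → X → Bool) →
  0 < length ws → 0 < length Ω → (∀ {w} → w ∈ ws → length Ω ≤ k * # Ω (P w)) →
  ∃ λ x → x ∈ Ω × length ws ≤ k * # ws (λ w → P w x)
select k ws Ω@(_ ∷ _) P ws≠ Ω≠ h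
  with x , x∈ , mx ← ∑-max Ω (λ x → # ws (λ w → P w x)) Ω≠ = x , x∈ ,
  *-cancelˡ-≤ (length Ω) (begin
    length Ω * length ws  ≡⟨ *-comm (length Ω) _ ⟩
    length ws * length Ω  ≡⟨ ∑-const ws (length Ω) ⟨
    ∑ ws (λ _ → length Ω)  ≤⟨ ∑-mono-∈ ws h ⟩
    ∑ ws (λ w → k * # Ω (P w))  ≡⟨ ∑-*ˡ ws k _ ⟩
    k * ∑ ws (λ w → # Ω (P w))  ≡⟨ cong (k *_) (∑-swap ws Ω _) ⟩
    k * ∑ Ω (λ x → # ws (λ w → P w x))  ≤⟨ *-monoʳ-≤ k mx ⟩
    k * (length Ω * # ws (λ w → P w x))  ≡⟨ lemma k (length Ω) _ ⟩
    length Ω * (k * # ws (λ w → P w x))  ∎)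
  where
  open ≤-Reasoning
  lemma : ∀ a b c → a * (b * c) ≡ b * (a * c)
  lemma = solve-∀

-- The reverse Markov inequality: the elements with d below n/(2k) contribute at most half of the
-- required sum, and each of the others contributes at most n.
markov : ∀ {A : Set} n k (xs : List A) (d : A → ℕ) → 0 < n → length xs ≤ n → (∀ x → d x ≤ n) →
  n * n ≤ k * ∑ xs d → n ≤ (2 * k) * # xs (λ x → n ≤ᵇ (2 * k) * d x)
markov n@(suc _) k xs d _ len d≤ h = *-cancelˡ-≤ n (+-cancelʳ-≤ (n * n) (n * n) _ (begin
  n * n + n * n  ≡⟨ l1 n ⟩
  2 * (n * n)  ≤⟨ *-monoʳ-≤ 2 h ⟩
  2 * (k * ∑ xs d)  ≡⟨ *-assoc 2 k _ ⟨
  (2 * k) * ∑ xs d  ≡⟨ ∑-*ˡ xs (2 * k) d ⟨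
  ∑ xs (λ x → (2 * k) * d x)  ≤⟨ ∑-mono xs pt ⟩
  ∑ xs (λ x → (2 * k * n) * ⟦ B x ⟧ + n)  ≡⟨ ∑-+ xs _ _ ⟩
  ∑ xs (λ x → (2 * k * n) * ⟦ B x ⟧) + ∑ xs (λ _ → n)  ≡⟨ cong₂ _+_ (∑-*ˡ xs (2 * k * n) _) (∑-const xs n) ⟩
  (2 * k * n) * # xs B + length xs * n  ≤⟨ +-monoʳ-≤ _ (*-monoˡ-≤ n len) ⟩
  (2 * k * n) * # xs B + n * n  ≡⟨ cong (_+ n * n) (l2 k n (# xs B)) ⟩
  n * (2 * k * # xs B) + n * n  ∎))
  where
  open ≤-Reasoning
  B : _ → Bool
  B x = n ≤ᵇ (2 * k) * d x
  l1 : ∀ a → a * a + a * a ≡ 2 * (a * a)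
  l1 = solve-∀
  l2 : ∀ a b c → (2 * a * b) * c ≡ b * (2 * a * c)
  l2 = solve-∀
  pt : ∀ x → (2 * k) * d x ≤ (2 * k * n) * ⟦ B x ⟧ + n
  pt x with B x in eq
  ... | true = ≤-trans (*-monoʳ-≤ (2 * k) (d≤ x)) (≤-trans (≤-reflexive (sym (*-identityʳ _))) (m≤m+n _ n))
  ... | false with ≤-total n (2 * k * d x)
  ...  | inj₁ le with () ← subst T eq (≤⇒≤ᵇ le)
  ...  | inj₂ ge = ≤-trans ge (m≤n+m n _)

-- Lists up to permutation and lists without repetition

Unique-↭ : ∀ {A : Set} {xs ys : List A} → xs ↭ ys → Unique xs → Unique ys
Unique-↭ {A} p = Permₛ.Unique-resp-↭ (setoid A) (↭⇒↭ₛ p)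

++-commutativeMonoid : Set → CommutativeMonoid 0ℓ 0ℓ
++-commutativeMonoid A = record { isCommutativeMonoid = ++-isCommutativeMonoid {A = A} }

module ↭-Solver (A : Set) = Algebra.Solver.CommutativeMonoid (++-commutativeMonoid A)

rotate : ∀ {A : Set} (xs ys zs : List A) → ys ++ (xs ++ zs) ↭ (xs ++ ys) ++ zs
rotate {A} = solve 3 (λ x y z → y ⊕ (x ⊕ z) ⊜ (x ⊕ y) ⊕ z) ↭-refl
  where open ↭-Solver A

interchange : ∀ {A : Set} (ws xs ys zs : List A) → (ws ++ xs) ++ (ys ++ zs) ↭ (ws ++ ys) ++ (xs ++ zs)
interchange {A} = solve 4 (λ w x y z → (w ⊕ x) ⊕ (y ⊕ z) ⊜ (w ⊕ y) ⊕ (x ⊕ z)) ↭-refl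
  where open ↭-Solver A

mem : ∀ {n} → List (Fin n) → Fin n → Bool
mem [] x = false
mem (y ∷ F) x = ⌊ x ≟ y ⌋ ∨ mem F x

mem-∈ : ∀ {n} {F : List (Fin n)} {x} → x ∈ F → T (mem F x)
mem-∈ {x = x} (here refl) with x ≟ x
... | yes _ = tt
... | no ne = ⊥-elim (ne refl)
mem-∈ {F = y ∷ F} {x} (there x∈) with x ≟ y
... | yes _ = tt
... | no _ = mem-∈ x∈

∈-mem : ∀ {n} (F : List (Fin n)) {x} → T (mem F x) → x ∈ F
∈-mem (y ∷ F) {x} h with x ≟ y
... | yes eq = here eq
... | no _ = there (∈-mem F h)

#-≡ : ∀ {n} (xs : List (Fin n)) y → Unique xs → # xs (λ x → ⌊ x ≟ y ⌋) ≤ 1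
#-≡ [] y _ = z≤n
#-≡ (x ∷ xs) y (x∉ ∷ u) with x ≟ y
... | no _ = #-≡ xs y u
... | yes refl = s≤s (≤-reflexive (none xs x∉))
  where
  none : ∀ zs → All (x ≢_) zs → # zs (λ z → ⌊ z ≟ x ⌋) ≡ 0
  none [] [] = refl
  none (z ∷ zs) (ne ∷ nes) with z ≟ x
  ... | yes refl = ⊥-elim (ne refl)
  ... | no _ = none zs nes

#-mem : ∀ {n} (xs F : List (Fin n)) → Unique xs → # xs (mem F) ≤ length F
#-mem xs [] u = ≤-reflexive (trans (∑-const xs 0) (*-zeroʳ (length xs)))
#-mem xs (y ∷ F) u = begin
  # xs (λ x → ⌊ x ≟ y ⌋ ∨ mem F x)  ≤⟨ ∑-mono xs (λ x → pt ⌊ x ≟ y ⌋ (mem F x)) ⟩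
  ∑ xs (λ x → ⟦ ⌊ x ≟ y ⌋ ⟧ + ⟦ mem F x ⟧)  ≡⟨ ∑-+ xs _ _ ⟩
  # xs (λ x → ⌊ x ≟ y ⌋) + # xs (mem F)  ≤⟨ +-mono-≤ (#-≡ xs y u) (#-mem xs F u) ⟩
  suc (length F)  ∎
  where
  open ≤-Reasoning
  pt : ∀ a b → ⟦ a ∨ b ⟧ ≤ ⟦ a ⟧ + ⟦ b ⟧
  pt true b = s≤s z≤n
  pt false b = ≤-refl

#-avoid : ∀ {n} (xs F : List (Fin n)) P → Unique xs →
  # xs P ≤ # xs (λ x → P x ∧ not (mem F x)) + length F
#-avoid xs F P u = begin
  # xs P  ≤⟨ ∑-mono xs (λ x → pt (P x) (mem F x)) ⟩
  ∑ xs (λ x → ⟦ P x ∧ not (mem F x) ⟧ + ⟦ mem F x ⟧)  ≡⟨ ∑-+ xs _ _ ⟩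
  # xs (λ x → P x ∧ not (mem F x)) + # xs (mem F)  ≤⟨ +-monoʳ-≤ _ (#-mem xs F u) ⟩
  # xs (λ x → P x ∧ not (mem F x)) + length F  ∎
  where
  open ≤-Reasoning
  pt : ∀ a b → ⟦ a ⟧ ≤ ⟦ a ∧ not b ⟧ + ⟦ b ⟧
  pt true true = ≤-refl
  pt true false = ≤-refl
  pt false b = z≤n

not-mem : ∀ {n} (F : List (Fin n)) {x} → T (not (mem F x)) → All (x ≢_) F
not-mem [] h = []
not-mem (y ∷ F) {x} h with x ≟ y
... | yes _ = ⊥-elim h
... | no ne = ne ∷ not-mem F h

length-cartesianProduct : ∀ {A B : Set} (xs : List A) (ys : List B) →
  length (cartesianProduct xs ys) ≡ length xs * length ys
length-cartesianProduct [] ys = refl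
length-cartesianProduct (x ∷ xs) ys = trans (length-++ (map (x ,_) ys))
  (cong₂ _+_ (length-map _ ys) (length-cartesianProduct xs ys))

length-allFin : ∀ n → length (allFin n) ≡ n
length-allFin n = length-tabulate {n = n} (λ x → x)

-- Shapes of tuples of vertices. `many s k P` is the iterated quantifier "at least n/k choices of the
-- first vertex such that, for at least n/k choices of the second one, …".

data Shape : Set where
  pt : Shape
  _⊗_ : Shape → Shape → Shape
  vec : Shape → ℕ → Shape

infixr 5 _⊗_

size : Shape → ℕ
size pt = 1
size (s ⊗ t) = size s + size t
size (vec s j) = j * size s

-- The factor by which `sel` may shrink the set of targets. Each vertex costs `2 * k` rather than
-- `k`, the 2 paying for the vertices already used.
cost : Shape → ℕ → ℕ
cost pt k = 2 * k
cost (s ⊗ t) k = cost s k * cost t k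
cost (vec s j) k = cost s k ^ j

module Tuples (n : ℕ) where

  El : Shape → Set
  El pt = Fin n
  El (s ⊗ t) = El s × El t
  El (vec s j) = Vec (El s) j

  verts : ∀ s → El s → List (Fin n)
  vertsᵛ : ∀ s {j} → Vec (El s) j → List (Fin n)
  verts pt x = x ∷ []
  verts (s ⊗ t) (x , y) = verts s x ++ verts t y
  verts (vec s j) xs = vertsᵛ s xs
  vertsᵛ s [] = []
  vertsᵛ s (x ∷ xs) = verts s x ++ vertsᵛ s xs

  length-verts : ∀ s x → length (verts s x) ≡ size s
  length-vertsᵛ : ∀ s {j} (xs : Vec (El s) j) → length (vertsᵛ s xs) ≡ j * size s
  length-verts pt x = refl
  length-verts (s ⊗ t) (x , y) = trans (length-++ (verts s x)) (cong₂ _+_ (length-verts s x) (length-verts t y))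
  length-verts (vec s j) xs = length-vertsᵛ s xs
  length-vertsᵛ s [] = refl
  length-vertsᵛ s (x ∷ xs) = trans (length-++ (verts s x)) (cong₂ _+_ (length-verts s x) (length-vertsᵛ s xs))

  opaque
    most : ℕ → (Fin n → Bool) → Bool
    most k P = n ≤ᵇ k * # (allFin n) P

    most⁺ : ∀ {k P} → n ≤ k * # (allFin n) P → T (most k P)
    most⁺ h = ≤⇒≤ᵇ h

    most⁻ : ∀ {k P} → T (most k P) → n ≤ k * # (allFin n) P
    most⁻ h = ≤ᵇ⇒≤ n _ h

  many : ∀ s → ℕ → (El s → Bool) → Bool
  manyᵛ : ∀ s j → ℕ → (Vec (El s) j → Bool) → Bool
  many pt k P = most k P
  many (s ⊗ t) k P = many s k (λ x → many t k (λ y → P (x , y)))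
  many (vec s j) k P = manyᵛ s j k P
  manyᵛ s zero k P = P []
  manyᵛ s (suc j) k P = many s k (λ x → manyᵛ s j k (λ xs → P (x ∷ xs)))

  many-mono : ∀ s {k P Q} → (∀ x → T (P x) → T (Q x)) → T (many s k P) → T (many s k Q)
  manyᵛ-mono : ∀ s j {k P Q} → (∀ x → T (P x) → T (Q x)) → T (manyᵛ s j k P) → T (manyᵛ s j k Q)
  many-mono pt {k} h p = most⁺ (≤-trans (most⁻ p) (*-monoʳ-≤ k (#-mono (allFin n) h)))
  many-mono (s ⊗ t) h = many-mono s (λ x → many-mono t (λ y → h (x , y)))
  many-mono (vec s j) h = manyᵛ-mono s j h
  manyᵛ-mono s zero h = h []
  manyᵛ-mono s (suc j) h = many-mono s (λ x → manyᵛ-mono s j (λ xs → h (x ∷ xs)))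

  many-up : ∀ s {k k′ P} → k ≤ k′ → T (many s k P) → T (many s k′ P)
  manyᵛ-up : ∀ s j {k k′ P} → k ≤ k′ → T (manyᵛ s j k P) → T (manyᵛ s j k′ P)
  many-up pt k≤ p = most⁺ (≤-trans (most⁻ p) (*-monoˡ-≤ _ k≤))
  many-up (s ⊗ t) k≤ p = many-mono s (λ x → many-up t k≤) (many-up s k≤ p)
  many-up (vec s j) k≤ p = manyᵛ-up s j k≤ p
  manyᵛ-up s zero k≤ p = p
  manyᵛ-up s (suc j) k≤ p = many-mono s (λ x → manyᵛ-up s j k≤) (many-up s k≤ p)

  private
    restrict : ∀ {W : Set} {ws : List W} {c d} (B : W → Bool) Q → length ws ≤ c * # ws B →
      length (keep B ws) ≤ d * # (keep B ws) Q → length ws ≤ c * d * # ws (λ w → B w ∧ Q w)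
    restrict {ws = ws} {c} {d} B Q h₁ h₂ = begin
      length ws  ≤⟨ h₁ ⟩
      c * # ws B  ≡⟨ cong (c *_) (length-keep B ws) ⟨
      c * length (keep B ws)  ≤⟨ *-monoʳ-≤ c h₂ ⟩
      c * (d * # (keep B ws) Q)  ≡⟨ *-assoc c d _ ⟨
      c * d * # (keep B ws) Q  ≡⟨ cong (c * d *_) (#-keep B Q ws) ⟩
      c * d * # ws (λ w → B w ∧ Q w)  ∎
      where open ≤-Reasoning

    nonempty : ∀ {W : Set} {ws : List W} {c} (B : W → Bool) → 0 < length ws → length ws ≤ c * # ws B →
      0 < length (keep B ws)
    nonempty {ws = ws} {c} B ws≠ h rewrite length-keep B ws with # ws B
    ... | suc _ = s≤s z≤n
    ... | zero rewrite *-zeroʳ c with () ← ≤-trans ws≠ h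

  length-extend : ∀ s x F c → length (verts s x ++ F) + c ≡ length F + (size s + c)
  length-extend s x F c rewrite length-++ (verts s x) {F} | length-verts s x = +-rotate (size s) (length F) c

  -- The coordinates are chosen one after the other, each choice keeping a constant fraction of ws alive.
  opaque
    sel : ∀ s k {W : Set} (ws : List W) (P : W → El s → Bool) F → Unique F → 0 < n → 2 * k * (length F + size s) ≤ n →
      0 < length ws → (∀ {w} → w ∈ ws → T (many s k (P w))) →
      ∃ λ x → Unique (verts s x ++ F) × length ws ≤ cost s k * # ws (λ w → P w x)
    selᵛ : ∀ s j k {W : Set} (ws : List W) (P : W → Vec (El s) j → Bool) F → Unique F →
      0 < n → 2 * k * (length F + j * size s) ≤ n → 0 < length ws → (∀ {w} → w ∈ ws → T (manyᵛ s j k (P w))) →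
      ∃ λ x → Unique (vertsᵛ s x ++ F) × length ws ≤ cost s k ^ j * # ws (λ w → P w x)
    -- The induction step common to products and nonempty vectors: the second component enters only
    -- through its vertex list, its quantifier and its own selection property. It is chosen for the
    -- targets that survive the first choice, so the costs multiply.
    sel₂ : ∀ s {B : Set} (vB : B → List (Fin n)) (mB : (B → Bool) → Bool) (szB cB k : ℕ) →
      (∀ {W : Set} (ws : List W) (P : W → B → Bool) F → Unique F → 0 < n → 2 * k * (length F + szB) ≤ n →
        0 < length ws → (∀ {w} → w ∈ ws → T (mB (P w))) →
        ∃ λ x → Unique (vB x ++ F) × length ws ≤ cB * # ws (λ w → P w x)) →
      ∀ {W : Set} (ws : List W) (P : W → El s → B → Bool) F → Unique F →
      0 < n → 2 * k * (length F + (size s + szB)) ≤ n → 0 < length ws →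
      (∀ {w} → w ∈ ws → T (many s k (λ x → mB (P w x)))) →
      ∃ λ x → ∃ λ y → Unique ((verts s x ++ vB y) ++ F) × length ws ≤ cost s k * cB * # ws (λ w → P w x y)

    sel pt k {W} ws P F uF n>0 hF ws≠ h
      = let x , _ , le = select (2 * k) ws (allFin n) P′ ws≠ (subst (0 <_) (sym (length-allFin n)) n>0) dense in
        x , not-mem F (∧-snd {P (proj₁ (hit le)) x} (proj₂ (hit le))) ∷ uF ,
        ≤-trans le (*-monoʳ-≤ (2 * k) (#-mono ws (λ w → ∧-fst)))
      where
      P′ : W → Fin n → Bool
      P′ w x = P w x ∧ not (mem F x)
      -- F has at most n/(2k) elements, so avoiding it destroys at most half of the n/k good
      -- vertices.
      dense : ∀ {w} → w ∈ ws → length (allFin n) ≤ 2 * k * # (allFin n) (P′ w)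
      dense {w} w∈ rewrite length-allFin n = +-cancelʳ-≤ n n _ (begin
        n + n  ≤⟨ +-mono-≤ hk hk ⟩
        k * c + k * c  ≤⟨ +-mono-≤ hc hc ⟩
        k * (c′ + f) + k * (c′ + f)  ≡⟨ l k c′ f ⟩
        2 * k * c′ + 2 * k * f  ≤⟨ +-monoʳ-≤ _ (≤-trans (*-monoʳ-≤ (2 * k) (m≤m+n f 1)) hF) ⟩
        2 * k * c′ + n  ∎)
        where
        open ≤-Reasoning
        c c′ f : ℕ
        c = # (allFin n) (P w)
        c′ = # (allFin n) (P′ w)
        f = length F
        hk : n ≤ k * c
        hk = most⁻ (h w∈)
        hc : k * c ≤ k * (c′ + f)
        hc = *-monoʳ-≤ k (#-avoid (allFin n) F (P w) (allFin⁺ n))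
        l : ∀ a b c → a * (b + c) + a * (b + c) ≡ 2 * a * b + 2 * a * c
        l = solve-∀
      -- That x avoids F is read off from a single target served by x; one exists because a positive
      -- fraction is served.
      hit : ∀ {x} → length ws ≤ 2 * k * # ws (λ w → P′ w x) → ∃ λ w → T (P′ w x)
      hit {x} le with # ws (λ w → P′ w x) in eq
      ... | zero rewrite *-zeroʳ (2 * k) with () ← ≤-trans ws≠ le
      ... | suc _ with w , _ , p ← #-find ws (λ w → P′ w x) (subst (0 <_) (sym eq) (s≤s z≤n)) = w , p
    sel (s ⊗ t) k ws P F uF n>0 hF ws≠ h
      with x , y , u , le ← sel₂ s (verts t) (many t k) (size t) (cost t k) k (sel t k) ws
                              (λ w x y → P w (x , y)) F uF n>0 hF ws≠ h
      = (x , y) , u , le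
    sel (vec s j) k = selᵛ s j k
    selᵛ s zero k ws P F uF n>0 hF ws≠ h = [] , uF ,
      ≤-reflexive (trans (sym (#-all (λ w → P w []) (All.tabulate h))) (sym (*-identityˡ _)))
    selᵛ s (suc j) k ws P F uF n>0 hF ws≠ h
      with x , y , u , le ← sel₂ s (vertsᵛ s) (manyᵛ s j k) (j * size s) (cost s k ^ j) k (selᵛ s j k) ws
                              (λ w x y → P w (x ∷ y)) F uF n>0 hF ws≠ h
      = x ∷ y , u , le
    sel₂ s vB mB szB cB k selB ws P F uF n>0 hF ws≠ h
      with x , u , le ← sel s k ws (λ w x → mB (P w x)) F uF n>0
             (≤-trans (*-monoʳ-≤ (2 * k) (+-monoʳ-≤ (length F) (m≤m+n (size s) szB))) hF) ws≠ h
      with y , v , le′ ← selB (keep (λ w → mB (P w x)) ws) (λ w y → P w x y) (verts s x ++ F) u n>0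
             (≤-trans (≤-reflexive (cong (2 * k *_) (length-extend s x F szB))) hF)
             (nonempty {ws = ws} {c = cost s k} (λ w → mB (P w x)) ws≠ le)
             (All.lookup (keep-all (λ w → mB (P w x)) ws))
      = x , y , Unique-↭ (rotate (verts s x) (vB y) F) v ,
        ≤-trans (restrict {ws = ws} {c = cost s k} (λ w → mB (P w x)) (λ w → P w x y) le le′)
          (*-monoʳ-≤ (cost s k * cB) (#-mono ws (λ w → ∧-snd {mB (P w x)})))

  enum : ∀ s → List (El s)
  enumᵛ : ∀ s j → List (Vec (El s) j)
  enum pt = allFin n
  enum (s ⊗ t) = cartesianProduct (enum s) (enum t)
  enum (vec s j) = enumᵛ s j
  enumᵛ s zero = [] ∷ []
  enumᵛ s (suc j) = map (λ (x , xs) → x ∷ xs) (cartesianProduct (enum s) (enumᵛ s j))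

  ∈-enum : ∀ s x → x ∈ enum s
  ∈-enumᵛ : ∀ s {j} (xs : Vec (El s) j) → xs ∈ enumᵛ s j
  ∈-enum pt x = ∈-allFin x
  ∈-enum (s ⊗ t) (x , y) = ∈-cartesianProduct⁺ (∈-enum s x) (∈-enum t y)
  ∈-enum (vec s j) xs = ∈-enumᵛ s xs
  ∈-enumᵛ s [] = here refl
  ∈-enumᵛ s (x ∷ xs) = ∈-map⁺ _ (∈-cartesianProduct⁺ (∈-enum s x) (∈-enumᵛ s xs))

  length-enum : ∀ s → length (enum s) ≡ n ^ size s
  length-enumᵛ : ∀ s j → length (enumᵛ s j) ≡ n ^ (j * size s)
  length-enum pt = trans (length-allFin n) (sym (*-identityʳ n))
  length-enum (s ⊗ t) = trans (length-cartesianProduct (enum s) (enum t))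
    (trans (cong₂ _*_ (length-enum s) (length-enum t)) (sym (^-distribˡ-+-* n (size s) (size t))))
  length-enum (vec s j) = length-enumᵛ s j
  length-enumᵛ s zero = refl
  length-enumᵛ s (suc j) = trans (length-map _ (cartesianProduct (enum s) (enumᵛ s j)))
    (trans (length-cartesianProduct (enum s) (enumᵛ s j))
      (trans (cong₂ _*_ (length-enum s) (length-enumᵛ s j)) (sym (^-distribˡ-+-* n (size s) (j * size s)))))

  allᵛ : ∀ {A : Set} {j} → (A → Bool) → Vec A j → Bool
  allᵛ P [] = true
  allᵛ P (x ∷ xs) = P x ∧ allᵛ P xs

  many-all : ∀ s j {k P} → T (many s k P) → T (many (vec s j) k (allᵛ P))
  many-all s zero p = tt
  many-all s (suc j) p = many-mono s (λ x px → manyᵛ-mono s j (λ xs pxs → ∧-intro px pxs) (many-all s j p)) p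

-- Copies of K³_{m,m}, tilings and factors

map-injective-∈ : ∀ {A B : Set} (f : A → B) {xs x y} → Unique (map f xs) → x ∈ xs → y ∈ xs → f x ≡ f y → x ≡ y
map-injective-∈ f u (here refl) (here refl) eq = refl
map-injective-∈ f (x∉ ∷ u) (here refl) (there y∈) eq = ⊥-elim (All.lookup x∉ (∈-map⁺ f y∈) eq)
map-injective-∈ f (x∉ ∷ u) (there x∈) (here refl) eq = ⊥-elim (All.lookup x∉ (∈-map⁺ f x∈) (sym eq))
map-injective-∈ f (_ ∷ u) (there x∈) (there y∈) eq = map-injective-∈ f u x∈ y∈ eq

kverts : ∀ m → List (KVert m)
kverts m = concatMap (λ i → inj₂ i ∷ []) (allFin m)
  ++ concatMap (λ i → inj₁ (i , zero) ∷ inj₁ (i , suc zero) ∷ []) (allFin m)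

∈-kverts : ∀ {m} (p : KVert m) → p ∈ kverts m
∈-kverts (inj₂ i) = ∈-++⁺ˡ (∈-concatMap⁺ _ (Any.map (λ { refl → here refl }) (∈-allFin i)))
∈-kverts {m} (inj₁ (i , zero)) = ∈-++⁺ʳ (concatMap (λ i → inj₂ i ∷ []) (allFin m))
  (∈-concatMap⁺ _ (Any.map (λ { refl → here refl }) (∈-allFin i)))
∈-kverts {m} (inj₁ (i , suc zero)) = ∈-++⁺ʳ (concatMap (λ i → inj₂ i ∷ []) (allFin m))
  (∈-concatMap⁺ _ (Any.map (λ { refl → there (here refl) }) (∈-allFin i)))

-- Y comes before the pairs X_i, so that the nested quantifier of `many` picks the pairs last, among
-- the pairs joined to all of Y.
tile : ℕ → Shape
tile m = vec pt m ⊗ vec (pt ⊗ pt) m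

module Tilings {n : ℕ} (H : ThreeGraph n) where
  open Tuples n

  adj : Fin n → Fin n × Fin n → Bool
  adj y (x , x′) = edge H x x′ y

  joined : ∀ {i j} → Vec (Fin n) i × Vec (Fin n × Fin n) j → Bool
  joined (ys , xs) = allᵛ (λ p → allᵛ (λ y → adj y p) ys) xs

  tilesVerts : ∀ {m} → List (El (tile m)) → List (Fin n)
  tilesVerts {m} = concatMap (verts (tile m))

  -- Disjointness of the tiles is implicit: a permutation respects multiplicities, so the tiles are
  -- disjoint as soon as L has no repetitions.
  Tileable : ℕ → List (Fin n) → Set
  Tileable m L = Σ (List (El (tile m))) λ ts → All (T ∘ joined) ts × L ↭ tilesVerts ts

  allᵛ-lookup : ∀ {A : Set} {j} (P : A → Bool) (xs : Vec A j) → T (allᵛ P xs) → ∀ i → T (P (Vec.lookup xs i))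
  allᵛ-lookup P (x ∷ xs) h zero = ∧-fst h
  allᵛ-lookup P (x ∷ xs) h (suc i) = allᵛ-lookup P xs (∧-snd {P x} h) i

  vertsᵛ-lookup : ∀ s {j} (xs : Vec (El s) j) → vertsᵛ s xs ≡ concatMap (λ i → verts s (Vec.lookup xs i)) (allFin j)
  vertsᵛ-lookup s [] = refl
  vertsᵛ-lookup s {suc j} (x ∷ xs) = cong (verts s x ++_) (trans (vertsᵛ-lookup s xs)
    (trans (sym (concatMap-map _ suc (allFin j)))
      (cong (concatMap (λ i → verts s (Vec.lookup (x ∷ xs) i))) (map-tabulate id suc))))

  at : ∀ {m} → El (tile m) → KVert m → Fin n
  at (ys , xs) (inj₁ (i , zero)) = proj₁ (Vec.lookup xs i)
  at (ys , xs) (inj₁ (i , suc zero)) = proj₂ (Vec.lookup xs i)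
  at (ys , xs) (inj₂ i) = Vec.lookup ys i

  verts-at : ∀ {m} (t : El (tile m)) → verts (tile m) t ≡ map (at t) (kverts m)
  verts-at {m} t@(ys , xs) = sym (trans (map-++ (at t) (concatMap _ (allFin m)) _)
    (cong₂ _++_ (trans (map-concatMap (at t) _ (allFin m)) (sym (vertsᵛ-lookup pt ys)))
                (trans (map-concatMap (at t) _ (allFin m)) (sym (vertsᵛ-lookup (pt ⊗ pt) xs)))))

  factor : ∀ {m} → Tileable m (allFin n) → KmmFactor m H
  factor {m} (ts , joins , perm) = length ts , φ , inj , surj , edges
    where
    φ : Fin (length ts) × KVert m → Fin n
    φ (c , p) = at (lookup ts c) p
    positions : List (Fin (length ts) × KVert m)
    positions = concatMap (λ c → map (c ,_) (kverts m)) (allFin (length ts))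
    ∈-positions : ∀ p → p ∈ positions
    ∈-positions (c , p) = ∈-concatMap⁺ _ (Any.map (λ { refl → ∈-map⁺ _ (∈-kverts p) }) (∈-allFin c))
    all-lookup : ts ≡ map (lookup ts) (allFin (length ts))
    all-lookup = sym (trans (map-tabulate id (lookup ts)) (tabulate-lookup ts))
    image : tilesVerts ts ≡ map φ positions
    image = trans (cong tilesVerts all-lookup) (trans (concatMap-map _ (lookup ts) (allFin (length ts)))
      (trans (concatMap-cong (λ c → trans (verts-at (lookup ts c)) (map-∘ (kverts m))) (allFin (length ts)))
        (sym (map-concatMap φ _ (allFin (length ts))))))
    perm′ : allFin n ↭ map φ positions
    perm′ = ↭-trans perm (↭-reflexive image)
    inj : ∀ p q → φ p ≡ φ q → p ≡ q
    inj p q = map-injective-∈ φ (Unique-↭ perm′ (allFin⁺ n)) (∈-positions p) (∈-positions q)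
    surj : ∀ v → ∃ λ p → φ p ≡ v
    surj v with p , _ , eq ← ∈-map⁻ φ (∈-resp-↭ perm′ (∈-allFin v)) = p , sym eq
    edges : ∀ c i y → edge H (φ (c , inj₁ (i , zero))) (φ (c , inj₁ (i , suc zero))) (φ (c , inj₂ y)) ≡ true
    edges c i y = T⇒≡ (allᵛ-lookup _ ys (allᵛ-lookup _ xs (All.lookup joins (∈-lookup c)) i) y)
      where
      ys = proj₁ (lookup ts c)
      xs = proj₂ (lookup ts c)

  tileable-[] : ∀ {m} → Tileable m []
  tileable-[] = [] , [] , ↭-refl

  tileable-↭ : ∀ {m L L′} → L ↭ L′ → Tileable m L → Tileable m L′
  tileable-↭ p (ts , a , q) = ts , a , ↭-trans (↭-sym p) q

  tileable-++ : ∀ {m L L′} → Tileable m L → Tileable m L′ → Tileable m (L ++ L′)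
  tileable-++ {m} (ts , a , p) (ts′ , a′ , p′) = ts ++ ts′ , Allₚ.++⁺ a a′ ,
    ↭-trans (++⁺ p p′) (↭-reflexive (sym (concatMap-++ (verts (tile m)) ts ts′)))

  tileable-tile : ∀ {m} (t : El (tile m)) → T (joined t) → Tileable m (verts (tile m) t)
  tileable-tile {m} t j = t ∷ [] , j ∷ [] , ↭-reflexive (sym (++-identityʳ (verts (tile m) t)))

  tileable-list : ∀ {m} (ts : List (El (tile m))) → All (T ∘ joined) ts → Tileable m (tilesVerts ts)
  tileable-list ts a = ts , a , ↭-refl

  length-tilesVerts : ∀ {m} (ts : List (El (tile m))) → length (tilesVerts ts) ≡ length ts * size (tile m)
  length-tilesVerts [] = refl
  length-tilesVerts {m} (t ∷ ts) = trans (length-++ (verts (tile m) t))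
    (cong₂ _+_ (length-verts (tile m) t) (length-tilesVerts ts))

  length-tileable : ∀ {m L} → Tileable m L → ∃ λ k → length L ≡ k * size (tile m)
  length-tileable (ts , _ , p) = length ts , trans (↭-length p) (length-tilesVerts ts)

-- Similarity, reachability and absorbing blocks

spread : ℕ → ℕ
spread k = k + (k′ + 2 * (k′ * k′))
  where
  k′ : ℕ
  k′ = k + 2 * (k * k)

spreads : ℕ → ℕ → ℕ
spreads zero k = k
spreads (suc j) k = spreads j (spread k)

k≤spread : ∀ k → k ≤ spread k
k≤spread k = m≤m+n k _

k≤spreads : ∀ j k → k ≤ spreads j k
k≤spreads zero k = ≤-refl
k≤spreads (suc j) k = ≤-trans (k≤spread k) (k≤spreads j (spread k))

-- switch m′ is the shape of a copy of K_{m,m} with one vertex of Y removed (m = suc m′); a gadget for (w , v)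
-- is a vertex a with two switches S, S′ such that S + w, S + a, S′ + a and S′ + v span copies of K_{m,m}.
switch : ℕ → Shape
switch m′ = vec pt m′ ⊗ vec (pt ⊗ pt) (suc m′)

gadgets : ℕ → Shape → Shape
gadgets m′ pt = pt ⊗ (switch m′ ⊗ switch m′)
gadgets m′ (s ⊗ t) = gadgets m′ s ⊗ gadgets m′ t
gadgets m′ (vec s j) = vec (gadgets m′ s) j

block : ℕ → Shape
block m′ = tile (suc m′) ⊗ gadgets m′ (tile (suc m′))

module Reachability {n : ℕ} (H : ThreeGraph n) where
  open Tuples n public
  open Tilings H public

  allᵛ-mono : ∀ {A : Set} {j} {P Q : A → Bool} (xs : Vec A j) → (∀ x → T (P x) → T (Q x)) → T (allᵛ P xs) → T (allᵛ Q xs)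
  allᵛ-mono [] h p = tt
  allᵛ-mono {P = P} (x ∷ xs) h p = ∧-intro (h x (∧-fst p)) (allᵛ-mono xs h (∧-snd {P x} p))

  module _ (n>0 : 0 < n) where

    -- Double counting: R holds for a 1/k² fraction of all pairs (x , y), and `markov` extracts from
    -- this many y with many x each.
    many-swap : ∀ k (R : Fin n → Fin n → Bool) → T (many pt k (λ x → many pt k (R x))) →
      T (many pt (2 * (k * k)) (λ y → many pt (2 * (k * k)) (λ x → R x y)))
    many-swap k R h = most⁺ (≤-trans (markov n (k * k) V (λ y → # V (λ x → R x y)) n>0 (≤-reflexive (length-allFin n))
      (λ y → ≤-trans (#≤length V _) (≤-reflexive (length-allFin n))) (begin
        n * n  ≤⟨ *-monoˡ-≤ n (most⁻ h) ⟩
        k * # V B * n  ≡⟨ l k (# V B) n ⟩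
        k * (n * # V B)  ≡⟨ cong (k *_) (∑-*ˡ V n _) ⟨
        k * ∑ V (λ x → n * ⟦ B x ⟧)  ≤⟨ *-monoʳ-≤ k (∑-mono V pw) ⟩
        k * ∑ V (λ x → k * # V (R x))  ≡⟨ cong (k *_) (∑-*ˡ V k _) ⟩
        k * (k * ∑ V (λ x → # V (R x)))  ≡⟨ *-assoc k k _ ⟨
        k * k * ∑ V (λ x → # V (R x))  ≡⟨ cong (k * k *_) (∑-swap V V _) ⟩
        k * k * ∑ V (λ y → # V (λ x → R x y))  ∎)) (*-monoʳ-≤ (2 * (k * k)) (#-mono V (λ x → most⁺ ∘ ≤ᵇ⇒≤ n _))))
      where
      open ≤-Reasoning
      V = allFin n
      B : Fin n → Bool
      B x = most k (R x)
      pw : ∀ x → n * ⟦ B x ⟧ ≤ k * # V (R x)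
      pw x with B x in eq
      ... | true = ≤-trans (≤-reflexive (*-identityʳ n)) (most⁻ (≡⇒T eq))
      ... | false = ≤-trans (≤-reflexive (*-zeroʳ n)) z≤n
      l : ∀ a b c → a * b * c ≡ a * (c * b)
      l = solve-∀

    -- The quantifier over y is moved to the front by two swaps, first past x′ and then past x. Each
    -- swap turns a constant k into 2k², and `spread` is large enough to dominate both.
    many-spread : ∀ k (Q : Fin n × Fin n → Bool) → T (many (pt ⊗ pt) k Q) →
      (∀ p → T (Q p) → T (many pt k (λ y → adj y p))) →
      T (many pt (spread k) (λ y → many (pt ⊗ pt) (spread k) (λ p → Q p ∧ adj y p)))
    many-spread k Q q d = many-mono pt (λ y → many-up (pt ⊗ pt) le₃ ∘ many-mono pt (λ x → many-up pt le₂))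
      (many-up pt le₃ (many-swap k′ _ (many-up pt (m≤m+n k _) (many-mono pt step q))))
      where
      k₁ k′ : ℕ
      k₁ = 2 * (k * k)
      k′ = k + k₁
      le₂ : k′ ≤ 2 * (k′ * k′)
      le₂ with k′
      ... | zero = z≤n
      ... | suc j = ≤-trans (m≤m*n (suc j) (suc j)) (m≤m+n _ _)
      le₃ : 2 * (k′ * k′) ≤ spread k
      le₃ = ≤-trans (m≤n+m _ k′) (m≤n+m _ k)
      step : ∀ x → T (many pt k (λ x′ → Q (x , x′))) →
        T (many pt k′ (λ y → many pt k′ (λ x′ → Q (x , x′) ∧ adj y (x , x′))))
      step x h = many-mono pt (λ y → many-up pt (m≤n+m k₁ k)) (many-up pt (m≤n+m k₁ k)
        (many-swap k _ (many-mono pt (λ x′ qx → many-mono pt (λ y → ∧-intro qx) (d (x , x′) qx)) h)))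

    -- The vertices y are chosen one at a time, Q being replaced by the pairs of Q joined to the
    -- last choice. The degree hypothesis survives since it passes to subsets of Q.
    many-joined : ∀ j k (Q : Fin n × Fin n → Bool) → T (many (pt ⊗ pt) k Q) →
      (∀ p → T (Q p) → T (many pt k (λ y → adj y p))) →
      T (many (vec pt j) (spreads j k) (λ ys → many (pt ⊗ pt) (spreads j k) (λ p → Q p ∧ allᵛ (λ y → adj y p) ys)))
    many-joined zero k Q q d = many-mono (pt ⊗ pt) (λ p qp → ∧-intro qp tt) q
    many-joined (suc j) k Q q d = many-mono pt
      (λ y q′ → manyᵛ-mono pt j (λ ys → many-mono (pt ⊗ pt) (λ p h →
          let h₁ = ∧-fst {Q p ∧ adj y p} h in
          ∧-intro (∧-fst {Q p} h₁) (∧-intro (∧-snd {Q p} h₁) (∧-snd {Q p ∧ adj y p} h))))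
        (many-joined j (spread k) (λ p → Q p ∧ adj y p) q′
          (λ p qp → many-up pt (k≤spread k) (d p (∧-fst {Q p} qp)))))
      (many-up pt (k≤spreads j (spread k)) (many-spread k Q q d))

  similar : ℕ → Fin n → Fin n → Bool
  similar k u a = many (pt ⊗ pt) k (λ p → adj u p ∧ adj a p)

  reach : ℕ → Fin n → Fin n → Bool
  reach k u v = many pt k (λ a → similar k u a ∧ similar k v a)

  reach-up : ∀ {k k′ u v} → k ≤ k′ → T (reach k u v) → T (reach k′ u v)
  reach-up {k} {k′} {u} {v} k≤ h = many-up pt k≤ (many-mono pt
    (λ a t → ∧-intro (many-up (pt ⊗ pt) k≤ (∧-fst {similar k u a} t)) (many-up (pt ⊗ pt) k≤ (∧-snd {similar k u a} t))) h)

  reachAll : ∀ s → ℕ → El s → El s → Bool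
  reachAllᵛ : ∀ s {j} → ℕ → Vec (El s) j → Vec (El s) j → Bool
  reachAll pt k w v = reach k w v
  reachAll (s ⊗ t) k (w , w′) (v , v′) = reachAll s k w v ∧ reachAll t k w′ v′
  reachAll (vec s j) k ws vs = reachAllᵛ s k ws vs
  reachAllᵛ s k [] [] = true
  reachAllᵛ s k (w ∷ ws) (v ∷ vs) = reachAll s k w v ∧ reachAllᵛ s k ws vs

  module _ (m′ : ℕ) where

    private m = suc m′

    add : Fin n → El (switch m′) → El (tile m)
    add w (ys , xs) = w ∷ ys , xs

    switches : Fin n → Fin n → El (switch m′) → Bool
    switches u a S = joined (add u S) ∧ joined (add a S)

    fits : ∀ s → El s → El s → El (gadgets m′ s) → Bool
    fitsᵛ : ∀ s {j} → Vec (El s) j → Vec (El s) j → Vec (El (gadgets m′ s)) j → Bool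
    fits pt w v (a , S , S′) = switches w a S ∧ switches v a S′
    fits (s ⊗ t) (w , w′) (v , v′) (g , g′) = fits s w v g ∧ fits t w′ v′ g′
    fits (vec s j) ws vs gs = fitsᵛ s ws vs gs
    fitsᵛ s [] [] [] = true
    fitsᵛ s (w ∷ ws) (v ∷ vs) (g ∷ gs) = fits s w v g ∧ fitsᵛ s ws vs gs

    absorbs : El (tile m) → El (block m′) → Bool
    absorbs w (K , g) = joined K ∧ fits (tile m) w K g

    suits : ℕ → El (tile m) → Bool
    suits k w = many (tile m) k (λ K → joined K ∧ reachAll (tile m) k w K)

    Absorbs : ℕ → ℕ → List (Fin n) → Set
    Absorbs k C F = ∀ us → All (T ∘ suits k) us → length us ≤ C → Tileable m (tilesVerts us ++ F)

    module _ (n>0 : 0 < n) (deg : ∀ x x′ → x ≢ x′ → T (many pt 3 (edge H x x′))) (k : ℕ) (k≥3 : 3 ≤ k) where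

      private κ = spreads m′ k

      deg-adj : ∀ u p → T (adj u p) → T (many pt k (λ y → adj y p))
      deg-adj u (x , x′) e = many-up pt k≥3 (deg x x′ (proj₁ (distinct H x x′ u (T⇒≡ e))))

      -- The pairs in both links are dense and each of them has many neighbours, so `many-joined`
      -- supplies the m′ remaining vertices of Y. The m pairs are then chosen independently from the
      -- same dense set; their disjointness is left to `sel`.
      many-switches : ∀ u a → T (similar k u a) → T (many (switch m′) κ (switches u a))
      many-switches u a h = manyᵛ-mono pt m′ (λ ys h′ → manyᵛ-mono (pt ⊗ pt) m {κ} {allᵛ (both ys)}
          {λ xs → switches u a (ys , xs)} (λ xs h″ → ∧-intro
            (allᵛ-mono {P = both ys} xs (λ p t → ∧-intro (∧-fst {adj u p} (∧-fst {adj u p ∧ adj a p} t)) (∧-snd {adj u p ∧ adj a p} t)) h″)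
            (allᵛ-mono {P = both ys} xs (λ p t → ∧-intro (∧-snd {adj u p} (∧-fst {adj u p ∧ adj a p} t)) (∧-snd {adj u p ∧ adj a p} t)) h″))
          (many-all (pt ⊗ pt) m {κ} {both ys} h′))
        (many-joined n>0 m′ k (λ p → adj u p ∧ adj a p) h (λ p e → deg-adj u p (∧-fst e)))
        where
        both : Vec (Fin n) m′ → Fin n × Fin n → Bool
        both ys p = (adj u p ∧ adj a p) ∧ allᵛ (λ y → adj y p) ys

      many-fits : ∀ s w v → T (reachAll s k w v) → T (many (gadgets m′ s) κ (fits s w v))
      many-fitsᵛ : ∀ s {j} (ws vs : Vec (El s) j) → T (reachAllᵛ s k ws vs) →
        T (manyᵛ (gadgets m′ s) j κ (fitsᵛ s ws vs))
      many-fits pt w v h = many-mono pt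
        (λ a sims → many-mono (switch m′) {κ} {switches w a} {λ S → many (switch m′) κ (λ S′ → fits pt w v (a , S , S′))}
            (λ S c → many-mono (switch m′) {κ} {switches v a} {λ S′ → fits pt w v (a , S , S′)} (λ S′ c′ → ∧-intro c c′)
            (many-switches v a (∧-snd {similar k w a} sims)))
          (many-switches w a (∧-fst sims)))
        (many-up pt (k≤spreads m′ k) h)
      many-fits (s ⊗ t) (w , w′) (v , v′) h = many-mono (gadgets m′ s)
        (λ g c → many-mono (gadgets m′ t) (λ g′ c′ → ∧-intro c c′) (many-fits t w′ v′ (∧-snd {reachAll s k w v} h)))
        (many-fits s w v (∧-fst h))
      many-fits (vec s j) ws vs h = many-fitsᵛ s ws vs h
      many-fitsᵛ s [] [] h = tt
      many-fitsᵛ s {suc j} (w ∷ ws) (v ∷ vs) h = many-mono (gadgets m′ s)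
        (λ g c → manyᵛ-mono (gadgets m′ s) j (λ gs c′ → ∧-intro c c′) (many-fitsᵛ s ws vs (∧-snd {reachAll s k w v} h)))
        (many-fits s w v (∧-fst h))

      many-absorbs : ∀ w → T (suits k w) → T (many (block m′) κ (absorbs w))
      many-absorbs w h = many-mono (tile m) {κ} {near} {λ K → many (gadgets m′ (tile m)) κ (λ g → absorbs w (K , g))}
        (λ K c → many-mono (gadgets m′ (tile m)) {κ} {fits (tile m) w K} {λ g → absorbs w (K , g)}
          (λ g c′ → ∧-intro (∧-fst {joined K} c) c′)
          (many-fits (tile m) w K (∧-snd {joined K} c)))
        (many-up (tile m) {k} {κ} {near} (k≤spreads m′ k) h)
        where
        near : El (tile m) → Bool
        near K = joined K ∧ reachAll (tile m) k w K

    tileable-fits : ∀ s w v g → T (fits s w v g) →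
      Tileable m (verts s w ++ verts (gadgets m′ s) g) × Tileable m (verts s v ++ verts (gadgets m′ s) g)
    tileable-fitsᵛ : ∀ s {j} (ws vs : Vec (El s) j) gs → T (fitsᵛ s ws vs gs) →
      Tileable m (vertsᵛ s ws ++ vertsᵛ (gadgets m′ s) gs) × Tileable m (vertsᵛ s vs ++ vertsᵛ (gadgets m′ s) gs)
    tileable-fits pt w v (a , S , S′) h =
        glue (add w S) (add a S′) (∧-fst c) (∧-snd {joined (add v S′)} c′) (prep w (shift a _ _))
      , glue (add a S) (add v S′) (∧-snd {joined (add w S)} c) (∧-fst c′)
          (↭-trans (prep a (shift v _ _)) (swap a v ↭-refl))
      where
      c = ∧-fst {switches w a S} h
      c′ = ∧-snd {switches w a S} h
      glue : ∀ {L} (t t′ : El (tile m)) → T (joined t) → T (joined t′) → verts (tile m) t ++ verts (tile m) t′ ↭ L → Tileable m L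
      glue t t′ j j′ p = tileable-↭ p (tileable-++ (tileable-tile t j) (tileable-tile t′ j′))
    tileable-fits (s ⊗ t) (w , w′) (v , v′) (g , g′) h
      with a , b ← tileable-fits s w v g (∧-fst h) | a′ , b′ ← tileable-fits t w′ v′ g′ (∧-snd {fits s w v g} h)
      = tileable-↭ (interchange (verts s w) _ _ _) (tileable-++ a a′) , tileable-↭ (interchange (verts s v) _ _ _) (tileable-++ b b′)
    tileable-fits (vec s j) ws vs gs h = tileable-fitsᵛ s ws vs gs h
    tileable-fitsᵛ s [] [] [] h = tileable-[] , tileable-[]
    tileable-fitsᵛ s (w ∷ ws) (v ∷ vs) (g ∷ gs) h
      with a , b ← tileable-fits s w v g (∧-fst h) | a′ , b′ ← tileable-fitsᵛ s ws vs gs (∧-snd {fits s w v g} h)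
      = tileable-↭ (interchange (verts s w) _ _ _) (tileable-++ a a′) , tileable-↭ (interchange (verts s v) _ _ _) (tileable-++ b b′)

    -- The two states of a block. While idle, the gadgets are tiled together with the vertices of K.
    -- To absorb w, they take w in place of these vertices, and K is released as a tile of its own.
    tileable-block : ∀ w b → T (absorbs w b) →
      Tileable m (verts (block m′) b) × Tileable m (verts (tile m) w ++ verts (block m′) b)
    tileable-block w (K , g) h with a , b ← tileable-fits (tile m) w K g (∧-snd {joined K} h)
      = b , tileable-↭ (shifts (verts (tile m) K) (verts (tile m) w)) (tileable-++ (tileable-tile K (∧-fst h)) a)

-- Greedy covering: r rounds suffice to exhaust n^s targets as soon as n^s < (1 + 1/q)^r.

factor-pos : ∀ {a c h} → 0 < a → a ≤ c * h → 0 < h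
factor-pos {c = c} {h = zero} a>0 le rewrite *-zeroʳ c with () ← ≤-trans a>0 le
factor-pos {h = suc _} _ _ = s≤s z≤n

bernoulli : ∀ q j → q ^ j * (q + j) ≤ suc q ^ j * q
bernoulli q zero = ≤-reflexive (cong (1 *_) (+-identityʳ q))
bernoulli q (suc j) = begin
  q * q ^ j * (q + suc j)  ≤⟨ m≤m+n _ (q ^ j * j) ⟩
  q * q ^ j * (q + suc j) + q ^ j * j  ≡⟨ l q (q ^ j) j ⟩
  suc q * (q ^ j * (q + j))  ≤⟨ *-monoʳ-≤ (suc q) (bernoulli q j) ⟩
  suc q * (suc q ^ j * q)  ≡⟨ *-assoc (suc q) (suc q ^ j) q ⟨
  suc q * suc q ^ j * q  ∎
  where
  open ≤-Reasoning
  l : ∀ a b c → a * b * (a + (1 + c)) + b * c ≡ (1 + a) * (b * (a + c))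
  l = solve-∀

^-distribʳ : ∀ a b e → (a * b) ^ e ≡ a ^ e * b ^ e
^-distribʳ a b zero = refl
^-distribʳ a b (suc e) rewrite ^-distribʳ a b e = l a b (a ^ e) (b ^ e)
  where
  l : ∀ a b c d → a * b * (c * d) ≡ a * c * (b * d)
  l = solve-∀

-- Order log n rounds would do, but a small linear number is affordable and needs only a crude
-- estimate. By `bernoulli`, n ≤ qM(1 + 1/q)^j. In the power s + 1 of this inequality the left side
-- has one factor n more than n^s, and this factor beats the constant (qM)^(s+1).
rounds : ∀ q M s n j → 0 < q → (q * M) ^ suc s < n → n ≤ j * M →
  n ^ s * q ^ (j * suc s) < suc q ^ (j * suc s)
rounds q@(suc _) M s n@(suc _) j _ big nj = ≰⇒> λ h → <-irrefl refl (begin-strict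
  A * n ^ s * (q * M) ^ e  ≡⟨ cong (_* (q * M) ^ e) (*-comm A (n ^ s)) ⟩
  n ^ s * A * (q * M) ^ e  <⟨ *-monoʳ-< (n ^ s * A) big ⟩
  n ^ s * A * n  ≡⟨ l₁ (n ^ s) A n ⟩
  A * n ^ e  ≡⟨ cong (_* n ^ e) (^-*-assoc q j e) ⟨
  (q ^ j) ^ e * n ^ e  ≡⟨ ^-distribʳ (q ^ j) n e ⟨
  (q ^ j * n) ^ e  ≤⟨ ^-monoˡ-≤ e (begin
      q ^ j * n  ≤⟨ *-monoʳ-≤ (q ^ j) nj ⟩
      q ^ j * (j * M)  ≡⟨ *-assoc (q ^ j) j M ⟨
      q ^ j * j * M  ≤⟨ *-monoˡ-≤ M (*-monoʳ-≤ (q ^ j) (m≤n+m j q)) ⟩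
      q ^ j * (q + j) * M  ≤⟨ *-monoˡ-≤ M (bernoulli q j) ⟩
      suc q ^ j * q * M  ≡⟨ *-assoc (suc q ^ j) q M ⟩
      suc q ^ j * (q * M)  ∎) ⟩
  (suc q ^ j * (q * M)) ^ e  ≡⟨ ^-distribʳ (suc q ^ j) (q * M) e ⟩
  (suc q ^ j) ^ e * (q * M) ^ e  ≡⟨ cong (_* (q * M) ^ e) (^-*-assoc (suc q) j e) ⟩
  B * (q * M) ^ e  ≤⟨ *-monoˡ-≤ ((q * M) ^ e) h ⟩
  n ^ s * A * (q * M) ^ e  ≡⟨ cong (_* (q * M) ^ e) (*-comm (n ^ s) A) ⟩
  A * n ^ s * (q * M) ^ e  ∎)
  where
  open ≤-Reasoning
  e A B : ℕ
  e = suc s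
  A = q ^ (j * e)
  B = suc q ^ (j * e)
  l₁ : ∀ a b c → a * b * c ≡ b * (c * a)
  l₁ = solve-∀
  instance
    _ : NonZero (n ^ s * A)
    _ = m*n≢0 (n ^ s) A ⦃ m^n≢0 n s ⦄ ⦃ m^n≢0 q (j * e) ⦄

-- At most a fraction 1 - 1/q of the targets is left. The weaker fraction q/(q + 1) is used because
-- it turns the invariant into an inequality between powers of q and q + 1.
fewer : ∀ {W : Set} q r (ws : List W) (hit : W → Bool) → length ws ≤ q * # ws hit →
  length ws * q ^ suc r < suc q ^ suc r → length (keep (not ∘ hit) ws) * q ^ r < suc q ^ r
fewer q r ws hit le few = *-cancelˡ-< (suc q) _ _ (begin-strict
  suc q * (u * q ^ r)  ≡⟨ *-assoc (suc q) u (q ^ r) ⟨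
  suc q * u * q ^ r  ≤⟨ *-monoˡ-≤ (q ^ r) {suc q * u} {q * length ws} (lin 0 le′ (l q u h (length ws) tot)) ⟩
  q * length ws * q ^ r  ≡⟨ l₂ q (length ws) (q ^ r) ⟩
  length ws * q ^ suc r  <⟨ few ⟩
  suc q ^ suc r  ∎)
  where
  open ≤-Reasoning
  u h : ℕ
  u = length (keep (not ∘ hit) ws)
  h = # ws hit
  le′ : length ws ≤ suc q * h
  le′ = ≤-trans le (*-monoˡ-≤ h {q} {suc q} (n≤1+n q))
  tot : h + u ≡ length ws
  tot = trans (cong (h +_) (length-keep (not ∘ hit) ws)) (#-not ws hit)
  l₁ : ∀ q u h → (1 + q) * u + (1 + q) * h + 0 ≡ q * (h + u) + (h + u)
  l₁ = solve-∀
  l : ∀ q u h w → h + u ≡ w → suc q * u + suc q * h + 0 ≡ q * w + w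
  l q u h _ refl = l₁ q u h
  l₂ : ∀ a b c → a * b * c ≡ b * (a * c)
  l₂ = solve-∀

-- Disjoint blocks forming an absorber

module Absorption (m′ : ℕ) {n : ℕ} (H : ThreeGraph n) (n>0 : 0 < n)
  (deg : ∀ x x′ → x ≢ x′ → T (Tuples.many n pt 3 (edge H x x′))) (k : ℕ) (k≥3 : 3 ≤ k)
  (κ q sz : ℕ) (hκ : spreads m′ k ≤ κ) (hq : cost (block m′) κ ≤ q) (hsz : size (block m′) ≡ sz) where
  open Reachability H

  private
    m : ℕ
    m = suc m′

  Absorbs₁ : El (tile m) → List (Fin n) → Set
  Absorbs₁ w F = Tileable m (verts (tile m) w ++ F)

  many-blocks : ∀ w → T (suits m′ k w) → T (many (block m′) κ (absorbs m′ w))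
  many-blocks w h = many-up (block m′) {spreads m′ k} {κ} {absorbs m′ w} hκ (many-absorbs m′ n>0 deg k k≥3 w h)

  pick : ∀ (ws : List (El (tile m))) F → Unique F → All (T ∘ suits m′ k) ws → 0 < length ws →
    2 * κ * (length F + sz) ≤ n →
    ∃ λ b → Unique (verts (block m′) b ++ F) × length ws ≤ q * # ws (λ w → absorbs m′ w b) ×
      Tileable m (verts (block m′) b)
  pick ws F uF dense ws≠ room = result (sel (block m′) κ ws (absorbs m′) F uF n>0
    (subst (λ z → 2 * κ * (length F + z) ≤ n) (sym hsz) room) ws≠
    (λ {w} w∈ → many-blocks w (All.lookup dense w∈)))
    where
    tileable : ∀ b → (∃ λ w → w ∈ ws × T (absorbs m′ w b)) → Tileable m (verts (block m′) b)
    tileable b (w , _ , hit) = proj₁ (tileable-block m′ w b hit)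
    result : (∃ λ b → Unique (verts (block m′) b ++ F) × length ws ≤ cost (block m′) κ * # ws (λ w → absorbs m′ w b)) →
      ∃ λ b → Unique (verts (block m′) b ++ F) × length ws ≤ q * # ws (λ w → absorbs m′ w b) ×
        Tileable m (verts (block m′) b)
    result (b , uB , le) = b , uB , ≤-trans le (*-monoˡ-≤ _ hq) ,
      tileable b (#-find ws (λ w → absorbs m′ w b) (factor-pos {c = cost (block m′) κ} ws≠ le))

  Collection : ℕ → List (El (tile m)) → List (Fin n) → Set
  Collection r ws F = ∃ λ F′ → Unique (F′ ++ F) × length F′ ≤ r * sz × Tileable m F′ × (∀ {w} → w ∈ ws → Absorbs₁ w F′)

  -- Targets absorbed by the new block are dropped and the others are left to the later rounds. For
  -- a given target, one block absorbs it and all other blocks are tiled in their idle state.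
  collect : ∀ r (ws : List (El (tile m))) F → Unique F → All (T ∘ suits m′ k) ws →
    length ws * q ^ r < suc q ^ r → 2 * κ * (length F + r * sz) ≤ n → Collection r ws F
  collect r [] F uF _ _ _ = [] , uF , z≤n , tileable-[] , λ ()
  collect zero (w ∷ ws) F uF _ few _ = ⊥-elim (<⇒≱ few (s≤s z≤n))
  collect (suc r) ws@(_ ∷ _) F uF dense few room = extend (pick ws F uF dense (s≤s z≤n)
      (≤-trans (*-monoʳ-≤ (2 * κ) (+-monoʳ-≤ (length F) (m≤m+n sz (r * sz)))) room))
    where
    hit : El (block m′) → El (tile m) → Bool
    hit b w = absorbs m′ w b
    finish : ∀ b → Tileable m (verts (block m′) b) →
      Collection r (keep (not ∘ hit b) ws) (verts (block m′) b ++ F) → Collection (suc r) ws F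
    finish b tilB (F′ , uF′ , len , til , abs) =
      F′ ++ verts (block m′) b , subst Unique (sym (++-assoc F′ _ F)) uF′ ,
      ≤-trans (≤-reflexive (trans (length-++ F′) (+-comm (length F′) _)))
        (+-mono-≤ (≤-reflexive (trans (length-verts (block m′) b) hsz)) len) ,
      tileable-++ til tilB , λ {w} → covers w (T? (hit b w))
      where
      covers : ∀ w → Dec (T (hit b w)) → w ∈ ws → Absorbs₁ w (F′ ++ verts (block m′) b)
      covers w (yes h) w∈ = tileable-↭ (shifts F′ (verts (tile m) w))
        (tileable-++ til (proj₂ (tileable-block m′ w b h)))
      covers w (no ¬h) w∈ = subst (Tileable m) (++-assoc (verts (tile m) w) F′ _)
        (tileable-++ (abs (∈-keep⁺ (not ∘ hit b) w∈ (subst (T ∘ not) (sym (¬T⇒≡ ¬h)) tt))) tilB)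
    extend : (∃ λ b → Unique (verts (block m′) b ++ F) × length ws ≤ q * # ws (hit b) ×
      Tileable m (verts (block m′) b)) → Collection (suc r) ws F
    extend (b , uB , le , tilB) = finish b tilB (collect r (keep (not ∘ hit b) ws) (verts (block m′) b ++ F) uB
      (keep-All (not ∘ hit b) dense) (fewer q r ws (hit b) le few)
      (≤-trans (≤-reflexive (cong (2 * κ *_)
        (trans (length-extend (block m′) b F (r * sz)) (cong (λ z → length F + (z + r * sz)) hsz)))) room))

  Absorber : ℕ → ℕ → List (Fin n) → Set
  Absorber C r F = ∃ λ F′ → Unique (F′ ++ F) × length F′ ≤ C * (r * sz) × Absorbs m′ k C F′

  -- A collection absorbs any single suitable tuple, so C disjoint collections absorb C of them, one
  -- tuple per collection; a collection without a tuple is tiled by itself.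
  absorber : ∀ C r F → Unique F → n ^ size (tile m) * q ^ r < suc q ^ r → 2 * κ * (length F + C * (r * sz)) ≤ n →
    Absorber C r F
  absorber zero r F uF few room = [] , uF , z≤n , λ { [] _ _ → tileable-[] }
  absorber (suc C) r F uF few room = first (collect r targets F uF (keep-all (suits m′ k) (enum (tile m)))
      (≤-<-trans (*-monoˡ-≤ (q ^ r) (≤-trans (≤-reflexive (length-keep (suits m′ k) (enum (tile m))))
        (≤-trans (#≤length (enum (tile m)) (suits m′ k)) (≤-reflexive (length-enum (tile m)))))) few)
      (≤-trans (*-monoʳ-≤ (2 * κ) (+-monoʳ-≤ (length F) (m≤m+n (r * sz) (C * (r * sz))))) room))
    where
    targets : List (El (tile m))
    targets = keep (suits m′ k) (enum (tile m))
    join : ∀ {F₁} → length F₁ ≤ r * sz → Tileable m F₁ → (∀ {w} → w ∈ targets → Absorbs₁ w F₁) →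
      Absorber C r (F₁ ++ F) → Absorber (suc C) r F
    join {F₁} len₁ til₁ abs₁ (F₂ , u₂ , len₂ , abs₂) =
      F₂ ++ F₁ , subst Unique (sym (++-assoc F₂ F₁ F)) u₂ ,
      ≤-trans (≤-reflexive (trans (length-++ F₂) (+-comm (length F₂) _))) (+-mono-≤ len₁ len₂) ,
      swallow
      where
      swallow : Absorbs m′ k (suc C) (F₂ ++ F₁)
      swallow [] _ _ = tileable-++ (abs₂ [] [] z≤n) til₁
      swallow (u ∷ us) (su ∷ sus) (s≤s le) = tileable-↭
        (↭-trans (interchange (verts (tile m) u) F₁ (tilesVerts us) F₂)
          (++⁺ˡ (verts (tile m) u ++ tilesVerts us) (++-comm F₁ F₂)))
        (tileable-++ (abs₁ (∈-keep⁺ (suits m′ k) (∈-enum (tile m) u) su)) (abs₂ us sus le))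
    first : Collection r targets F → Absorber (suc C) r F
    first (F₁ , u₁ , len₁ , til₁ , abs₁) = join len₁ til₁ abs₁ (absorber C r (F₁ ++ F) u₁ few
      (≤-trans (*-monoʳ-≤ (2 * κ) (≤-trans (≤-reflexive (trans (cong (_+ C * (r * sz)) (length-++ F₁))
        (+-rotate (length F₁) (length F) _))) (+-monoʳ-≤ (length F) (+-monoˡ-≤ (C * (r * sz)) len₁)))) room))

Absorbing : ℕ → ℕ → ℕ → ℕ → ∀ {n} → ThreeGraph n → Set
Absorbing m′ k g C {n} H = ∀ F → Unique F → 4 * spreads m′ k * length F ≤ n →
  ∃ λ F′ → Unique (F′ ++ F) × g * length F′ ≤ n × Reachability.Absorbs H m′ k C F′

absorbing : ∀ m′ k → 3 ≤ k → ∀ g C → Σ ℕ λ N → ∀ n → N ≤ n → (H : ThreeGraph n) → 0 < n →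
  (∀ x x′ → x ≢ x′ → T (Tuples.many n pt 3 (edge H x x′))) → Absorbing m′ k g C H
absorbing m′ k k≥3 g C = threshold′ (spreads m′ k) (cost (block m′) (spreads m′ k)) (size (block m′))
  (size (tile (suc m′))) refl refl refl refl
  where
  threshold′ : ∀ κ q₀ sz s → spreads m′ k ≡ κ → cost (block m′) (spreads m′ k) ≡ q₀ → size (block m′) ≡ sz →
    size (tile (suc m′)) ≡ s → Σ ℕ λ N → ∀ n → N ≤ n → (H : ThreeGraph n) → 0 < n →
    (∀ x x′ → x ≢ x′ → T (Tuples.many n pt 3 (edge H x x′))) → Absorbing m′ k g C H
  threshold′ κ q₀ sz s refl hq hsz hs = suc ((q * M) ^ suc s) + M , prove
    where
    q M₀ M G : ℕ
    q = suc q₀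
    -- The two summands of G serve the size bound on the absorber and the room required by `sel`.
    -- For j = 1 + n/M the absorber has at most X vertices with G · X = j · M₀. Since j · M ≤ 2n, a
    -- value of M above 2 · M₀ makes G · X at most n.
    G = g + 4 * κ
    M₀ = G * (C * (suc s * sz))
    M = suc (2 * M₀)
    prove : ∀ n → suc ((q * M) ^ suc s) + M ≤ n → (H : ThreeGraph n) → 0 < n →
      (∀ x x′ → x ≢ x′ → T (Tuples.many n pt 3 (edge H x x′))) → Absorbing m′ k g C H
    prove n big H n>0 deg F uF room = result (Absorption.absorber m′ H n>0 deg k k≥3 κ q sz ≤-refl
        (≤-trans (≤-reflexive hq) (n≤1+n q₀)) hsz C (j * suc s) F uF
        (subst (λ z → n ^ z * q ^ (j * suc s) < suc q ^ (j * suc s)) (sym hs) (rounds q M s n j (s≤s z≤n) (≤-trans (m≤m+n (suc ((q * M) ^ suc s)) M) big) n≤jM)) room′)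
      where
      open ≤-Reasoning
      j X : ℕ
      j = suc (n / M)
      X = C * (j * suc s * sz)
      n≤jM : n ≤ j * M
      n≤jM = begin
        n  ≡⟨ m≡m%n+[m/n]*n n M ⟩
        n % M + n / M * M  ≤⟨ +-monoˡ-≤ (n / M * M) (<⇒≤ (m%n<n n M)) ⟩
        M + n / M * M  ∎
      small : G * X ≤ n
      small = *-cancelˡ-≤ 2 (begin
        2 * (G * (C * (j * suc s * sz)))  ≡⟨ l G C j (suc s) sz ⟩
        j * (2 * M₀)  ≤⟨ *-monoʳ-≤ j (n≤1+n (2 * M₀)) ⟩
        M + n / M * M  ≤⟨ +-mono-≤ (≤-trans (m≤n+m M (suc ((q * M) ^ suc s))) big) (m/n*n≤m n M) ⟩
        n + n  ≡⟨ cong (n +_) (+-identityʳ n) ⟨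
        2 * n  ∎)
        where
        l : ∀ G C j e z → 2 * (G * (C * (j * e * z))) ≡ j * (2 * (G * (C * (e * z))))
        l = solve-∀
      room′ : 2 * κ * (length F + X) ≤ n
      room′ = *-cancelˡ-≤ 2 (begin
        2 * (2 * κ * (length F + X))  ≡⟨ l κ (length F) X ⟩
        4 * κ * length F + 4 * κ * X  ≤⟨ +-mono-≤ room (≤-trans (*-monoˡ-≤ X (m≤n+m (4 * κ) g)) small) ⟩
        n + n  ≡⟨ cong (n +_) (+-identityʳ n) ⟨
        2 * n  ∎)
        where
        l : ∀ a b c → 2 * (2 * a * (b + c)) ≡ 4 * a * b + 4 * a * c
        l = solve-∀
      result : (∃ λ F′ → Unique (F′ ++ F) × length F′ ≤ X × Reachability.Absorbs H m′ k C F′) →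
        ∃ λ F′ → Unique (F′ ++ F) × g * length F′ ≤ n × Reachability.Absorbs H m′ k C F′
      result (F′ , u , len , abs) = F′ , u , ≤-trans (*-mono-≤ (m≤m+n g (4 * κ)) len) small , abs

-- Almost perfect tilings

concatMap-↭ : ∀ {A B : Set} (f : A → List B) {xs ys} → xs ↭ ys → concatMap f xs ↭ concatMap f ys
concatMap-↭ f _↭_.refl = ↭-refl
concatMap-↭ f (prep x p) = ++⁺ˡ (f x) (concatMap-↭ f p)
concatMap-↭ f (swap x y p) = ↭-trans (shifts (f x) (f y)) (++⁺ˡ (f y) (++⁺ˡ (f x) (concatMap-↭ f p)))
concatMap-↭ f (_↭_.trans p q) = ↭-trans (concatMap-↭ f p) (concatMap-↭ f q)

∈-split : ∀ {A : Set} {x : A} {xs} → x ∈ xs → ∃ λ ys → xs ↭ x ∷ ys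
∈-split {xs = x ∷ xs} (here refl) = xs , ↭-refl
∈-split {xs = y ∷ xs} (there x∈) with ys , p ← ∈-split x∈ = y ∷ ys , ↭-trans (prep y p) (swap y _ ↭-refl)

flat : ∀ {A : Set} → List (A × A) → List A
flat = concatMap (λ (x , x′) → x ∷ x′ ∷ [])

length-flat : ∀ {A : Set} (ps : List (A × A)) → length (flat ps) ≡ length ps * 2
length-flat [] = refl
length-flat (_ ∷ ps) = cong (λ l → suc (suc l)) (length-flat ps)

pairUp : ∀ {A : Set} j (l : List A) → length l ≡ j * 2 → ∃ λ ps → length ps ≡ j × flat ps ≡ l
pairUp zero [] eq = [] , refl , refl
pairUp (suc j) (x ∷ y ∷ l) eq with ps , len , eq′ ← pairUp j l (suc-injective (suc-injective eq)) =
  (x , y) ∷ ps , cong suc len , cong (λ l → x ∷ y ∷ l) eq′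

takeVec : ∀ {A : Set} j (l : List A) → j ≤ length l → ∃ λ (v : Vec A j) → ∃ λ rest → l ≡ toList v ++ rest
takeVec zero l _ = [] , l , refl
takeVec (suc j) (x ∷ l) (s≤s le) with v , rest , refl ← takeVec j l le = x ∷ v , rest , refl

cut-length : ∀ {A : Set} {j c} (v : Vec A j) {l : List A} → length (toList v ++ l) ≡ j + c → length l ≡ c
cut-length {j = j} v {l} eq =
  +-cancelˡ-≡ j _ _ (trans (sym (trans (length-++ (toList v)) (cong (_+ length l) (Vecₚ.length-toList v)))) eq)

splitAt′ : ∀ {A : Set} j (l : List A) → j ≤ length l → ∃ λ xs → ∃ λ ys → l ≡ xs ++ ys × length xs ≡ j
splitAt′ zero l _ = [] , l , refl , refl
splitAt′ (suc j) (x ∷ l) (s≤s le) with xs , ys , refl , len ← splitAt′ j l le = x ∷ xs , ys , refl , cong suc len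

module Cutting {n : ℕ} (H : ThreeGraph n) where
  open Reachability H public

  vertsᵛ-toList : ∀ {j} (v : Vec (Fin n) j) → vertsᵛ pt v ≡ toList v
  vertsᵛ-toList [] = refl
  vertsᵛ-toList (x ∷ v) = cong (x ∷_) (vertsᵛ-toList v)

  vertsᵛ-flat : ∀ {j} (v : Vec (Fin n × Fin n) j) → vertsᵛ (pt ⊗ pt) v ≡ flat (toList v)
  vertsᵛ-flat [] = refl
  vertsᵛ-flat ((x , x′) ∷ v) = cong (λ l → x ∷ x′ ∷ l) (vertsᵛ-flat v)

  allᵛ-toList : ∀ {A : Set} {j} {P : A → Bool} (v : Vec A j) → All (T ∘ P) (toList v) → T (allᵛ P v)
  allᵛ-toList [] [] = tt
  allᵛ-toList (x ∷ v) (p ∷ ps) = ∧-intro p (allᵛ-toList v ps)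

  Within : ∀ {m} → List (Fin n) → List (Fin n × Fin n) → El (tile m) → Set
  Within ys ps (v , w) = All (_∈ ys) (toList v) × All (_∈ ps) (toList w)

  tilesOf : ∀ m k ys ps → length ys ≡ k * m → length ps ≡ k * m →
    ∃ λ (ts : List (El (tile m))) → length ts ≡ k × tilesVerts ts ↭ ys ++ flat ps × All (Within ys ps) ts
  tilesOf m zero [] [] _ _ = [] , refl , ↭-refl , []
  tilesOf m (suc k) ys ps ly lp
    with v , ys′ , refl ← takeVec m ys (subst (m ≤_) (sym ly) (m≤m+n m _))
       | w , ps′ , refl ← takeVec m ps (subst (m ≤_) (sym lp) (m≤m+n m _))
    with ts , lt , perm , within ← tilesOf m k ys′ ps′ (cut-length v ly) (cut-length w lp)
    = (v , w) ∷ ts , cong suc lt ,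
      ↭-trans (++⁺ (↭-reflexive (cong₂ _++_ (vertsᵛ-toList v) (vertsᵛ-flat w))) perm)
        (↭-trans (interchange (toList v) (flat (toList w)) ys′ (flat ps′))
          (++⁺ˡ (toList v ++ ys′) (↭-reflexive (sym (concatMap-++ _ (toList w) ps′))))) ,
      (All.tabulate ∈-++⁺ˡ , All.tabulate ∈-++⁺ˡ) ∷
      All.map (λ (a , b) → All.map (∈-++⁺ʳ (toList v)) a , All.map (∈-++⁺ʳ (toList w)) b) within

  nbr : Fin n × Fin n → Fin n → Bool
  nbr p y = adj y p

  joined-within : ∀ {m ys ps} {t : El (tile m)} → All (λ y → All (λ p → T (nbr p y)) ps) ys → Within ys ps t → T (joined t)
  joined-within {t = v , w} h (a , b) = allᵛ-toList w (All.map (λ p∈ → allᵛ-toList v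
    (All.map (λ y∈ → All.lookup (All.lookup h y∈) p∈) a)) b)

  -- Keep the larger half of the pairs at each vertex of vs.
  homogenise : ∀ vs (ps : List (Fin n × Fin n)) → ∃ λ ps′ → ∃ λ rest → ps ↭ ps′ ++ rest ×
    length ps ≤ 2 ^ length vs * length ps′ ×
    ∃ λ S → ∃ λ S̄ → vs ↭ S ++ S̄ × All (λ y → All (λ p → T (nbr p y)) ps′) S ×
      (∀ {p} → p ∈ ps′ → # S̄ (nbr p) ≡ 0)
  homogenise [] ps = ps , [] , ↭-reflexive (sym (++-identityʳ ps)) , ≤-reflexive (sym (*-identityˡ _)) ,
    [] , [] , ↭-refl , [] , λ _ → refl
  homogenise (v ∷ vs) ps = halves (≤-total (length A) (length B))
    where
    A B : List (Fin n × Fin n)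
    A = keep (λ p → nbr p v) ps
    B = keep (not ∘ (λ p → nbr p v)) ps
    A+B : length ps ≡ length A + length B
    A+B = trans (↭-length (keep-↭ (λ p → nbr p v) ps)) (length-++ A)
    Result : Set
    Result = ∃ λ ps′ → ∃ λ rest → ps ↭ ps′ ++ rest ×
      length ps ≤ 2 ^ suc (length vs) * length ps′ ×
      ∃ λ S → ∃ λ S̄ → v ∷ vs ↭ S ++ S̄ × All (λ y → All (λ p → T (nbr p y)) ps′) S ×
        (∀ {p} → p ∈ ps′ → # S̄ (nbr p) ≡ 0)
    bound : ∀ {x y z} c → x ≡ y + z → z ≤ y → ∀ {w} → y ≤ c * w → x ≤ (2 * c) * w
    bound {y = y} c refl z≤y {w} le = ≤-trans (+-mono-≤ le (≤-trans z≤y le)) (≤-reflexive (l c w))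
      where
      l : ∀ c w → c * w + c * w ≡ (2 * c) * w
      l = solve-∀
    halves : length A ≤ length B ⊎ length B ≤ length A → Result
    halves (inj₂ B≤A) with ps′ , rest , perm , le , S , S̄ , vperm , hS , hS̄ ← homogenise vs A =
      ps′ , rest ++ B , ↭-trans (keep-↭ _ ps) (↭-trans (++⁺ʳ B perm) (↭-reflexive (++-assoc ps′ rest B))) ,
      bound (2 ^ length vs) A+B B≤A le ,
      v ∷ S , S̄ , prep v vperm , Allₚ.++⁻ˡ ps′ (All-resp-↭ perm (keep-all _ ps)) ∷ hS , hS̄
    halves (inj₁ A≤B) with ps′ , rest , perm , le , S , S̄ , vperm , hS , hS̄ ← homogenise vs B =
      ps′ , rest ++ A , ↭-trans (keep-↭ _ ps) (↭-trans (++-comm A B) (↭-trans (++⁺ʳ A perm) (↭-reflexive (++-assoc ps′ rest A)))) ,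
      bound (2 ^ length vs) (trans A+B (+-comm (length A) _)) A≤B le ,
      S , v ∷ S̄ , ↭-trans (prep v vperm) (↭-sym (shift v S S̄)) , hS ,
      λ {p} p∈ → trans (cong (_+ # S̄ (nbr p)) (none (All.lookup (Allₚ.++⁻ˡ ps′ (All-resp-↭ perm (keep-all _ ps))) p∈))) (hS̄ p∈)
      where
      none : ∀ {b} → T (not b) → ⟦ b ⟧ ≡ 0
      none {false} _ = refl

  -- A cell built below consists of two tiles or of as many uncovered vertices. Equal sizes allow
  -- the degree of a pair to be averaged over the cells, and the cells without tiles keep this
  -- possible while most vertices are still uncovered.
  Cell : ℕ → Set
  Cell m = List (El (tile m)) × List (Fin n)

  cellVerts : ∀ {m} → Cell m → List (Fin n)
  cellVerts (ts , ws) = tilesVerts ts ++ ws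

  IsCell : ∀ {m} → Cell m → Set
  IsCell {m} c = length (cellVerts c) ≡ 2 * size (tile m) × length (proj₁ c) ≤ 2

  couples : ∀ {m} (ts : List (El (tile m))) → ∃ λ (cs : List (Cell m)) → ∃ λ rest →
    ts ≡ concatMap proj₁ cs ++ rest × concatMap proj₂ cs ≡ [] × All IsCell cs × length rest ≤ 1
  couples [] = [] , [] , refl , refl , [] , z≤n
  couples (t ∷ []) = [] , t ∷ [] , refl , refl , [] , ≤-refl
  couples {m} (t ∷ t′ ∷ ts) with cs , rest , refl , eq , cells , len ← couples ts =
    (t ∷ t′ ∷ [] , []) ∷ cs , rest , refl , eq ,
    (trans (length-++ (tilesVerts (t ∷ t′ ∷ []))) (trans (+-identityʳ _) (length-tilesVerts (t ∷ t′ ∷ []))) , ≤-refl) ∷ cells , len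

  chunks : ∀ {m} c → 0 < c → c ≡ 2 * size (tile m) → ∀ fuel (ws : List (Fin n)) → length ws ≤ fuel →
    ∃ λ (cs : List (Cell m)) → ∃ λ rest →
    ws ≡ concatMap proj₂ cs ++ rest × concatMap proj₁ cs ≡ [] × All IsCell cs × length rest ≤ c
  chunks c c>0 eq zero [] le = [] , [] , refl , refl , [] , z≤n
  chunks c c>0 eq (suc fuel) ws le with c ≤? length ws
  ... | no c≰ = [] , ws , refl , refl , [] , <⇒≤ (≰⇒> c≰)
  ... | yes c≤ with xs , ys , refl , len ← splitAt′ c ws c≤
    with cs , rest , eq″ , eq′ , cells , lenr ← chunks c c>0 eq fuel ys
           (s≤s⁻¹ (≤-trans (+-monoˡ-≤ (length ys) (subst (1 ≤_) (sym len) c>0)) (≤-trans (≤-reflexive (sym (length-++ xs))) le)))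
    = ([] , xs) ∷ cs , rest , trans (cong (xs ++_) eq″) (sym (++-assoc xs _ rest)) , eq′ , (trans len eq , z≤n) ∷ cells , lenr

∑-concatMap : ∀ {A B : Set} (xs : List A) (f : A → List B) g → ∑ (concatMap f xs) g ≡ ∑ xs (λ x → ∑ (f x) g)
∑-concatMap [] f g = refl
∑-concatMap (x ∷ xs) f g = trans (∑-++ (f x) _ g) (cong (∑ (f x) g +_) (∑-concatMap xs f g))

complement : ∀ {n} (F : List (Fin n)) → Unique F → ∃ λ W → allFin n ↭ W ++ F
complement {n} [] _ = allFin n , ↭-reflexive (sym (++-identityʳ _))
complement (x ∷ F) (x∉ ∷ u) = remove (complement F u)
  where
  remove : (∃ λ W → allFin _ ↭ W ++ F) → ∃ λ W → allFin _ ↭ W ++ x ∷ F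
  remove (W , p) = drop-x (∈-++⁻ W (∈-resp-↭ p (∈-allFin x)))
    where
    drop-x : x ∈ W ⊎ x ∈ F → ∃ λ W → allFin _ ↭ W ++ x ∷ F
    drop-x (inj₁ x∈W) with W′ , q ← ∈-split x∈W = W′ , ↭-trans p (↭-trans (++⁺ʳ F q) (↭-sym (shift x W′ F)))
    drop-x (inj₂ x∈F) = ⊥-elim (All.lookup x∉ x∈F refl)

Unique-++ʳ : ∀ {A : Set} (xs : List A) {ys} → Unique (xs ++ ys) → Unique ys
Unique-++ʳ [] u = u
Unique-++ʳ (x ∷ xs) (_ ∷ u) = Unique-++ʳ xs u

Unique-++ˡ : ∀ {A : Set} (xs : List A) {ys} → Unique (xs ++ ys) → Unique xs
Unique-++ˡ xs {ys} u = Unique-++ʳ ys (Unique-↭ (++-comm xs ys) u)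

flat-distinct : ∀ {A : Set} (ps : List (A × A)) → Unique (flat ps) → All (λ (x , x′) → x ≢ x′) ps
flat-distinct [] _ = []
flat-distinct (_ ∷ ps) ((x≢ ∷ _) ∷ _ ∷ u) = x≢ ∷ flat-distinct ps u

size-tile : ∀ m → size (tile m) ≡ 3 * m
size-tile m = l m
  where
  l : ∀ m → m * 1 + m * 2 ≡ 3 * m
  l = solve-∀

-- Of Q leftover pairs at least Q/K are good for a common cell. Each of the 2s halvings of
-- `homogenise` keeps at least half of them, so 3m pairs survive, which is what three tiles need.
module AlmostTiling (m′ : ℕ) {n : ℕ} (H : ThreeGraph n)
  (deg : ∀ x x′ → x ≢ x′ → n ≤ 2 * # (allFin n) (edge H x x′) + 3)
  (K Q : ℕ) (K-def : K ≡ 2 * (3 * suc m′ + 1)) (Q-def : Q ≡ K * (2 ^ (2 * size (tile (suc m′))) * (3 * suc m′)))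
  (F : List (Fin n)) where
  open Cutting H

  private
    m s ign : ℕ
    m = suc m′
    s = size (tile m)
    -- A bound on the vertices outside the cells: an unpaired tile, the remainder of the uncovered
    -- vertices, the Q selected pairs, and F.
    ign = s + (2 * s + (Q * 2 + length F))

  module _ (room : 2 * s * (2 * ign + 3) + ign ≤ n) where

    good : Fin n × Fin n → Cell m → Bool
    good p c = s ≤ᵇ # (cellVerts c) (nbr p)

    -- Since 2s is even, a cell with fewer than half of its vertices adjacent to p falls short of half by at
    -- least one; this slack pays for the ignored vertices.
    good-dense : ∀ (cs : List (Cell m)) R → All IsCell cs → allFin n ↭ concatMap cellVerts cs ++ R → length R ≤ ign →
      ∀ p → proj₁ p ≢ proj₂ p → 0 < length cs × length cs ≤ K * # cs (good p)
    good-dense cs R cells perm lenR p p≢ = ≤-trans (s≤s z≤n) τ-large , final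
      where
      open ≤-Reasoning
      τ D G r : ℕ
      τ = length cs
      D = # (concatMap cellVerts cs) (nbr p)
      G = # cs (good p)
      r = length R
      total : 2 * s * τ + r ≡ n
      total = begin-equality
        2 * s * τ + r  ≡⟨ cong (_+ r) (*-comm (2 * s) τ) ⟩
        τ * (2 * s) + r  ≡⟨ cong (_+ r) (lengths cs cells) ⟨
        length (concatMap cellVerts cs) + r  ≡⟨ length-++ (concatMap cellVerts cs) ⟨
        length (concatMap cellVerts cs ++ R)  ≡⟨ ↭-length perm ⟨
        length (allFin n)  ≡⟨ length-allFin n ⟩
        n  ∎
        where
        lengths : ∀ cs → All IsCell cs → length (concatMap cellVerts cs) ≡ length cs * (2 * s)
        lengths [] [] = refl
        lengths (c ∷ cs) ((len , _) ∷ h) = trans (length-++ (cellVerts c)) (cong₂ _+_ len (lengths cs h))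
      degree : n ≤ 2 * (D + r) + 3
      degree = ≤-trans (deg (proj₁ p) (proj₂ p) p≢) (+-monoˡ-≤ 3 (*-monoʳ-≤ 2 (begin
        # (allFin n) (nbr p)  ≡⟨ ∑-↭ _ perm ⟩
        # (concatMap cellVerts cs ++ R) (nbr p)  ≡⟨ ∑-++ (concatMap cellVerts cs) R _ ⟩
        D + # R (nbr p)  ≤⟨ +-monoʳ-≤ D (#≤length R (nbr p)) ⟩
        D + r  ∎)))
      per-cell : ∀ {c} → c ∈ cs → # (cellVerts c) (nbr p) + 1 ≤ s + (s + 1) * ⟦ good p c ⟧
      per-cell {c} c∈ with good p c in eq
      ... | true = begin
        # (cellVerts c) (nbr p) + 1  ≤⟨ +-monoˡ-≤ 1 (#≤length (cellVerts c) (nbr p)) ⟩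
        length (cellVerts c) + 1  ≡⟨ cong (_+ 1) (proj₁ (All.lookup cells c∈)) ⟩
        2 * s + 1  ≡⟨ l s ⟩
        s + (s + 1) * 1  ∎
        where
        l : ∀ s → 2 * s + 1 ≡ s + (s + 1) * 1
        l = solve-∀
      ... | false = begin
        # (cellVerts c) (nbr p) + 1  ≡⟨ +-comm _ 1 ⟩
        suc (# (cellVerts c) (nbr p))  ≤⟨ ≰⇒> (λ h → subst T eq (≤⇒≤ᵇ h)) ⟩
        s  ≤⟨ m≤m+n s _ ⟩
        s + (s + 1) * 0  ∎
      slack : D + τ ≤ s * τ + (s + 1) * G
      slack = begin
        D + τ  ≡⟨ cong₂ _+_ (∑-concatMap cs cellVerts _) (sym (trans (∑-const cs 1) (*-identityʳ τ))) ⟩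
        ∑ cs (λ c → # (cellVerts c) (nbr p)) + ∑ cs (λ _ → 1)  ≡⟨ ∑-+ cs _ _ ⟨
        ∑ cs (λ c → # (cellVerts c) (nbr p) + 1)  ≤⟨ ∑-mono-∈ cs per-cell ⟩
        ∑ cs (λ c → s + (s + 1) * ⟦ good p c ⟧)  ≡⟨ ∑-+ cs _ _ ⟩
        ∑ cs (λ _ → s) + ∑ cs (λ c → (s + 1) * ⟦ good p c ⟧)  ≡⟨ cong₂ _+_ (trans (∑-const cs s) (*-comm τ s)) (∑-*ˡ cs (s + 1) _) ⟩
        s * τ + (s + 1) * G  ∎
      τ-large : 2 * ign + 3 ≤ τ
      τ-large = *-cancelˡ-≤ (2 * s) (+-cancelʳ-≤ ign _ _ (begin
        2 * s * (2 * ign + 3) + ign  ≤⟨ room ⟩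
        n  ≡⟨ total ⟨
        2 * s * τ + r  ≤⟨ +-monoʳ-≤ (2 * s * τ) lenR ⟩
        2 * s * τ + ign  ∎))
      final : τ ≤ K * G
      -- The slack, doubled, is 2τ: one τ pays for the errors `2 * r + 3`, the other remains and
      -- bounds the number of good cells from below.
      final = +-cancelˡ-≤ (2 * s * τ + τ) _ _ (begin
        2 * s * τ + τ + τ  ≡⟨ l₁ s τ ⟩
        2 * s * τ + 2 * τ  ≤⟨ +-monoˡ-≤ (2 * τ) (≤-trans (m≤m+n _ r) (≤-reflexive total)) ⟩
        n + 2 * τ  ≤⟨ +-monoˡ-≤ (2 * τ) degree ⟩
        2 * (D + r) + 3 + 2 * τ  ≡⟨ l₂ D r τ ⟩
        2 * (D + τ) + (2 * r + 3)  ≤⟨ +-mono-≤ (*-monoʳ-≤ 2 slack) (≤-trans (+-monoˡ-≤ 3 (*-monoʳ-≤ 2 lenR)) τ-large) ⟩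
        2 * (s * τ + (s + 1) * G) + τ  ≡⟨ l₃ s τ G ⟩
        2 * s * τ + τ + 2 * (s + 1) * G  ≡⟨ cong (λ z → 2 * s * τ + τ + 2 * (z + 1) * G) (size-tile m) ⟩
        2 * s * τ + τ + 2 * (3 * m + 1) * G  ≡⟨ cong (λ z → 2 * s * τ + τ + z * G) K-def ⟨
        2 * s * τ + τ + K * G  ∎)
        where
        l₁ : ∀ s t → 2 * s * t + t + t ≡ 2 * s * t + 2 * t
        l₁ = solve-∀
        l₂ : ∀ d r t → 2 * (d + r) + 3 + 2 * t ≡ 2 * (d + t) + (2 * r + 3)
        l₂ = solve-∀
        l₃ : ∀ s t g → 2 * (s * t + (s + 1) * g) + t ≡ 2 * s * t + t + 2 * (s + 1) * g
        l₃ = solve-∀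

    State : List (El (tile m)) → List (Fin n) → Set
    State ts W = All (T ∘ joined) ts × allFin n ↭ (W ++ tilesVerts ts) ++ F

    Better : List (El (tile m)) → Set
    Better ts = ∃ λ ts′ → ∃ λ W′ → State ts′ W′ × length ts < length ts′

    -- A cell (at most two tiles) and 3m pairs of leftover vertices, all adjacent to the same 3m vertices of the
    -- cell, are traded for three tiles.
    trade : ∀ (c : Cell m) ts₁ W₁ ps → State (proj₁ c ++ ts₁) (flat ps ++ (proj₂ c ++ W₁)) → IsCell c →
      (∀ {p} → p ∈ ps → T (good p c)) → 2 ^ (2 * s) * (3 * m) ≤ length ps → Better (proj₁ c ++ ts₁)
    trade c ts₁ W₁ ps (joins , perm) (lenc , le2) all-good enough = use (homogenise (cellVerts c) ps)
      where
      use : (∃ λ ps′ → ∃ λ rest → ps ↭ ps′ ++ rest ×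
        length ps ≤ 2 ^ length (cellVerts c) * length ps′ ×
        ∃ λ S → ∃ λ S̄ → cellVerts c ↭ S ++ S̄ × All (λ y → All (λ p → T (nbr p y)) ps′) S ×
          (∀ {p} → p ∈ ps′ → # S̄ (nbr p) ≡ 0)) → Better (proj₁ c ++ ts₁)
      use (ps′ , rest , pperm , le , S , S̄ , vperm , hS , hS̄) = build
          (splitAt′ (3 * m) S (subst (_≤ length S) (size-tile m) (S-large ps′ enough′ hS̄ (λ p∈ → all-good (∈-resp-↭ (↭-sym pperm) (∈-++⁺ˡ p∈))))))
          (splitAt′ (3 * m) ps′ enough′)
        where
        enough′ : 3 * m ≤ length ps′
        enough′ = *-cancelˡ-≤ (2 ^ (2 * s)) ⦃ m^n≢0 2 (2 * s) ⦄
          (≤-trans enough (subst (λ z → length ps ≤ 2 ^ z * length ps′) lenc le))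
        -- A surviving pair has no neighbour in S̄, so its s or more neighbours in the cell all lie
        -- in S.
        S-large : ∀ qs → 3 * m ≤ length qs → (∀ {p} → p ∈ qs → # S̄ (nbr p) ≡ 0) → (∀ {p} → p ∈ qs → T (good p c)) → s ≤ length S
        S-large (p ∷ _) _ none g = begin
          s  ≤⟨ ≤ᵇ⇒≤ s _ (g (here refl)) ⟩
          # (cellVerts c) (nbr p)  ≡⟨ ∑-↭ _ vperm ⟩
          # (S ++ S̄) (nbr p)  ≡⟨ ∑-++ S S̄ _ ⟩
          # S (nbr p) + # S̄ (nbr p)  ≡⟨ cong (# S (nbr p) +_) (none (here refl)) ⟩
          # S (nbr p) + 0  ≡⟨ +-identityʳ _ ⟩
          # S (nbr p)  ≤⟨ #≤length S (nbr p) ⟩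
          length S  ∎
          where open ≤-Reasoning
        build : (∃ λ A → ∃ λ B → S ≡ A ++ B × length A ≡ 3 * m) → (∃ λ P → ∃ λ P̄ → ps′ ≡ P ++ P̄ × length P ≡ 3 * m) →
          Better (proj₁ c ++ ts₁)
        build (A , B , refl , lA) (P , P̄ , refl , lP) = finish (tilesOf m 3 A P lA lP)
          where
          finish : (∃ λ (ts : List (El (tile m))) → length ts ≡ 3 × tilesVerts ts ↭ A ++ flat P × All (Within A P) ts) →
            Better (proj₁ c ++ ts₁)
          finish (ts , lts , tperm , within) = ts ++ ts₁ , flat (P̄ ++ rest) ++ (B ++ S̄ ++ W₁) ,
            (Allₚ.++⁺ (All.map (joined-within (All.map (Allₚ.++⁻ˡ P) (Allₚ.++⁻ˡ A hS))) within) (Allₚ.++⁻ʳ (proj₁ c) joins) ,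
             ↭-trans perm (++⁺ʳ F moved)) ,
            more
            where
            more : length (proj₁ c ++ ts₁) < length (ts ++ ts₁)
            more rewrite length-++ (proj₁ c) {ts₁} | length-++ ts {ts₁} | lts = s≤s (+-monoˡ-≤ (length ts₁) le2)
            open PermutationReasoning
            moved : (flat ps ++ (proj₂ c ++ W₁)) ++ tilesVerts (proj₁ c ++ ts₁) ↭
              (flat (P̄ ++ rest) ++ (B ++ S̄ ++ W₁)) ++ tilesVerts (ts ++ ts₁)
            moved = begin
              (flat ps ++ (proj₂ c ++ W₁)) ++ tilesVerts (proj₁ c ++ ts₁)
                ≡⟨ cong ((flat ps ++ (proj₂ c ++ W₁)) ++_) (concatMap-++ (verts (tile m)) (proj₁ c) ts₁) ⟩
              (flat ps ++ (proj₂ c ++ W₁)) ++ (tilesVerts (proj₁ c) ++ tilesVerts ts₁)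
                ↭⟨ solve 5 (λ f c₂ w c₁ t → (f ⊕ (c₂ ⊕ w)) ⊕ (c₁ ⊕ t) ⊜ f ⊕ ((c₁ ⊕ c₂) ⊕ (w ⊕ t))) ↭-refl
                     (flat ps) (proj₂ c) W₁ (tilesVerts (proj₁ c)) (tilesVerts ts₁) ⟩
              flat ps ++ (cellVerts c ++ (W₁ ++ tilesVerts ts₁))
                ↭⟨ ++⁺ (concatMap-↭ _ (↭-trans pperm (↭-reflexive (++-assoc P P̄ rest))))
                       (++⁺ʳ (W₁ ++ tilesVerts ts₁) vperm) ⟩
              flat (P ++ (P̄ ++ rest)) ++ (((A ++ B) ++ S̄) ++ (W₁ ++ tilesVerts ts₁))
                ≡⟨ cong (_++ (((A ++ B) ++ S̄) ++ (W₁ ++ tilesVerts ts₁))) (concatMap-++ _ P (P̄ ++ rest)) ⟩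
              (flat P ++ flat (P̄ ++ rest)) ++ (((A ++ B) ++ S̄) ++ (W₁ ++ tilesVerts ts₁))
                ↭⟨ solve 7 (λ p r a b s w t → (p ⊕ r) ⊕ (((a ⊕ b) ⊕ s) ⊕ (w ⊕ t)) ⊜ (r ⊕ (b ⊕ (s ⊕ w))) ⊕ ((a ⊕ p) ⊕ t)) ↭-refl
                     (flat P) (flat (P̄ ++ rest)) A B S̄ W₁ (tilesVerts ts₁) ⟩
              (flat (P̄ ++ rest) ++ (B ++ S̄ ++ W₁)) ++ ((A ++ flat P) ++ tilesVerts ts₁)
                ↭⟨ ++⁺ˡ (flat (P̄ ++ rest) ++ (B ++ S̄ ++ W₁)) (++⁺ʳ (tilesVerts ts₁) (↭-sym tperm)) ⟩
              (flat (P̄ ++ rest) ++ (B ++ S̄ ++ W₁)) ++ (tilesVerts ts ++ tilesVerts ts₁)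
                ≡⟨ cong ((flat (P̄ ++ rest) ++ (B ++ S̄ ++ W₁)) ++_) (concatMap-++ (verts (tile m)) ts ts₁) ⟨
              (flat (P̄ ++ rest) ++ (B ++ S̄ ++ W₁)) ++ tilesVerts (ts ++ ts₁)
                ∎
              where open ↭-Solver (Fin n)

    cells-↭ : ∀ (cs : List (Cell m)) → concatMap cellVerts cs ↭ tilesVerts (concatMap proj₁ cs) ++ concatMap proj₂ cs
    cells-↭ [] = ↭-refl
    cells-↭ (c ∷ cs) = ↭-trans (++⁺ˡ (cellVerts c) (cells-↭ cs))
      (↭-trans (interchange (tilesVerts (proj₁ c)) (proj₂ c) _ _)
        (++⁺ʳ _ (↭-reflexive (sym (concatMap-++ (verts (tile m)) (proj₁ c) _)))))

    cut-cells : ∀ ts (W : List (Fin n)) → ∃ λ (cs : List (Cell m)) → ∃ λ ts₀ → ∃ λ W₀ →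
      ts ≡ concatMap proj₁ cs ++ ts₀ × W ≡ concatMap proj₂ cs ++ W₀ × All IsCell cs × length ts₀ ≤ 1 × length W₀ ≤ 2 * s
    cut-cells ts W
      with cs₁ , ts₀ , eq₁ , e₁ , cells₁ , l₁ ← couples ts
         | cs₂ , W₀ , eq₂ , e₂ , cells₂ , l₂ ← chunks (2 * s) (s≤s z≤n) refl (length W) W ≤-refl
      = cs₁ ++ cs₂ , ts₀ , W₀ ,
        trans eq₁ (cong (_++ ts₀) (sym (trans (concatMap-++ proj₁ cs₁ cs₂) (trans (cong (concatMap proj₁ cs₁ ++_) e₂) (++-identityʳ _))))) ,
        trans eq₂ (cong (_++ W₀) (sym (trans (concatMap-++ proj₂ cs₁ cs₂) (cong (_++ concatMap proj₂ cs₂) e₁)))) ,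
        Allₚ.++⁺ cells₁ cells₂ , l₁ , l₂

    improve : ∀ ts W → State ts W → Q * 2 ≤ length W → Better ts
    improve ts W st big = split (splitAt′ (Q * 2) W big)
      where
      split : (∃ λ A → ∃ λ W₁ → W ≡ A ++ W₁ × length A ≡ Q * 2) → Better ts
      split (A , W₁ , refl , lA) = pairs (pairUp Q A lA)
        where
        pairs : (∃ λ ps → length ps ≡ Q × flat ps ≡ A) → Better ts
        pairs (ps , lps , refl) = cells (cut-cells ts W₁)
          where
          cells : (∃ λ (cs : List (Cell m)) → ∃ λ ts₀ → ∃ λ W₀ →
            ts ≡ concatMap proj₁ cs ++ ts₀ × W₁ ≡ concatMap proj₂ cs ++ W₀ × All IsCell cs × length ts₀ ≤ 1 × length W₀ ≤ 2 * s) →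
            Better ts
          cells (cs , ts₀ , W₀ , refl , refl , isCells , lts₀ , lW₀) =
            chosen (select K ps cs good ps>0 (proj₁ (dense-at (#-find ps (λ _ → true) ps>0′)))
              (λ {p} p∈ → proj₂ (good-dense cs R isCells perm lenR p (All.lookup distinct-ps p∈))))
            where
            R : List (Fin n)
            R = tilesVerts ts₀ ++ (W₀ ++ (flat ps ++ F))
            lenR : length R ≤ ign
            lenR rewrite length-++ (tilesVerts ts₀) {W₀ ++ (flat ps ++ F)} | length-++ W₀ {flat ps ++ F} | length-++ (flat ps) {F} =
              +-mono-≤ (≤-trans (≤-reflexive (length-tilesVerts ts₀)) (≤-trans (*-monoˡ-≤ s lts₀) (≤-reflexive (+-identityʳ s))))
                (+-mono-≤ lW₀ (+-monoˡ-≤ (length F) (≤-reflexive (trans (length-flat ps) (cong (_* 2) lps)))))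
            perm : allFin n ↭ concatMap cellVerts cs ++ R
            perm = begin
              allFin n
                ↭⟨ proj₂ st ⟩
              ((flat ps ++ (concatMap proj₂ cs ++ W₀)) ++ tilesVerts (concatMap proj₁ cs ++ ts₀)) ++ F
                ≡⟨ cong (λ z → ((flat ps ++ (concatMap proj₂ cs ++ W₀)) ++ z) ++ F) (concatMap-++ (verts (tile m)) (concatMap proj₁ cs) ts₀) ⟩
              ((flat ps ++ (concatMap proj₂ cs ++ W₀)) ++ (tilesVerts (concatMap proj₁ cs) ++ tilesVerts ts₀)) ++ F
                ↭⟨ solve 6 (λ p c₂ w c₁ t f → ((p ⊕ (c₂ ⊕ w)) ⊕ (c₁ ⊕ t)) ⊕ f ⊜ (c₁ ⊕ c₂) ⊕ (t ⊕ (w ⊕ (p ⊕ f)))) ↭-refl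
                     (flat ps) (concatMap proj₂ cs) W₀ (tilesVerts (concatMap proj₁ cs)) (tilesVerts ts₀) F ⟩
              (tilesVerts (concatMap proj₁ cs) ++ concatMap proj₂ cs) ++ R
                ↭⟨ ++⁺ʳ R (↭-sym (cells-↭ cs)) ⟩
              concatMap cellVerts cs ++ R
                ∎
              where
              open PermutationReasoning
              open ↭-Solver (Fin n)
            distinct-ps : All (λ p → proj₁ p ≢ proj₂ p) ps
            distinct-ps = flat-distinct ps (Unique-++ˡ (flat ps) (Unique-++ˡ (flat ps ++ _)
              (Unique-++ˡ (((flat ps) ++ _) ++ _) (Unique-↭ (proj₂ st) (allFin⁺ n)))))
            K>0 : 0 < K
            K>0 = subst (0 <_) (sym K-def) (s≤s z≤n)
            Q>0 : 0 < Q
            Q>0 = subst (0 <_) (sym Q-def) (*-mono-≤ {1} {K} {1} K>0 (*-mono-≤ {1} {2 ^ (2 * s)} {1} (m^n>0 2 (2 * s)) (s≤s z≤n)))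
            ps>0 : 0 < length ps
            ps>0 = subst (0 <_) (sym lps) Q>0
            ps>0′ : 0 < # ps (λ _ → true)
            ps>0′ = subst (0 <_) (sym (#-all {xs = ps} (λ _ → true) (All.tabulate (λ _ → tt)))) ps>0
            dense-at : (∃ λ p → p ∈ ps × ⊤) → 0 < length cs × ⊤
            dense-at (p , p∈ , _) = proj₁ (good-dense cs R isCells perm lenR p (All.lookup distinct-ps p∈)) , tt
            chosen : (∃ λ c → c ∈ cs × length ps ≤ K * # ps (λ p → good p c)) → Better (concatMap proj₁ cs ++ ts₀)
            chosen (c , c∈ , many-good) = around (∈-split c∈)
              where
              ps₂ rest : List (Fin n × Fin n)
              ps₂ = keep (λ p → good p c) ps
              rest = keep (not ∘ (λ p → good p c)) ps
              enough : 2 ^ (2 * s) * (3 * m) ≤ length ps₂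
              enough = *-cancelˡ-≤ K ⦃ >-nonZero K>0 ⦄ (begin
                K * (2 ^ (2 * s) * (3 * m))  ≡⟨ Q-def ⟨
                Q  ≡⟨ lps ⟨
                length ps  ≤⟨ many-good ⟩
                K * # ps (λ p → good p c)  ≡⟨ cong (K *_) (length-keep (λ p → good p c) ps) ⟨
                K * length ps₂  ∎)
                where open ≤-Reasoning
              around : (∃ λ cs′ → cs ↭ c ∷ cs′) → Better (concatMap proj₁ cs ++ ts₀)
              around (cs′ , cperm) = back (trade c ts₁ W₂ ps₂ (All-resp-↭ tperm (proj₁ st) , ↭-trans (proj₂ st) (++⁺ʳ F vperm))
                  (All.lookup isCells c∈) (All.lookup (keep-all (λ p → good p c) ps)) enough)
                where
                ts₁ : List (El (tile m))
                ts₁ = concatMap proj₁ cs′ ++ ts₀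
                W₂ : List (Fin n)
                W₂ = (concatMap proj₂ cs′ ++ W₀) ++ flat rest
                tperm : concatMap proj₁ cs ++ ts₀ ↭ proj₁ c ++ ts₁
                tperm = ↭-trans (++⁺ʳ ts₀ (concatMap-↭ proj₁ cperm)) (↭-reflexive (++-assoc (proj₁ c) (concatMap proj₁ cs′) ts₀))
                vperm : (flat ps ++ (concatMap proj₂ cs ++ W₀)) ++ tilesVerts (concatMap proj₁ cs ++ ts₀) ↭
                  (flat ps₂ ++ (proj₂ c ++ W₂)) ++ tilesVerts (proj₁ c ++ ts₁)
                vperm = ++⁺ (begin
                  flat ps ++ (concatMap proj₂ cs ++ W₀)
                    ↭⟨ ++⁺ (concatMap-↭ _ (keep-↭ (λ p → good p c) ps)) (++⁺ʳ W₀ (concatMap-↭ proj₂ cperm)) ⟩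
                  flat (ps₂ ++ rest) ++ ((proj₂ c ++ concatMap proj₂ cs′) ++ W₀)
                    ≡⟨ cong (_++ ((proj₂ c ++ concatMap proj₂ cs′) ++ W₀)) (concatMap-++ _ ps₂ rest) ⟩
                  (flat ps₂ ++ flat rest) ++ ((proj₂ c ++ concatMap proj₂ cs′) ++ W₀)
                    ↭⟨ solve 5 (λ p r c d w → (p ⊕ r) ⊕ ((c ⊕ d) ⊕ w) ⊜ p ⊕ (c ⊕ ((d ⊕ w) ⊕ r))) ↭-refl
                         (flat ps₂) (flat rest) (proj₂ c) (concatMap proj₂ cs′) W₀ ⟩
                  flat ps₂ ++ (proj₂ c ++ W₂)
                    ∎) (concatMap-↭ _ tperm)
                  where
                  open PermutationReasoning
                  open ↭-Solver (Fin n)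
                back : Better (proj₁ c ++ ts₁) → Better (concatMap proj₁ cs ++ ts₀)
                back (ts′ , W′ , st′ , lt) = ts′ , W′ , st′ , subst (_< length ts′) (sym (↭-length tperm)) lt

    -- Each improvement adds a tile and there are never more than n tiles, so the fuel cannot run
    -- out before the uncovered part is small.
    iterate : ∀ fuel ts W → State ts W → n < length ts + fuel → ∃ λ ts′ → ∃ λ W′ → State ts′ W′ × length W′ < Q * 2
    iterate fuel ts W st enough with Q * 2 ≤? length W
    ... | no small = ts , W , st , ≰⇒> small
    iterate zero ts W st enough | yes _ = ⊥-elim (<⇒≱ enough (begin
      length ts + 0  ≡⟨ +-identityʳ _ ⟩
      length ts  ≤⟨ m≤m*n (length ts) s ⟩
      length ts * s  ≡⟨ length-tilesVerts ts ⟨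
      length (tilesVerts ts)  ≤⟨ m≤n+m _ (length W) ⟩
      length W + length (tilesVerts ts)  ≡⟨ length-++ W ⟨
      length (W ++ tilesVerts ts)  ≤⟨ m≤m+n _ (length F) ⟩
      length (W ++ tilesVerts ts) + length F  ≡⟨ length-++ (W ++ tilesVerts ts) ⟨
      length ((W ++ tilesVerts ts) ++ F)  ≡⟨ ↭-length (proj₂ st) ⟨
      length (allFin n)  ≡⟨ length-allFin n ⟩
      n  ∎))
      where open ≤-Reasoning
    iterate (suc fuel) ts W st enough | yes big = again (improve ts W st big)
      where
      again : Better ts → ∃ λ ts′ → ∃ λ W′ → State ts′ W′ × length W′ < Q * 2
      again (ts′ , W′ , st′ , lt) = iterate fuel ts′ W′ st′
        (≤-trans enough (≤-trans (≤-reflexive (+-suc (length ts) fuel)) (+-monoˡ-≤ fuel lt)))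

    almost-tiling : Unique F → ∃ λ ts → ∃ λ W → State ts W × length W < Q * 2
    almost-tiling u = start (complement F u)
      where
      start : (∃ λ W → allFin n ↭ W ++ F) → ∃ λ ts → ∃ λ W → State ts W × length W < Q * 2
      start (W , p) = iterate (suc n) [] W ([] , ↭-trans p (++⁺ʳ F (↭-reflexive (sym (++-identityʳ W))))) ≤-refl

leftover : ℕ → ℕ
leftover m′ = 2 * (3 * suc m′ + 1) * (2 ^ (2 * size (tile (suc m′))) * (3 * suc m′))

AlmostTiled : ℕ → ℕ → ∀ {n} → ThreeGraph n → List (Fin n) → Set
AlmostTiled m′ c {n} H F = ∃ λ (ts : List (Tuples.El n (tile (suc m′)))) → ∃ λ W →
  All (T ∘ Tilings.joined H) ts × allFin n ↭ (W ++ Tilings.tilesVerts H ts) ++ F × length W < c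

almostTiling : ∀ m′ → Σ ℕ λ g → Σ ℕ λ c → Σ ℕ λ N → ∀ n → N ≤ n → (H : ThreeGraph n) →
  (∀ x x′ → x ≢ x′ → n ≤ 2 * # (allFin n) (edge H x x′) + 3) →
  ∀ F → Unique F → g * length F ≤ n → AlmostTiled m′ c H F
almostTiling m′ = constants (size (tile (suc m′))) (leftover m′) refl refl
  where
  constants : ∀ s Q → size (tile (suc m′)) ≡ s → leftover m′ ≡ Q → Σ ℕ λ g → Σ ℕ λ c → Σ ℕ λ N → ∀ n → N ≤ n →
    (H : ThreeGraph n) → (∀ x x′ → x ≢ x′ → n ≤ 2 * # (allFin n) (edge H x x′) + 3) →
    ∀ F → Unique F → g * length F ≤ n → AlmostTiled m′ c H F
  -- The room condition of `AlmostTiling` expands to (4s + 1)(ig + |F|) + 6s ≤ n. The terms without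
  -- F and the term with F are each allotted n/2.
  constants s Q hs hQ = 2 * (4 * s + 1) , Q * 2 , 2 * ((4 * s + 1) * ig + 6 * s) , prove
    where
    ig : ℕ
    ig = s + (2 * s + Q * 2)
    prove : ∀ n → 2 * ((4 * s + 1) * ig + 6 * s) ≤ n → (H : ThreeGraph n) →
      (∀ x x′ → x ≢ x′ → n ≤ 2 * # (allFin n) (edge H x x′) + 3) →
      ∀ F → Unique F → 2 * (4 * s + 1) * length F ≤ n → AlmostTiled m′ (Q * 2) H F
    prove n big H deg F u small = result (AlmostTiling.almost-tiling m′ H deg (2 * (3 * suc m′ + 1)) Q refl (sym hQ) F room u)
      where
      ign : ℕ → ℕ
      ign s = s + (2 * s + (Q * 2 + length F))
      room′ : 2 * s * (2 * ign s + 3) + ign s ≤ n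
      room′ = *-cancelˡ-≤ 2 (begin
        2 * (2 * s * (2 * ign s + 3) + ign s)  ≡⟨ l s (Q * 2) (length F) ⟩
        2 * ((4 * s + 1) * ig + 6 * s) + 2 * (4 * s + 1) * length F  ≤⟨ +-mono-≤ big small ⟩
        n + n  ≡⟨ cong (n +_) (+-identityʳ n) ⟨
        2 * n  ∎)
        where
        open ≤-Reasoning
        l : ∀ s q f → 2 * (2 * s * (2 * (s + (2 * s + (q + f))) + 3) + (s + (2 * s + (q + f)))) ≡
          2 * ((4 * s + 1) * (s + (2 * s + q)) + 6 * s) + 2 * (4 * s + 1) * f
        l = solve-∀
      room : 2 * size (tile (suc m′)) * (2 * ign (size (tile (suc m′))) + 3) + ign (size (tile (suc m′))) ≤ n
      room = subst (λ z → 2 * z * (2 * ign z + 3) + ign z ≤ n) (sym hs) room′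
      result : (∃ λ (ts : List (Tuples.El n (tile (suc m′)))) → ∃ λ W →
        (All (T ∘ Tilings.joined H) ts × allFin n ↭ (W ++ Tilings.tilesVerts H ts) ++ F) × length W < Q * 2) →
        AlmostTiled m′ (Q * 2) H F
      result (ts , W , (a , p) , l) = ts , W , a , p , l

-- Reachability of all pairs, or closeness to the parity construction

-- Pointwise inequalities between indicators of sets of pairs are propositional, so they are settled
-- by evaluating all truth assignments.
check₂ : (f : Bool → Bool → Bool) → T (∀Bool λ a → ∀Bool (f a)) → ∀ a b → T (f a b)
check₂ f p a = ∀Bool-elim (f a) (∀Bool-elim (λ a → ∀Bool (f a)) p a)

check₃ : (f : Bool → Bool → Bool → Bool) → T (∀Bool λ a → ∀Bool λ b → ∀Bool (f a b)) → ∀ a b c → T (f a b c)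
check₃ f p a = check₂ (f a) (∀Bool-elim (λ a → ∀Bool λ b → ∀Bool (f a b)) p a)

check₄ : (f : Bool → Bool → Bool → Bool → Bool) → T (∀Bool λ a → ∀Bool λ b → ∀Bool λ c → ∀Bool (f a b c)) →
  ∀ a b c d → T (f a b c d)
check₄ f p a = check₃ (f a) (∀Bool-elim (λ a → ∀Bool λ b → ∀Bool λ c → ∀Bool (f a b c)) p a)

check₅ : (f : Bool → Bool → Bool → Bool → Bool → Bool) →
  T (∀Bool λ a → ∀Bool λ b → ∀Bool λ c → ∀Bool λ d → ∀Bool (f a b c d)) → ∀ a b c d e → T (f a b c d e)
check₅ f p a = check₄ (f a) (∀Bool-elim (λ a → ∀Bool λ b → ∀Bool λ c → ∀Bool λ d → ∀Bool (f a b c d)) p a)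

xor-triangle : ∀ a b c → ⟦ a xor c ⟧ ≤ ⟦ a xor b ⟧ + ⟦ b xor c ⟧
xor-triangle a b c = ≤ᵇ⇒≤ _ _ (check₃ (λ a b c → ⟦ a xor c ⟧ ≤ᵇ ⟦ a xor b ⟧ + ⟦ b xor c ⟧) tt a b c)

≤-via : ∀ {a b} → T (⟦ a ⟧ ≤ᵇ ⟦ b ⟧) → ⟦ a ⟧ ≤ ⟦ b ⟧
≤-via = ≤ᵇ⇒≤ _ _

module PairSums (n : ℕ) where

  V : List (Fin n)
  V = allFin n

  ∑∑ : (Fin n → Fin n → ℕ) → ℕ
  ∑∑ f = ∑ V (λ x → ∑ V (f x))

  ## : (Fin n → Fin n → Bool) → ℕ
  ## P = ∑∑ (λ x y → ⟦ P x y ⟧)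

  ∑∑-mono : ∀ {f g : Fin n → Fin n → ℕ} → (∀ x y → f x y ≤ g x y) → ∑∑ f ≤ ∑∑ g
  ∑∑-mono h = ∑-mono V (λ x → ∑-mono V (h x))

  ∑∑-+ : ∀ f g → ∑∑ (λ x y → f x y + g x y) ≡ ∑∑ f + ∑∑ g
  ∑∑-+ f g = trans (∑-cong V (λ x → ∑-+ V (f x) (g x))) (∑-+ V _ _)

  ##-mono : ∀ {P Q : Fin n → Fin n → Bool} → (∀ x y → ⟦ P x y ⟧ ≤ ⟦ Q x y ⟧) → ## P ≤ ## Q
  ##-mono = ∑∑-mono

  ##-sub : ∀ P Q R → (∀ x y → ⟦ P x y ⟧ ≤ ⟦ Q x y ⟧ + ⟦ R x y ⟧) → ## P ≤ ## Q + ## R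
  ##-sub P Q R h = ≤-trans (∑∑-mono h) (≤-reflexive (∑∑-+ (λ x y → ⟦ Q x y ⟧) (λ x y → ⟦ R x y ⟧)))

  ##-swap : ∀ P → ## P ≡ ## (λ x y → P y x)
  ##-swap P = ∑-swap V V (λ x y → ⟦ P x y ⟧)

  ∑-n : ∀ c → ∑ V (λ _ → c) ≡ n * c
  ∑-n c = trans (∑-const V c) (cong (_* c) (length-allFin n))

  #≤n : ∀ P → # V P ≤ n
  #≤n P = ≤-trans (#≤length V P) (≤-reflexive (length-allFin n))

  ##≤ : ∀ P → ## P ≤ n * n
  ##≤ P = ≤-trans (∑-mono V (λ x → #≤n (P x))) (≤-reflexive (∑-n n))

  ##-row : ∀ P → ## (λ x _ → P x) ≡ n * # V P
  ##-row P = trans (∑-cong V (λ x → ∑-n ⟦ P x ⟧)) (∑-*ˡ V n (λ x → ⟦ P x ⟧))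

  dist : (P Q : Fin n → Fin n → Bool) → ℕ
  dist P Q = ## (λ x y → P x y xor Q x y)

  dist-triangle : ∀ P Q R → dist P R ≤ dist P Q + dist Q R
  dist-triangle P Q R = ##-sub _ _ _ (λ x y → xor-triangle (P x y) (Q x y) (R x y))

  open Tuples n

  ##-many : ∀ k P → 0 < n → n * n ≤ k * ## (λ x y → P (x , y)) → T (many (pt ⊗ pt) (2 * k) P)
  ##-many k P n>0 h = many-mono pt (λ x → most⁺ ∘ ≤ᵇ⇒≤ n _) (most⁺ (markov n k V (λ x → # V (λ y → P (x , y))) n>0
    (≤-reflexive (length-allFin n)) (λ x → #≤n _) h))

-- H agrees up to few edges with the 3-graph whose edges meet the colour class χ = true in an even number of
-- vertices.
record Coloured (k Kb : ℕ) {n : ℕ} (H : ThreeGraph n) : Set where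
  open PairSums n
  field
    χ typ : Fin n → Bool
    e : ℕ
    e-small : Kb * e ≤ n
    few-atypical : # V (not ∘ typ) ≤ e
    typical : ∀ w → T (typ w) → dist (λ x y → edge H x y w) (λ x y → not (χ w xor (χ x xor χ y))) ≤ 69 * (n * e)
    many-true : n ≤ 6 * # V χ
    many-false : n ≤ 6 * # V (not ∘ χ)
    same-colour : ∀ w w′ → χ w ≡ χ w′ → T (Reachability.reach H k w w′)

module Dichotomy {n : ℕ} (H : ThreeGraph n) (n>0 : 0 < n)
  (deg : ∀ x x′ → x ≢ x′ → n ≤ 2 * # (allFin n) (edge H x x′) + 3)
  (e Kb : ℕ) (e≥4 : 4 ≤ e) (Kb-large : 400 ≤ Kb) (e-small : Kb * e ≤ n) (e-large : n ≤ 2 * Kb * e) where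
  open Reachability H
  open PairSums n

  -- The unit of error for sets of pairs. As e lies between n/(2Kb) and n/Kb, E pairs are a positive
  -- fraction of all pairs (`both-similar`) and yet negligible against n² (`E-small`).
  E : ℕ
  E = n * e

  4n≤E : 4 * n ≤ E
  4n≤E = ≤-trans (*-monoˡ-≤ n e≥4) (≤-reflexive (*-comm e n))

  E-small : ∀ c → c ≤ 400 → c * E ≤ n * n
  E-small c c≤ = begin
    c * (n * e)  ≡⟨ l c n e ⟩
    n * (c * e)  ≤⟨ *-monoʳ-≤ n (*-monoˡ-≤ e (≤-trans c≤ Kb-large)) ⟩
    n * (Kb * e)  ≤⟨ *-monoʳ-≤ n e-small ⟩
    n * n  ∎
    where
    open ≤-Reasoning
    l : ∀ a b c → a * (b * c) ≡ b * (a * c)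
    l = solve-∀

  L : Fin n → Fin n → Fin n → Bool
  L w x y = edge H x y w

  L-sym : ∀ w x y → L w x y ≡ L w y x
  L-sym w x y = sym₁₂ H x y w

  L-large : ∀ w → n * n ≤ 2 * ## (L w) + 4 * n
  L-large w = begin
    n * n  ≡⟨ ∑-n n ⟨
    ∑ V (λ _ → n)  ≤⟨ ∑-mono V pw ⟩
    ∑ V (λ x → 2 * # V (L w x) + (3 + n * ⟦ ⌊ x ≟ w ⌋ ⟧))  ≡⟨ ∑-+ V _ _ ⟩
    ∑ V (λ x → 2 * # V (L w x)) + ∑ V (λ x → 3 + n * ⟦ ⌊ x ≟ w ⌋ ⟧)  ≡⟨ cong₂ _+_ (∑-*ˡ V 2 _) (∑-+ V _ _) ⟩
    2 * ## (L w) + (∑ V (λ _ → 3) + ∑ V (λ x → n * ⟦ ⌊ x ≟ w ⌋ ⟧))  ≤⟨ +-monoʳ-≤ (2 * ## (L w)) (+-mono-≤ (≤-reflexive (∑-n 3))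
                                                                            (≤-trans (≤-reflexive (∑-*ˡ V n _)) (*-monoʳ-≤ n (#-≡ V w (allFin⁺ n))))) ⟩
    2 * ## (L w) + (n * 3 + n * 1)  ≡⟨ cong (2 * ## (L w) +_) (l n) ⟩
    2 * ## (L w) + 4 * n  ∎
    where
    open ≤-Reasoning
    l : ∀ n → n * 3 + n * 1 ≡ 4 * n
    l = solve-∀
    pw : ∀ x → n ≤ 2 * # V (L w x) + (3 + n * ⟦ ⌊ x ≟ w ⌋ ⟧)
    pw x with x ≟ w
    ... | yes _ = ≤-trans (≤-reflexive (sym (*-identityʳ n))) (≤-trans (m≤n+m (n * 1) 3) (m≤n+m _ (2 * # V (L w x))))
    ... | no x≢w = ≤-trans (deg x w x≢w) (+-mono-≤ (≤-reflexive (cong (2 *_) (∑-cong V (λ y → cong ⟦_⟧ (sym₂₃ H x w y))))) (m≤m+n 3 _))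

  both : Fin n → Fin n → ℕ
  both u v = ## (λ x y → L u x y ∧ L v x y)

  -- Each link contains half of all pairs up to an error of 2n, so by inclusion and exclusion the
  -- pairs in neither link outnumber those in both by at most 4n.
  neither : ∀ u v → both u v ≤ E → ## (λ x y → not (L u x y) ∧ not (L v x y)) ≤ 2 * E
  neither u v h = *-cancelˡ-≤ 2 (lin 0
      (+-mono-≤ (*-monoʳ-≤ 2 count) (+-mono-≤ (L-large u) (+-mono-≤ (L-large v) (+-mono-≤ (*-monoʳ-≤ 2 h) (*-monoʳ-≤ 2 4n≤E)))))
      (l (## (L u)) (## (L v)) (both u v) neg n E (n * n)))
    where
    neg : ℕ
    neg = ## (λ x y → not (L u x y) ∧ not (L v x y))
    count : ## (L u) + ## (L v) + neg ≤ n * n + both u v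
    count = ≤-reflexive (begin
      ## (L u) + ## (L v) + neg
        ≡⟨ cong (_+ neg) (∑∑-+ _ _) ⟨
      ∑∑ (λ x y → ⟦ L u x y ⟧ + ⟦ L v x y ⟧) + neg
        ≡⟨ ∑∑-+ _ _ ⟨
      ∑∑ (λ x y → ⟦ L u x y ⟧ + ⟦ L v x y ⟧ + ⟦ not (L u x y) ∧ not (L v x y) ⟧)
        ≡⟨ ∑-cong V (λ x → ∑-cong V (λ y → pw (L u x y) (L v x y))) ⟩
      ∑∑ (λ x y → 1 + ⟦ L u x y ∧ L v x y ⟧)
        ≡⟨ ∑∑-+ (λ _ _ → 1) _ ⟩
      ∑∑ (λ _ _ → 1) + both u v
        ≡⟨ cong (_+ both u v) (trans (∑-cong V (λ _ → trans (∑-n 1) (*-identityʳ n))) (∑-n n)) ⟩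
      n * n + both u v ∎)
      where
      open ≡-Reasoning
      pw : ∀ a b → ⟦ a ⟧ + ⟦ b ⟧ + ⟦ not a ∧ not b ⟧ ≡ 1 + ⟦ a ∧ b ⟧
      pw true true = refl
      pw true false = refl
      pw false true = refl
      pw false false = refl
    l : ∀ a b c m n E N → 2 * m + (2 * (N + c) + ((2 * a + 4 * n) + ((2 * b + 4 * n) + (2 * E + 2 * E)))) + 0
      ≡ 2 * (2 * E) + (2 * (a + b + m) + (N + (N + (2 * c + 2 * (4 * n)))))
    l = solve-∀

  complementary : ∀ u v → both u v ≤ E → dist (L u) (λ x y → not (L v x y)) ≤ 3 * E
  complementary u v h = ≤-trans (##-sub _ (λ x y → L u x y ∧ L v x y) (λ x y → not (L u x y) ∧ not (L v x y))
      (λ x y → ≤ᵇ⇒≤ _ _ (check₂ (λ a b → ⟦ a xor not b ⟧ ≤ᵇ ⟦ a ∧ b ⟧ + ⟦ not a ∧ not b ⟧) tt (L u x y) (L v x y))))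
    (+-mono-≤ h (neither u v h))

  both-similar : ∀ u a → E ≤ both u a → T (similar (4 * Kb) u a)
  both-similar u a h = many-up (pt ⊗ pt) (≤-reflexive (l₁ Kb)) (##-many (2 * Kb) (λ p → adj u p ∧ adj a p) n>0 (begin
    n * n  ≤⟨ *-monoʳ-≤ n e-large ⟩
    n * (2 * Kb * e)  ≡⟨ l₂ n (2 * Kb) e ⟩
    2 * Kb * E  ≤⟨ *-monoʳ-≤ (2 * Kb) h ⟩
    2 * Kb * both u a  ∎))
    where
    open ≤-Reasoning
    l₁ : ∀ k → 2 * (2 * k) ≡ 4 * k
    l₁ = solve-∀
    l₂ : ∀ a b c → a * (b * c) ≡ b * (a * c)
    l₂ = solve-∀

  -- The links of u and v are almost complementary, and all but e vertices have a link almost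
  -- disjoint from one of the two, hence close to the other.
  module Far (u v : Fin n) (far : both u v ≤ E)
    (few : # V (λ w → not (both w u ≤ᵇ E) ∧ not (both w v ≤ᵇ E)) ≤ e) where

    amb typ : Fin n → Bool
    amb w = not (both w u ≤ᵇ E) ∧ not (both w v ≤ᵇ E)
    typ w = not (amb w)

    χ₀ : Fin n → Bool
    χ₀ w = n * n ≤ᵇ 8 * both w u

    ref : Bool → Fin n → Fin n → Bool
    ref true = L u
    ref false = L v

    -- The link of w has about n²/2 pairs, nearly all of them in the link of u or of v. So it shares
    -- about n²/4 pairs with one of these links, and the cutoff n²/8 leaves room for the errors.
    χ₀-false : ∀ w → ¬ T (χ₀ w) → n * n ≤ 8 * both w v
    χ₀-false w h = *-cancelˡ-≤ 1 (lin (n * n)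
        (+-mono-≤ (*-monoʳ-≤ 4 (L-large w)) (+-mono-≤ (*-monoʳ-≤ 8 split) (+-mono-≤ (*-monoʳ-≤ 4 4n≤E)
          (+-mono-≤ (*-monoʳ-≤ 8 (neither u v far)) (+-mono-≤ (<⇒≤ (≰⇒> (λ le → h (≤⇒≤ᵇ le)))) (E-small 20 (m≤m+n 20 380)))))))
        (l (## (L w)) (both w u) (both w v) neg n E (n * n)))
      where
      neg : ℕ
      neg = ## (λ x y → not (L u x y) ∧ not (L v x y))
      split : ## (L w) ≤ both w u + (both w v + neg)
      split = ≤-trans (##-sub (L w) (λ x y → L w x y ∧ L u x y) (λ x y → L w x y ∧ not (L u x y))
          (λ x y → ≤ᵇ⇒≤ _ _ (check₂ (λ a b → ⟦ a ⟧ ≤ᵇ ⟦ a ∧ b ⟧ + ⟦ a ∧ not b ⟧) tt (L w x y) (L u x y))))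
        (+-monoʳ-≤ (both w u) (##-sub _ (λ x y → L w x y ∧ L v x y) (λ x y → not (L u x y) ∧ not (L v x y))
          (λ x y → ≤ᵇ⇒≤ _ _ (check₃ (λ a b c → ⟦ a ∧ not b ⟧ ≤ᵇ ⟦ a ∧ c ⟧ + ⟦ not b ∧ not c ⟧) tt (L w x y) (L u x y) (L v x y)))))
      l : ∀ w a b m n E N → 1 * N + (4 * (2 * w + 4 * n) + (8 * (a + (b + m)) + (4 * E + (8 * (2 * E) + (N + N))))) + N
        ≡ 1 * (8 * b) + (4 * N + (8 * w + (4 * (4 * n) + (8 * m + (8 * a + 20 * E)))))
      l = solve-∀

    ref-large : ∀ w → n * n ≤ 8 * ## (λ x y → L w x y ∧ ref (χ₀ w) x y)
    ref-large w with χ₀ w in eq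
    ... | true = ≤ᵇ⇒≤ _ _ (≡⇒T eq)
    ... | false = χ₀-false w (subst T eq)

    dist-comm : ∀ P Q → dist P Q ≡ dist Q P
    dist-comm P Q = ∑-cong V (λ x → ∑-cong V (λ y → cong ⟦_⟧ (xor-comm (P x y) (Q x y))))

    not-not : ∀ P Q → dist (λ x y → not (P x y)) Q ≤ dist P (λ x y → not (Q x y))
    not-not P Q = ##-mono (λ x y → ≤-via (check₂ (λ a b → ⟦ not a xor b ⟧ ≤ᵇ ⟦ a xor not b ⟧) tt (P x y) (Q x y)))

    not-8E : ∀ {x} → x ≤ E → ¬ (n * n ≤ 8 * x)
    not-8E {x} x≤E h = <⇒≱ n>0 (*-cancelˡ-≤ n ⦃ >-nonZero n>0 ⦄ (≤-trans n²≤0 (≤-reflexive (sym (*-zeroʳ n)))))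
      where
      n²≤0 : n * n ≤ 0
      n²≤0 = lin 0 (+-mono-≤ (*-monoʳ-≤ 2 h) (+-mono-≤ (*-monoʳ-≤ 16 x≤E) (E-small 16 (m≤m+n 16 384)))) (l x E (n * n))
        where
        l : ∀ x E N → N + (2 * (8 * x) + (16 * E + N)) + 0 ≡ 0 + (2 * N + (16 * x + 16 * E))
        l = solve-∀

    -- The link of w is almost disjoint from that of u or v, thus close to its complement, thus
    -- close to the other one: two complementations at a cost of 3E each. The colour `χ₀ w` names
    -- this other one because an overlap of E is below the cutoff n²/8.
    typ-ref : ∀ w → T (typ w) → dist (L w) (ref (χ₀ w)) ≤ 6 * E
    typ-ref w t with χ₀ w in eq | both w u ≤? E | both w v ≤? E
    ... | _ | no h₁ | no h₂ = ⊥-elim (contra (¬T⇒≡ (h₁ ∘ ≤ᵇ⇒≤ _ _)) (¬T⇒≡ (h₂ ∘ ≤ᵇ⇒≤ _ _)) t)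
      where
      contra : ∀ {a b} → a ≡ false → b ≡ false → T (not (not a ∧ not b)) → ⊥
      contra refl refl ()
    ... | true | yes h | _ = ⊥-elim (not-8E h (≤ᵇ⇒≤ _ _ (≡⇒T eq)))
    ... | false | yes h | _ = ≤-trans (dist-triangle (L w) (λ x y → not (L u x y)) (L v))
      (≤-trans (+-mono-≤ (complementary w u h) (≤-trans (not-not (L u) (L v)) (complementary u v far))) (≤-reflexive (l E)))
      where
      l : ∀ E → 3 * E + 3 * E ≡ 6 * E
      l = solve-∀
    ... | false | no _ | yes h = ⊥-elim (not-8E h (χ₀-false w (subst T eq)))
    ... | true | no _ | yes h = ≤-trans (dist-triangle (L w) (λ x y → not (L v x y)) (L u))
      (≤-trans (+-mono-≤ (complementary w v h) (≤-trans (≤-reflexive (dist-comm _ (L u))) (complementary u v far))) (≤-reflexive (l E)))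
      where
      l : ∀ E → 3 * E + 3 * E ≡ 6 * E
      l = solve-∀

    g : Fin n → Fin n → Bool
    g = L v

    typ-g : ∀ w → T (typ w) → dist (L w) (λ x y → g x y xor χ₀ w) ≤ 9 * E
    typ-g w t = ≤-trans (dist-triangle (L w) (ref (χ₀ w)) _) (≤-trans (+-mono-≤ (typ-ref w t) (step (χ₀ w))) (≤-reflexive (l E)))
      where
      l : ∀ E → 6 * E + 3 * E ≡ 9 * E
      l = solve-∀
      step : ∀ b → dist (ref b) (λ x y → g x y xor b) ≤ 3 * E
      step true = ≤-trans (##-mono (λ x y → ≤-via (check₂ (λ a b → ⟦ a xor (b xor true) ⟧ ≤ᵇ ⟦ a xor not b ⟧) tt (L u x y) (L v x y)))) (complementary u v far)
      step false = ≤-trans (##-mono {Q = λ _ _ → false} (λ x y → ≤-via (check₂ (λ a b → ⟦ a xor (a xor false) ⟧ ≤ᵇ ⟦ false ⟧) tt (L v x y) true)))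
        (≤-trans (≤-reflexive (trans (##-row (λ _ → false)) (cong (n *_) (trans (∑-n 0) (*-zeroʳ n))))) (≤-trans (≤-reflexive (*-zeroʳ n)) z≤n))

    Δ : (w x y : Fin n) → Bool
    Δ w x y = L w x y xor (g x y xor χ₀ w)

    amb-small : n * # V amb ≤ E
    amb-small = *-monoʳ-≤ n few

    triple : ∑ V (λ w → ## (Δ w)) ≤ n * (10 * E)
    triple = begin
      ∑ V (λ w → ## (Δ w))  ≤⟨ ∑-mono V pw ⟩
      ∑ V (λ w → 9 * E + n * n * ⟦ amb w ⟧)  ≡⟨ ∑-+ V _ _ ⟩
      ∑ V (λ _ → 9 * E) + ∑ V (λ w → n * n * ⟦ amb w ⟧)  ≡⟨ cong₂ _+_ (∑-n (9 * E)) (∑-*ˡ V (n * n) _) ⟩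
      n * (9 * E) + n * n * # V amb  ≡⟨ cong (n * (9 * E) +_) (*-assoc n n _) ⟩
      n * (9 * E) + n * (n * # V amb)  ≤⟨ +-monoʳ-≤ (n * (9 * E)) (*-monoʳ-≤ n amb-small) ⟩
      n * (9 * E) + n * E  ≡⟨ l n E ⟩
      n * (10 * E)  ∎
      where
      open ≤-Reasoning
      l : ∀ n E → n * (9 * E) + n * E ≡ n * (10 * E)
      l = solve-∀
      pw : ∀ w → ## (Δ w) ≤ 9 * E + n * n * ⟦ amb w ⟧
      pw w with amb w in eq
      ... | true = ≤-trans (##≤ (Δ w)) (≤-trans (≤-reflexive (sym (*-identityʳ (n * n)))) (m≤n+m _ (9 * E)))
      ... | false = ≤-trans (typ-g w (subst (T ∘ not) (sym eq) tt)) (m≤m+n (9 * E) _)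

    triple′ : ∑ V (λ w → ## (λ x y → Δ x w y)) ≤ n * (10 * E)
    triple′ = ≤-trans (≤-reflexive (∑-swap V V (λ w x → # V (λ y → Δ x w y)))) triple

    -- The triple w, x, y can be read in the link of w or in that of x, so `g x y xor χ₀ w` and
    -- `g w y xor χ₀ x` agree for almost all triples. Fixing the best w splits g into a function of
    -- x and a function of y.
    aligned : ∃ λ w₀ → dist g (λ x y → χ₀ x xor (g w₀ y xor χ₀ w₀)) ≤ 20 * E
    aligned = best (∑-min V (λ w → ## (Δ w) + ## (λ x y → Δ x w y)) (subst (0 <_) (sym (length-allFin n)) n>0))
      where
      best : (∃ λ w → w ∈ V × length V * (## (Δ w) + ## (λ x y → Δ x w y)) ≤ ∑ V (λ w → ## (Δ w) + ## (λ x y → Δ x w y))) → _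
      best (w , _ , h) = w , ≤-trans (##-sub _ (Δ w) (λ x y → Δ x w y) pw) (*-cancelˡ-≤ n ⦃ >-nonZero n>0 ⦄ (begin
        n * (## (Δ w) + ## (λ x y → Δ x w y))  ≡⟨ cong (_* (## (Δ w) + ## (λ x y → Δ x w y))) (length-allFin n) ⟨
        length V * (## (Δ w) + ## (λ x y → Δ x w y))  ≤⟨ h ⟩
        ∑ V (λ w → ## (Δ w) + ## (λ x y → Δ x w y))  ≡⟨ ∑-+ V _ _ ⟩
        ∑ V (λ w → ## (Δ w)) + ∑ V (λ w → ## (λ x y → Δ x w y))  ≤⟨ +-mono-≤ triple triple′ ⟩
        n * (10 * E) + n * (10 * E)  ≡⟨ l n E ⟩
        n * (20 * E)  ∎))
        where
        open ≤-Reasoning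
        l : ∀ n E → n * (10 * E) + n * (10 * E) ≡ n * (20 * E)
        l = solve-∀
        pw : ∀ x y → ⟦ g x y xor (χ₀ x xor (g w y xor χ₀ w)) ⟧ ≤ ⟦ Δ w x y ⟧ + ⟦ Δ x w y ⟧
        pw x y rewrite trans (L-sym x w y) (trans (sym₂₃ H y w x) (sym₁₂ H y x w)) =
          ≤ᵇ⇒≤ _ _ (check₅ (λ a b c d e → ⟦ a xor (b xor (c xor d)) ⟧ ≤ᵇ ⟦ e xor (a xor d) ⟧ + ⟦ e xor (c xor b) ⟧)
            tt (g x y) (χ₀ x) (g w y) (χ₀ w) (L w x y))

    Coloured₀ : Set
    Coloured₀ = ∃ λ c → dist g (λ x y → (χ₀ x xor χ₀ y) xor c) ≤ 60 * E

    -- Now g x y is close to χ₀ x + h y, and g is symmetric, so χ₀ x + h y is close to χ₀ y + h x.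
    -- Hence r = χ₀ + h is almost constant, and its value at the best y₀ serves as the constant c.
    coloured₀ : Coloured₀
    coloured₀ = from aligned
      where
      from : (∃ λ w₀ → dist g (λ x y → χ₀ x xor (g w₀ y xor χ₀ w₀)) ≤ 20 * E) → Coloured₀
      from (w₀ , hw) = best (∑-min V (λ y → # V (λ x → r x xor r y)) (subst (0 <_) (sym (length-allFin n)) n>0))
        where
        h r : Fin n → Bool
        h y = g w₀ y xor χ₀ w₀
        r x = χ₀ x xor h x
        hw′ : dist (λ x y → χ₀ y xor h x) g ≤ 20 * E
        hw′ = ≤-trans (≤-reflexive (trans (##-swap _) (∑-cong V λ x → ∑-cong V λ y →
          cong ⟦_⟧ (trans (cong ((χ₀ x xor h y) xor_) (L-sym v y x)) (xor-comm (χ₀ x xor h y) (g x y)))))) hw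
        rr : ## (λ y x → r x xor r y) ≤ 40 * E
        rr = ≤-trans (##-mono (λ y x → ≤-via (check₄ (λ a b c d → ⟦ (a xor b) xor (c xor d) ⟧ ≤ᵇ ⟦ (a xor d) xor (c xor b) ⟧) tt (χ₀ x) (h x) (χ₀ y) (h y))))
          (≤-trans (dist-triangle (λ y x → χ₀ x xor h y) g (λ y x → χ₀ y xor h x)) (≤-trans (+-mono-≤ hw′ hw) (≤-reflexive (l E))))
          where
          l : ∀ E → 20 * E + 20 * E ≡ 40 * E
          l = solve-∀
        best : (∃ λ y → y ∈ V × length V * # V (λ x → r x xor r y) ≤ ## (λ y x → r x xor r y)) → Coloured₀
        best (y₀ , _ , hy) = r y₀ , ≤-trans (dist-triangle g (λ x y → χ₀ x xor h y) _) (≤-trans (+-mono-≤ hw (begin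
            dist (λ x y → χ₀ x xor h y) (λ x y → (χ₀ x xor χ₀ y) xor r y₀)
              ≤⟨ ##-mono (λ x y → ≤-via (check₄ (λ a b c d → ⟦ (a xor b) xor ((a xor c) xor d) ⟧ ≤ᵇ ⟦ (c xor b) xor d ⟧) tt (χ₀ x) (h y) (χ₀ y) (r y₀))) ⟩
            ## (λ x y → r y xor r y₀)  ≡⟨ ##-swap _ ⟩
            ## (λ y x → r y xor r y₀)  ≡⟨ ##-row (λ x → r x xor r y₀) ⟩
            n * # V (λ x → r x xor r y₀)  ≡⟨ cong (_* # V (λ x → r x xor r y₀)) (length-allFin n) ⟨
            length V * # V (λ x → r x xor r y₀)  ≤⟨ hy ⟩
            ## (λ y x → r x xor r y)  ≤⟨ rr ⟩
            40 * E  ∎)) (≤-reflexive (l E)))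
          where
          open ≤-Reasoning
          l : ∀ E → 20 * E + 40 * E ≡ 60 * E
          l = solve-∀

    coloured : Coloured (spread (4 * Kb)) Kb H
    coloured = from coloured₀
      where
      from : Coloured₀ → Coloured (spread (4 * Kb)) Kb H
      from (c , hc) = record
        { χ = χ ; typ = typ ; e = e ; e-small = e-small
        ; few-atypical = ≤-trans (#-mono V (λ w → subst T (not-involutive (amb w)))) few
        ; typical = typical-χ
        ; many-true = colour-large (λ a → a xor not c) (λ a b → ≤ᵇ⇒≤ _ _ (check₂ (λ a b → ⟦ a xor b ⟧ ≤ᵇ ⟦ a xor not c ⟧ + ⟦ b xor not c ⟧) (tc c) a b))
        ; many-false = colour-large (λ a → not (a xor not c)) (λ a b → ≤ᵇ⇒≤ _ _ (check₂ (λ a b → ⟦ a xor b ⟧ ≤ᵇ ⟦ not (a xor not c) ⟧ + ⟦ not (b xor not c) ⟧) (tc′ c) a b))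
        ; same-colour = same
        }
        where
        open ≤-Reasoning
        -- The shift by `not c` enters three times in a triple and thus once modulo 2, which turns
        -- χ₀ w + χ₀ x + χ₀ y + c into the indicator of an even triple for χ.
        χ : Fin n → Bool
        χ x = χ₀ x xor not c
        tc : ∀ c → T (∀Bool λ a → ∀Bool λ b → ⟦ a xor b ⟧ ≤ᵇ ⟦ a xor not c ⟧ + ⟦ b xor not c ⟧)
        tc true = tt
        tc false = tt
        tc′ : ∀ c → T (∀Bool λ a → ∀Bool λ b → ⟦ a xor b ⟧ ≤ᵇ ⟦ not (a xor not c) ⟧ + ⟦ not (b xor not c) ⟧)
        tc′ true = tt
        tc′ false = tt
        typical-χ : ∀ w → T (typ w) → dist (L w) (λ x y → not (χ w xor (χ x xor χ y))) ≤ 69 * E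
        typical-χ w t = begin
          dist (L w) (λ x y → not (χ w xor (χ x xor χ y)))
            ≤⟨ ##-mono (λ x y → ≤-via (check₅ (λ a b d e f → ⟦ a xor not ((b xor not f) xor ((d xor not f) xor (e xor not f))) ⟧ ≤ᵇ ⟦ a xor (((d xor e) xor f) xor b) ⟧) tt (L w x y) (χ₀ w) (χ₀ x) (χ₀ y) c)) ⟩
          dist (L w) (λ x y → ((χ₀ x xor χ₀ y) xor c) xor χ₀ w)
            ≤⟨ dist-triangle (L w) (λ x y → g x y xor χ₀ w) _ ⟩
          dist (L w) (λ x y → g x y xor χ₀ w) + dist (λ x y → g x y xor χ₀ w) (λ x y → ((χ₀ x xor χ₀ y) xor c) xor χ₀ w)
            ≤⟨ +-mono-≤ (typ-g w t) (≤-trans (##-mono (λ x y → ≤-via (check₃ (λ a b d → ⟦ (a xor b) xor (d xor b) ⟧ ≤ᵇ ⟦ a xor d ⟧) tt (g x y) (χ₀ w) ((χ₀ x xor χ₀ y) xor c)))) hc) ⟩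
          9 * E + 60 * E  ≡⟨ l E ⟩
          69 * E  ∎
          where
          l : ∀ E → 9 * E + 60 * E ≡ 69 * E
          l = solve-∀
        odd : ℕ
        odd = ## (λ x y → χ₀ x xor χ₀ y)
        -- Depending on c, the pairs with two different values of χ₀ are close to g or to its
        -- complement, which nearly contains the link of u. In both cases they make up almost half
        -- of all pairs, so neither colour class can be small.
        g-or-not : ∀ b → c ≡ b → n * n ≤ 2 * odd + 123 * E
        g-or-not false refl = lin (2 * E) (+-mono-≤ (L-large v) (+-mono-≤ 4n≤E (*-monoʳ-≤ 2 (≤-trans
            (##-sub g _ (λ x y → χ₀ x xor χ₀ y) (λ x y → ≤ᵇ⇒≤ _ _ (check₂ (λ a b → ⟦ a ⟧ ≤ᵇ ⟦ a xor (b xor false) ⟧ + ⟦ b ⟧) tt (g x y) (χ₀ x xor χ₀ y))))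
            (+-monoˡ-≤ odd hc))))) (l (## g) n E (n * n) odd)
          where
          l : ∀ g n E N o → N + ((2 * g + 4 * n) + (E + 2 * (60 * E + o))) + 2 * E ≡ (2 * o + 123 * E) + (N + (4 * n + 2 * g))
          l = solve-∀
        g-or-not true refl = lin 0 (+-mono-≤ (L-large u) (+-mono-≤ 4n≤E (+-mono-≤ (*-monoʳ-≤ 2 far) (*-monoʳ-≤ 2 (≤-trans
            (##-sub (L u) (λ x y → L u x y ∧ g x y) (λ x y → not (g x y)) (λ x y → ≤ᵇ⇒≤ _ _ (check₂ (λ a b → ⟦ a ⟧ ≤ᵇ ⟦ a ∧ b ⟧ + ⟦ not b ⟧) tt (L u x y) (g x y))))
            (+-monoʳ-≤ (both u v) (≤-trans
              (##-sub (λ x y → not (g x y)) _ (λ x y → χ₀ x xor χ₀ y) (λ x y → ≤ᵇ⇒≤ _ _ (check₂ (λ a b → ⟦ not a ⟧ ≤ᵇ ⟦ a xor (b xor true) ⟧ + ⟦ b ⟧) tt (g x y) (χ₀ x xor χ₀ y))))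
              (+-monoˡ-≤ odd hc)))))))) (l (## (L u)) (both u v) n E (n * n) odd)
          where
          l : ∀ g b n E N o → N + ((2 * g + 4 * n) + (E + (2 * E + 2 * (b + (60 * E + o))))) + 0 ≡ (2 * o + 123 * E) + (N + (4 * n + (2 * b + 2 * g)))
          l = solve-∀
        colour-large : ∀ (f : Bool → Bool) → (∀ a b → ⟦ a xor b ⟧ ≤ ⟦ f a ⟧ + ⟦ f b ⟧) → n ≤ 6 * # V (f ∘ χ₀)
        colour-large f h = *-cancelˡ-≤ (2 * n) ⦃ >-nonZero (*-mono-≤ {1} {2} (s≤s z≤n) n>0) ⦄
          (lin 0 (+-mono-≤ (*-monoʳ-≤ 3 (g-or-not c refl)) (+-mono-≤ (*-monoʳ-≤ 6 odd≤) (E-small 369 (m≤m+n 369 31))))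
            (l n odd (# V (f ∘ χ₀)) E))
          where
          odd≤ : odd ≤ n * # V (f ∘ χ₀) + n * # V (f ∘ χ₀)
          odd≤ = ≤-trans (##-sub _ (λ x _ → f (χ₀ x)) (λ _ y → f (χ₀ y)) (λ x y → h (χ₀ x) (χ₀ y)))
            (≤-reflexive (cong₂ _+_ (##-row (f ∘ χ₀)) (∑-n _)))
          l : ∀ n o k E → 2 * n * n + (3 * (2 * o + 123 * E) + (6 * (n * k + n * k) + n * n)) + 0
            ≡ 2 * n * (6 * k) + (3 * (n * n) + (6 * o + 369 * E))
          l = solve-∀
        -- The intermediate vertices are the typical ones of the common colour. The endpoints may be
        -- atypical: by `ref-large` every link overlaps its reference link in n²/8 pairs, and the
        -- link of a typical vertex differs from that reference by at most 6E.
        same : ∀ w w′ → χ w ≡ χ w′ → T (reach (spread (4 * Kb)) w w′)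
        same w w′ eq = many-up pt (≤-trans (m≤m+n 12 _) (≤-trans (*-monoʳ-≤ 4 Kb-large) (k≤spread (4 * Kb)))) (most⁺ {12} (≤-trans X-large
            (*-monoʳ-≤ 12 (#-mono V (λ a h → ∧-intro (sim w refl a h) (sim w′ (sym (cancel (χ₀ w) (χ₀ w′) (not c) eq)) a h))))))
          where
          cancel : ∀ a b d → a xor d ≡ b xor d → a ≡ b
          cancel true true d _ = refl
          cancel false false d _ = refl
          cancel true false true ()
          cancel true false false ()
          cancel false true true ()
          cancel false true false ()
          same? X : Fin n → Bool
          same? a = not (χ₀ a xor χ₀ w)
          X a = same? a ∧ typ a
          eq-colours : ∀ b → T (∀Bool λ a → ∀Bool λ a′ → ⟦ a xor a′ ⟧ ≤ᵇ ⟦ not (a xor b) ⟧ + ⟦ not (a′ xor b) ⟧)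
          eq-colours true = tt
          eq-colours false = tt
          X-large : n ≤ 12 * # V X
          X-large = lin 0 (+-mono-≤ (*-monoʳ-≤ 2 (colour-large (λ a → not (a xor χ₀ w)) (λ a b → ≤ᵇ⇒≤ _ _ (check₂ (λ a b → ⟦ a xor b ⟧ ≤ᵇ ⟦ not (a xor χ₀ w) ⟧ + ⟦ not (b xor χ₀ w) ⟧) (eq-colours (χ₀ w)) a b))))
              (+-mono-≤ (*-monoʳ-≤ 12 split) (+-mono-≤ (*-monoʳ-≤ 12 few) (≤-trans (*-monoˡ-≤ e (≤-trans (m≤m+n 12 388) Kb-large)) e-small))))
            (l n (# V same?) (# V X) (# V amb) e)
            where
            split : # V same? ≤ # V X + # V amb
            split = ≤-trans (∑-mono V (λ a → ≤ᵇ⇒≤ _ _ (check₂ (λ a b → ⟦ a ⟧ ≤ᵇ ⟦ a ∧ not b ⟧ + ⟦ b ⟧) tt (same? a) (amb a)))) (≤-reflexive (∑-+ V _ _))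
            l : ∀ n s x a e → n + (2 * (6 * s) + (12 * (x + a) + (12 * e + n))) + 0 ≡ 12 * x + (2 * n + (12 * s + (12 * a + 12 * e)))
            l = solve-∀
          sim : ∀ z → χ₀ z ≡ χ₀ w → ∀ a → T (X a) → T (similar (spread (4 * Kb)) z a)
          sim z zw a h = many-up (pt ⊗ pt) (≤-trans (m≤m+n 32 _) (≤-trans (*-monoʳ-≤ 4 Kb-large) (k≤spread (4 * Kb))))
            (##-many 16 (λ p → adj z p ∧ adj a p) n>0 (lin 0
              (+-mono-≤ (*-monoʳ-≤ 2 (ref-large z)) (+-mono-≤ (*-monoʳ-≤ 16 close) (E-small 96 (m≤m+n 96 304))))
              (l (n * n) (## (λ x y → L z x y ∧ ref (χ₀ z) x y)) (both z a) E)))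
            where
            agree : ∀ b b′ → T (not (b xor b′)) → b ≡ b′
            agree true true _ = refl
            agree false false _ = refl
            close : ## (λ x y → L z x y ∧ ref (χ₀ z) x y) ≤ both z a + 6 * E
            close = ≤-trans (##-sub _ (λ x y → L z x y ∧ L a x y) (λ x y → L a x y xor ref (χ₀ z) x y)
                (λ x y → ≤ᵇ⇒≤ _ _ (check₃ (λ p q r → ⟦ p ∧ r ⟧ ≤ᵇ ⟦ p ∧ q ⟧ + ⟦ q xor r ⟧) tt (L z x y) (L a x y) (ref (χ₀ z) x y))))
              (+-monoʳ-≤ (both z a) (subst (λ b → dist (L a) (ref b) ≤ 6 * E)
                (trans (agree (χ₀ a) (χ₀ w) (∧-fst {same? a} h)) (sym zw)) (typ-ref a (∧-snd {same? a} h))))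
            l : ∀ N r b E → N + (2 * (8 * r) + (16 * (b + 6 * E) + N)) + 0 ≡ 16 * b + (2 * N + (16 * r + 96 * E))
            l = solve-∀

  -- If two links share more than E pairs, `many-spread` finds many vertices y adjacent to many
  -- shared pairs, and such y are similar to both ends. If they share few, the vertices overlapping
  -- substantially with both links do the same, unless there are at most e of them.
  dichotomy : 9 ≤ n → (∀ u v → T (reach (spread (4 * Kb)) u v)) ⊎ Coloured (spread (4 * Kb)) Kb H
  dichotomy n≥9 = decide (Finₚ.any? (λ u → Finₚ.any? (λ v → (both u v ≤? E) ×-dec
      (# V (λ w → not (both w u ≤ᵇ E) ∧ not (both w v ≤ᵇ E)) ≤? e))))
    where
    k : ℕ
    k = 4 * Kb
    decide : Dec (∃ λ u → ∃ λ v → both u v ≤ E × # V (λ w → not (both w u ≤ᵇ E) ∧ not (both w v ≤ᵇ E)) ≤ e) →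
      (∀ u v → T (reach (spread k) u v)) ⊎ Coloured (spread k) Kb H
    decide (yes (u , v , far , few)) = inj₂ (Far.coloured u v far few)
    decide (no none) = inj₁ near
      where
      deg-many : ∀ p → proj₁ p ≢ proj₂ p → T (many pt k (λ y → adj y p))
      deg-many (x , x′) x≢ = most⁺ (≤-trans three (*-monoˡ-≤ (# V (edge H x x′)) (≤-trans (≤-trans (m≤m+n 3 397) Kb-large) (m≤m+n Kb _))))
        where
        three : n ≤ 3 * # V (edge H x x′)
        three = *-cancelˡ-≤ 2 (lin 0 (+-mono-≤ (*-monoʳ-≤ 3 (deg x x′ x≢)) n≥9) (l n (# V (edge H x x′))))
          where
          l : ∀ n c → 2 * n + (3 * (2 * c + 3) + n) + 0 ≡ 2 * (3 * c) + (3 * n + 9)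
          l = solve-∀
      near : ∀ u v → T (reach (spread k) u v)
      near u v with both u v ≤? E
      ... | no far = many-mono pt {spread k} {λ y → many (pt ⊗ pt) (spread k) (λ p → (adj u p ∧ adj v p) ∧ adj y p)}
          {λ y → similar (spread k) u y ∧ similar (spread k) v y}
          (λ y h → ∧-intro (many-mono (pt ⊗ pt) (λ p t → ∧-intro (∧-fst (∧-fst {adj u p ∧ adj v p} t)) (∧-snd {adj u p ∧ adj v p} t)) h)
                           (many-mono (pt ⊗ pt) (λ p t → ∧-intro (∧-snd {adj u p} (∧-fst {adj u p ∧ adj v p} t)) (∧-snd {adj u p ∧ adj v p} t)) h))
          (many-spread n>0 k (λ p → adj u p ∧ adj v p) (both-similar u v (<⇒≤ (≰⇒> far)))
            (λ p h → deg-many p (proj₁ (distinct H _ _ u (T⇒≡ (∧-fst {adj u p} h))))))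
      ... | yes far = many-up pt {k} (k≤spread k) (most⁺ (≤-trans e-large (≤-trans (*-monoˡ-≤ e (*-monoˡ-≤ Kb (s≤s (s≤s (z≤n {2})))))
          (*-monoʳ-≤ k (≤-trans (<⇒≤ (≰⇒> (λ few → none (u , v , far , few))))
            (#-mono V (λ w h → ∧-intro (sim w u (∧-fst h)) (sim w v (∧-snd {not (both w u ≤ᵇ E)} h)))))))))
        where
        sim : ∀ w z → T (not (both w z ≤ᵇ E)) → T (similar (spread k) z w)
        sim w z h = many-up (pt ⊗ pt) (k≤spread k) (both-similar z w (≤-trans (<⇒≤ (≰⇒> (λ le → clash (≤⇒≤ᵇ le) h)))
          (##-mono (λ x y → ≤-via (check₂ (λ a b → ⟦ a ∧ b ⟧ ≤ᵇ ⟦ b ∧ a ⟧) tt (L w x y) (L z x y))))))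

-- Tiles and parity in the coloured case

times : ℕ → Bool → Bool
times zero c = false
times (suc j) c = c xor times j c

module Structure (m′ : ℕ) {n : ℕ} (H : ThreeGraph n) (n>0 : 0 < n)
  (deg : ∀ x x′ → x ≢ x′ → n ≤ 2 * # (allFin n) (edge H x x′) + 3)
  (k Kb : ℕ) (k≥144 : 144 ≤ k) (Kb-large : 5000 * suc m′ ≤ Kb) (C : Coloured k Kb H) where
  open Cutting H
  open PairSums n
  open Coloured C public

  private
    m : ℕ
    m = suc m′

  colour : Bool → Fin n → Bool
  colour c x = not (χ x xor c)

  colour-≡ : ∀ {c} x → T (colour c x) → χ x ≡ c
  colour-≡ {c} x h with χ x | c
  ... | true | true = refl
  ... | false | false = refl

  ≡-colour : ∀ {c} x → χ x ≡ c → T (colour c x)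
  ≡-colour {true} x eq rewrite eq = tt
  ≡-colour {false} x eq rewrite eq = tt

  colour-large : ∀ c → n ≤ 6 * # V (colour c)
  colour-large true = ≤-trans many-true (*-monoʳ-≤ 6 (#-mono V (λ x h → ≡-colour x (T⇒≡ h))))
  colour-large false = ≤-trans many-false (*-monoʳ-≤ 6 (#-mono V (λ x h → ≡-colour x (¬T⇒≡ (λ t → clash t h)))))

  e-small′ : ∀ c → c ≤ 5000 → c * (m * e) ≤ n
  e-small′ c c≤ = ≤-trans (≤-reflexive (sym (*-assoc c m e)))
    (≤-trans (*-monoˡ-≤ e (≤-trans (*-monoˡ-≤ m c≤) Kb-large)) e-small)

  typical-colour : ∀ c → T (many pt 12 (λ y → typ y ∧ colour c y))
  typical-colour c = most⁺ (lin 0 (+-mono-≤ (*-monoʳ-≤ 2 (colour-large c)) (+-mono-≤ (*-monoʳ-≤ 12 split)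
      (+-mono-≤ (*-monoʳ-≤ 12 few-atypical) (≤-trans (*-monoʳ-≤ 12 (m≤n*m e m)) (e-small′ 12 (m≤m+n 12 4988))))))
    (l n (# V (colour c)) (# V (λ y → typ y ∧ colour c y)) (# V (not ∘ typ)) e))
    where
    split : # V (colour c) ≤ # V (λ y → typ y ∧ colour c y) + # V (not ∘ typ)
    split = ≤-trans (∑-mono V (λ y → ≤ᵇ⇒≤ _ _ (check₂ (λ a b → ⟦ a ⟧ ≤ᵇ ⟦ b ∧ a ⟧ + ⟦ not b ⟧) tt (colour c y) (typ y)))) (≤-reflexive (∑-+ V _ _))
    l : ∀ n s x a e → n + (2 * (6 * s) + (12 * (x + a) + (12 * e + n))) + 0 ≡ 12 * x + (2 * n + (12 * s + (12 * a + 12 * e)))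
    l = solve-∀

  coloured-pair : Bool → Bool → Fin n × Fin n → Bool
  coloured-pair c c′ (x , x′) = colour c x ∧ colour c′ x′

  pairs-large : ∀ c c′ → n * n ≤ 36 * ## (λ x x′ → coloured-pair c c′ (x , x′))
  pairs-large c c′ = ≤-trans (*-mono-≤ (colour-large c) (colour-large c′)) (≤-reflexive (trans (l (# V (colour c)) (# V (colour c′))) (cong (36 *_) (sym product))))
    where
    l : ∀ a b → 6 * a * (6 * b) ≡ 36 * (a * b)
    l = solve-∀
    ⟦∧⟧ : ∀ a b → ⟦ a ∧ b ⟧ ≡ ⟦ b ⟧ * ⟦ a ⟧
    ⟦∧⟧ true true = refl
    ⟦∧⟧ true false = refl
    ⟦∧⟧ false true = refl
    ⟦∧⟧ false false = refl
    product : ## (λ x x′ → coloured-pair c c′ (x , x′)) ≡ # V (colour c) * # V (colour c′)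
    product = trans (∑-swap V V _) (trans (∑-cong V (λ x′ → trans (∑-cong V (λ x → ⟦∧⟧ (colour c x) (colour c′ x′))) (trans (∑-*ˡ V ⟦ colour c′ x′ ⟧ _) (*-comm ⟦ colour c′ x′ ⟧ _)))) (∑-*ˡ V (# V (colour c)) _))

  -- A pair coloured c, c′ forms an even triple with each y in `ys`, so a typical y misses at most
  -- 69 · n · e of these pairs.
  common : ∀ c c′ {j} (ys : Vec (Fin n) j) → T (allᵛ (λ y → typ y ∧ colour (c xor c′) y) ys) →
    ## (λ x x′ → coloured-pair c c′ (x , x′)) ≤
      ## (λ x x′ → coloured-pair c c′ (x , x′) ∧ allᵛ (λ y → adj y (x , x′)) ys) + j * (69 * (n * e))
  common c c′ [] _ = ≤-trans (##-mono (λ x x′ → ≤-via (check₂ (λ a b → ⟦ a ⟧ ≤ᵇ ⟦ a ∧ true ⟧) tt (coloured-pair c c′ (x , x′)) true))) (≤-reflexive (sym (+-identityʳ _)))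
  common c c′ {suc j} (y ∷ ys) h = begin
    ## U  ≤⟨ common c c′ ys (∧-snd {typ y ∧ colour (c xor c′) y} h) ⟩
    ## (λ x x′ → U x x′ ∧ A x x′) + j * ε  ≤⟨ +-monoˡ-≤ (j * ε) (##-sub _ (λ x x′ → U x x′ ∧ (edge H x x′ y ∧ A x x′))
                                                                               (λ x x′ → edge H x x′ y xor not (χ y xor (χ x xor χ x′))) pw) ⟩
    ## (λ x x′ → U x x′ ∧ (edge H x x′ y ∧ A x x′)) + dist (λ x x′ → edge H x x′ y) (λ x x′ → not (χ y xor (χ x xor χ x′))) + j * ε
                                                                          ≤⟨ +-monoˡ-≤ (j * ε) (+-monoʳ-≤ _ (typical y (∧-fst (∧-fst {typ y ∧ colour (c xor c′) y} h)))) ⟩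
    ## (λ x x′ → U x x′ ∧ (edge H x x′ y ∧ A x x′)) + ε + j * ε  ≡⟨ +-assoc (## (λ x x′ → U x x′ ∧ (edge H x x′ y ∧ A x x′))) ε (j * ε) ⟩
    ## (λ x x′ → U x x′ ∧ (edge H x x′ y ∧ A x x′)) + (ε + j * ε)  ∎
    where
    open ≤-Reasoning
    ε : ℕ
    ε = 69 * (n * e)
    U A : Fin n → Fin n → Bool
    U x x′ = coloured-pair c c′ (x , x′)
    A x x′ = allᵛ (λ y → adj y (x , x′)) ys
    χy : χ y ≡ c xor c′
    χy = colour-≡ y (∧-snd {typ y} (∧-fst {typ y ∧ colour (c xor c′) y} h))
    pw : ∀ x x′ → ⟦ U x x′ ∧ A x x′ ⟧ ≤ ⟦ U x x′ ∧ (edge H x x′ y ∧ A x x′) ⟧ + ⟦ edge H x x′ y xor not (χ y xor (χ x xor χ x′)) ⟧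
    pw x x′ rewrite χy = ≤ᵇ⇒≤ _ _ (∀Bool-elim
      (λ f → ⟦ (not (χ x xor c) ∧ not (χ x′ xor c′)) ∧ f ⟧ ≤ᵇ ⟦ (not (χ x xor c) ∧ not (χ x′ xor c′)) ∧ (edge H x x′ y ∧ f) ⟧ + ⟦ edge H x x′ y xor not ((c xor c′) xor (χ x xor χ x′)) ⟧)
      (check₅ (λ a b c d e → ∀Bool λ f → ⟦ (not (a xor c) ∧ not (b xor d)) ∧ f ⟧ ≤ᵇ ⟦ (not (a xor c) ∧ not (b xor d)) ∧ (e ∧ f) ⟧ + ⟦ e xor not ((c xor d) xor (a xor b)) ⟧)
        tt (χ x) (χ x′) c c′ (edge H x x′ y)) (A x x′))

  many-common : ∀ c c′ {j} (ys : Vec (Fin n) j) → j ≤ m → T (allᵛ (λ y → typ y ∧ colour (c xor c′) y) ys) →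
    T (many (pt ⊗ pt) 144 (λ p → coloured-pair c c′ p ∧ allᵛ (λ y → adj y p) ys))
  many-common c c′ {j} ys j≤m h = ##-many 72 (λ p → coloured-pair c c′ p ∧ allᵛ (λ y → adj y p) ys) n>0
    (lin 0 (+-mono-≤ (*-monoʳ-≤ 2 (pairs-large c c′)) (+-mono-≤ (*-monoʳ-≤ 72 (common c c′ ys h)) small))
      (l (n * n) (## (λ x x′ → coloured-pair c c′ (x , x′))) (## (λ x x′ → coloured-pair c c′ (x , x′) ∧ allᵛ (λ y → adj y (x , x′)) ys)) (j * (69 * (n * e)))))
    where
    open ≤-Reasoning
    -- Here 72 · 69 = 4968 determines the constant 5000 in the lower bound for Kb.
    small : 72 * (j * (69 * (n * e))) ≤ n * n
    small = begin
      72 * (j * (69 * (n * e)))  ≤⟨ *-monoʳ-≤ 72 (*-monoˡ-≤ (69 * (n * e)) j≤m) ⟩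
      72 * (m * (69 * (n * e)))  ≡⟨ l′ m n e ⟩
      n * (4968 * (m * e))  ≤⟨ *-monoʳ-≤ n (e-small′ 4968 (m≤m+n 4968 32)) ⟩
      n * n  ∎
      where
      l′ : ∀ m n e → 72 * (m * (69 * (n * e))) ≡ n * (4968 * (m * e))
      l′ = solve-∀
    l : ∀ N u x d → N + (2 * (36 * u) + (72 * (x + d) + N)) + 0 ≡ 72 * x + (2 * N + (72 * u + 72 * d))
    l = solve-∀

  -- The pattern into which the leftover will be cut: such tuples can be formed from any 3jm
  -- vertices with an even number of true ones and at least jm false ones.
  Shaped : El (tile m) → Set
  Shaped (ys , xs) = All (λ y → χ y ≡ false) (toList ys) × All (λ p → χ (proj₁ p) ≡ χ (proj₂ p)) (toList xs)

  -- A copy with the same colour in every position is found by taking typical false vertices as Y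
  -- and then monochromatic pairs, nearly all of which are joined to them. Equality of colours gives
  -- reachability.
  suits-shaped : ∀ w → Shaped w → T (suits m′ k w)
  suits-shaped (ys , xs) (hy , hx) = manyᵛ-mono pt m {k} {allᵛ Z}
      {λ zs → many (vec (pt ⊗ pt) m) k (λ ps → joined (zs , ps) ∧ (reachAllᵛ pt k ys zs ∧ reachAllᵛ (pt ⊗ pt) k xs ps))}
      (λ zs hz → manyᵛ-mono (pt ⊗ pt) m {k} {λ ps → joined (zs , ps) ∧ reachAllᵛ (pt ⊗ pt) k xs ps}
        {λ ps → joined (zs , ps) ∧ (reachAllᵛ pt k ys zs ∧ reachAllᵛ (pt ⊗ pt) k xs ps)}
        (λ ps h → ∧-intro (∧-fst {joined (zs , ps)} h) (∧-intro (reach-ys ys zs hy hz) (∧-snd {joined (zs , ps)} h)))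
        (pairs zs hz xs hx))
      (many-all pt m (many-up pt {12} {k} (≤-trans (m≤m+n 12 132) k≥144) (typical-colour false)))
    where
    Z : Fin n → Bool
    Z y = typ y ∧ colour false y
    reach-ys : ∀ {j} (ys zs : Vec (Fin n) j) → All (λ y → χ y ≡ false) (toList ys) → T (allᵛ Z zs) → T (reachAllᵛ pt k ys zs)
    reach-ys [] [] _ _ = tt
    reach-ys (y ∷ ys) (z ∷ zs) (hy ∷ hys) hz =
      ∧-intro (same-colour y z (trans hy (sym (colour-≡ z (∧-snd {typ z} (∧-fst {Z z} hz)))))) (reach-ys ys zs hys (∧-snd {Z z} hz))
    pairs : ∀ (zs : Vec (Fin n) m) → T (allᵛ Z zs) → ∀ {j} (xs : Vec (Fin n × Fin n) j) → All (λ p → χ (proj₁ p) ≡ χ (proj₂ p)) (toList xs) →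
      T (manyᵛ (pt ⊗ pt) j k (λ ps → joined (zs , ps) ∧ reachAllᵛ (pt ⊗ pt) k xs ps))
    pairs zs hz [] [] = tt
    pairs zs hz {suc j} ((a , b) ∷ xs) (eq ∷ hx) = many-mono (pt ⊗ pt) {k} {λ p → coloured-pair (χ a) (χ a) p ∧ allᵛ (λ y → adj y p) zs}
        {λ p → manyᵛ (pt ⊗ pt) j k (λ ps → joined (zs , p ∷ ps) ∧ reachAllᵛ (pt ⊗ pt) k ((a , b) ∷ xs) (p ∷ ps))}
        (λ p h → manyᵛ-mono (pt ⊗ pt) j {k} {λ ps → joined (zs , ps) ∧ reachAllᵛ (pt ⊗ pt) k xs ps}
          (λ ps h′ → ∧-intro (∧-intro (∧-snd {coloured-pair (χ a) (χ a) p} h) (∧-fst h′))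
            (∧-intro (∧-intro (same-colour a (proj₁ p) (sym (colour-≡ (proj₁ p) (∧-fst (∧-fst {coloured-pair (χ a) (χ a) p} h)))))
                              (same-colour b (proj₂ p) (trans (sym eq) (sym (colour-≡ (proj₂ p) (∧-snd {colour (χ a) (proj₁ p)} (∧-fst {coloured-pair (χ a) (χ a) p} h)))))))
                     (∧-snd {joined (zs , ps)} h′)))
          (pairs zs hz xs hx))
        (many-up (pt ⊗ pt) {144} {k} k≥144 (many-common (χ a) (χ a) zs ≤-refl
          (subst (λ c → T (allᵛ (λ y → typ y ∧ colour c y) zs)) (sym (xor-self (χ a))) hz)))
      where
      xor-self : ∀ b → b xor b ≡ false
      xor-self true = refl
      xor-self false = refl

  parity : List (Fin n) → Bool
  parity [] = false
  parity (x ∷ l) = χ x xor parity l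

  parity-++ : ∀ l l′ → parity (l ++ l′) ≡ parity l xor parity l′
  parity-++ [] l′ = refl
  parity-++ (x ∷ l) l′ = trans (cong (χ x xor_) (parity-++ l l′)) (sym (xor-assoc (χ x) (parity l) (parity l′)))

  parity-ys : ∀ {j c} (ys : Vec (Fin n) j) → (∀ i → χ (Vec.lookup ys i) ≡ c) → parity (vertsᵛ pt ys) ≡ times j c
  parity-ys [] h = refl
  parity-ys (y ∷ ys) h = cong₂ _xor_ (h zero) (parity-ys ys (h ∘ suc))

  pairParity : Fin n × Fin n → Bool
  pairParity (x , x′) = χ x xor χ x′

  parity-xs : ∀ {j c} (xs : Vec (Fin n × Fin n) j) → (∀ i → pairParity (Vec.lookup xs i) ≡ c) → parity (vertsᵛ (pt ⊗ pt) xs) ≡ times j c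
  parity-xs [] h = refl
  parity-xs ((x , x′) ∷ xs) h = trans (sym (xor-assoc (χ x) (χ x′) _)) (cong₂ _xor_ (h zero) (parity-xs xs (h ∘ suc)))

  -- The other m′ vertices of Y and the other m′ pairs contribute m′ times c each and cancel, so the
  -- wrong triple formed by y and p decides.
  parity-bad : ∀ {c} p y (ys : Vec (Fin n) m′) (xs : Vec (Fin n × Fin n) m′) → χ y xor pairParity p ≡ true →
    (∀ i → χ (Vec.lookup ys i) ≡ c) → (∀ i → pairParity (Vec.lookup xs i) ≡ c) →
    parity (verts (tile m) (y ∷ ys , p ∷ xs)) ≡ true
  parity-bad {c} (x , x′) y ys xs wrong hy hx = trans (parity-++ (vertsᵛ pt (y ∷ ys)) (vertsᵛ (pt ⊗ pt) ((x , x′) ∷ xs)))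
    (trans (cong₂ (λ a b → (χ y xor a) xor (χ x xor (χ x′ xor b))) (parity-ys ys hy) (parity-xs xs hx))
      (combine (χ y) (χ x) (χ x′) (times m′ c) wrong))
    where
    combine : ∀ a b d t → a xor (b xor d) ≡ true → (a xor t) xor (b xor (d xor t)) ≡ true
    combine a b d t eq = T⇒≡ (impl _ _ (check₄ (λ a b d t → not (a xor (b xor d)) ∨ ((a xor t) xor (b xor (d xor t)))) tt a b d t) (≡⇒T eq))
      where
      impl : ∀ p q → T (not p ∨ q) → T p → T q
      impl true q h _ = h

  NoBadTile : Set
  NoBadTile = ∀ t → T (joined t) → Unique (verts (tile m) t) → parity (verts (tile m) t) ≡ false

  bad : Fin n → Fin n → Fin n → Bool
  bad x x′ y = edge H x x′ y ∧ (χ y xor pairParity (x , x′))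

  bad-sym : ∀ x x′ y → T (bad x x′ y) → T (bad x y x′)
  bad-sym x x′ y h = ∧-intro (subst T (sym₂₃ H x x′ y) (∧-fst h))
    (impl (χ x) (χ x′) (χ y) (∧-snd {edge H x x′ y} h))
    where
    impl : ∀ a b c → T (c xor (a xor b)) → T (b xor (a xor c))
    impl a b c h = go (check₃ (λ a b c → not (c xor (a xor b)) ∨ (b xor (a xor c))) tt a b c) h
      where
      go : ∀ {p q} → T (not p ∨ q) → T p → T q
      go {true} h _ = h

  bad-≢ : ∀ x x′ y → T (bad x x′ y) → (x ≢ x′) × (x′ ≢ y) × (x ≢ y)
  bad-≢ x x′ y h = distinct H x x′ y (T⇒≡ (∧-fst h))

  allᵛ-tabulate : ∀ {A : Set} {j} (P : A → Bool) (xs : Vec A j) → (∀ i → T (P (Vec.lookup xs i))) → T (allᵛ P xs)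
  allᵛ-tabulate P [] h = tt
  allᵛ-tabulate P (x ∷ xs) h = ∧-intro (h zero) (allᵛ-tabulate P xs (h ∘ suc))

  choose : ∀ s κ (P : El s → Bool) F → Unique F → 2 * κ * (length F + size s) ≤ n → T (many s κ P) →
    ∃ λ x → Unique (verts s x ++ F) × T (P x)
  choose s κ P F uF room h = found (sel s κ (tt ∷ []) (λ _ → P) F uF n>0 room (s≤s z≤n) (λ _ → h))
    where
    found : (∃ λ x → Unique (verts s x ++ F) × 1 ≤ cost s κ * # (tt ∷ []) (λ _ → P x)) → ∃ λ x → Unique (verts s x ++ F) × T (P x)
    found (x , u , le) = x , u , proj₂ (proj₂ (#-find (tt ∷ []) (λ _ → P x) (factor-pos {c = cost s κ} (s≤s z≤n) le)))

  module _ (noBad : NoBadTile) (large : 2 * (48 * m + 144) * (6 * m) ≤ n) where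

    private
      k₀ : ℕ
      -- A colour class has at least n/6 vertices. With this constant the 2m exclusions in
      -- `matching` and the m losses in `no-matching` each add up to about n/12, half of a class.
      k₀ = 48 * m

      large′ : ∀ {a b} → a ≤ 48 * m + 144 → b ≤ 6 * m → 2 * a * b ≤ n
      large′ ha hb = ≤-trans (*-mono-≤ (*-monoʳ-≤ 2 ha) hb) large

    -- A pair with many wrong neighbours extends to a tile of the wrong parity.
    few-typical-bad : ∀ x x′ → x ≢ x′ → ¬ T (many pt k₀ (λ y → bad x x′ y ∧ typ y))
    few-typical-bad x x′ x≢ h = contra (choose (vec pt m ⊗ vec (pt ⊗ pt) m′) (k₀ + 144)
        (λ (ys , xs) → allᵛ (λ y → bad x x′ y ∧ typ y) ys ∧ allᵛ (λ p → coloured-pair γ false p ∧ allᵛ (λ y → adj y p) ys) xs)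
        (x ∷ x′ ∷ []) ((x≢ ∷ []) ∷ ([] ∷ [])) (large′ ≤-refl small)
        (manyᵛ-mono pt m (λ ys hys → manyᵛ-mono (pt ⊗ pt) m′ (λ xs hxs → ∧-intro hys hxs)
            (many-all (pt ⊗ pt) m′ (many-up (pt ⊗ pt) (m≤n+m 144 k₀) (many-common γ false ys ≤-refl (allᵛ-mono ys typ-col hys)))))
          (many-all pt m (many-up pt (m≤m+n k₀ 144) h))))
      where
      -- All wrong neighbours of the pair have this colour, so pairs coloured γ, false form even
      -- triples with them and `many-common` supplies the remaining pairs.
      γ : Bool
      γ = not (pairParity (x , x′))
      small : 2 + (m * 1 + m′ * 2) ≤ 6 * m
      small = ≤-trans (m≤m+n _ (3 * m)) (≤-reflexive (l m′))
        where
        l : ∀ a → 2 + ((1 + a) * 1 + a * 2) + 3 * (1 + a) ≡ 6 * (1 + a)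
        l = solve-∀
      γ-eq : ∀ a b → T (a xor b) → a ≡ not b
      γ-eq true false _ = refl
      γ-eq false true _ = refl
      bad-colour : ∀ y → T (bad x x′ y) → χ y ≡ γ
      bad-colour y b = γ-eq (χ y) _ (∧-snd {edge H x x′ y} b)
      xor-false : ∀ b → b xor false ≡ b
      xor-false true = refl
      xor-false false = refl
      typ-col : ∀ y → T (bad x x′ y ∧ typ y) → T (typ y ∧ colour (γ xor false) y)
      typ-col y h = ∧-intro (∧-snd {bad x x′ y} h) (≡-colour y (trans (bad-colour y (∧-fst h)) (sym (xor-false γ))))
      contra : (∃ λ (t : El (vec pt m ⊗ vec (pt ⊗ pt) m′)) → Unique (verts (vec pt m ⊗ vec (pt ⊗ pt) m′) t ++ x ∷ x′ ∷ []) ×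
        T (allᵛ (λ y → bad x x′ y ∧ typ y) (proj₁ t) ∧ allᵛ (λ p → coloured-pair γ false p ∧ allᵛ (λ y → adj y p) (proj₁ t)) (proj₂ t))) → ⊥
      contra ((ys@(y ∷ ys′) , xs) , u , h) = true≢false (trans (sym par) (noBad (ys , (x , x′) ∷ xs) joins unique))
        where
        true≢false : true ≡ false → ⊥
        true≢false ()
        hys = ∧-fst {allᵛ (λ y → bad x x′ y ∧ typ y) ys} h
        hxs = ∧-snd {allᵛ (λ y → bad x x′ y ∧ typ y) ys} h
        badᵢ : ∀ i → T (bad x x′ (Vec.lookup ys i))
        badᵢ i = ∧-fst (allᵛ-lookup (λ y → bad x x′ y ∧ typ y) ys hys i)
        joins : T (joined (ys , (x , x′) ∷ xs))
        joins = ∧-intro (allᵛ-mono {P = λ y → bad x x′ y ∧ typ y} {λ y → adj y (x , x′)} ys (λ y h → ∧-fst (∧-fst {bad x x′ y} h)) hys)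
                        (allᵛ-mono {P = λ p → coloured-pair γ false p ∧ allᵛ (λ y → adj y p) ys} xs (λ p h → ∧-snd {coloured-pair γ false p} h) hxs)
        unique : Unique (verts (tile m) (ys , (x , x′) ∷ xs))
        unique = Unique-↭ (solve 3 (λ a b c → (a ⊕ b) ⊕ c ⊜ a ⊕ (c ⊕ b)) ↭-refl (vertsᵛ pt ys) (vertsᵛ (pt ⊗ pt) xs) (x ∷ x′ ∷ [])) u
          where open ↭-Solver (Fin n)
        par : parity (verts (tile m) (ys , (x , x′) ∷ xs)) ≡ true
        par = parity-bad (x , x′) y ys′ xs (T⇒≡ (∧-snd {edge H x x′ y} (badᵢ zero))) (λ i → bad-colour _ (badᵢ (suc i)))
          (λ i → pair-col (Vec.lookup xs i) (∧-fst (allᵛ-lookup (λ p → coloured-pair γ false p ∧ allᵛ (λ y → adj y p) ys) xs hxs i)))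
          where
          pair-col : ∀ p → T (coloured-pair γ false p) → pairParity p ≡ γ
          pair-col (a , b) h = trans (cong₂ _xor_ (colour-≡ a (∧-fst {colour γ a} h)) (colour-≡ b (∧-snd {colour γ a} h))) (xor-false γ)

    few-bad : ∀ x x′ → k₀ * # V (bad x x′) ≤ 2 * n
    few-bad x x′ with x ≟ x′
    ... | yes refl = ≤-trans (*-monoʳ-≤ k₀ (#-mono V {Q = λ _ → false} (λ y h → proj₁ (bad-≢ x x y h) refl)))
      (≤-trans (≤-reflexive (trans (cong (k₀ *_) (trans (∑-n 0) (*-zeroʳ n))) (*-zeroʳ k₀))) z≤n)
    ... | no x≢ = lin 0 (+-mono-≤ (*-monoʳ-≤ k₀ split) (+-mono-≤ (<⇒≤ (≰⇒> (few-typical-bad x x′ x≢ ∘ most⁺)))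
        (+-mono-≤ (*-monoʳ-≤ k₀ few-atypical) (≤-trans (≤-reflexive (*-assoc 48 m e)) (e-small′ 48 (m≤m+n 48 4952))))))
      (l k₀ n (# V (bad x x′)) (# V (λ y → bad x x′ y ∧ typ y)) (# V (not ∘ typ)) e)
      where
      split : # V (bad x x′) ≤ # V (λ y → bad x x′ y ∧ typ y) + # V (not ∘ typ)
      split = ≤-trans (∑-mono V (λ y → ≤ᵇ⇒≤ _ _ (check₂ (λ a b → ⟦ a ⟧ ≤ᵇ ⟦ a ∧ b ⟧ + ⟦ not b ⟧) tt (bad x x′ y) (typ y)))) (≤-reflexive (∑-+ V _ _))
      l : ∀ k n b t a e → k * b + (k * (t + a) + (n + (k * e + n))) + 0 ≡ 2 * n + (k * b + (k * t + (k * a + k * e)))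
      l = solve-∀

    m-small : 72 * m ≤ n
    m-small = ≤-trans (m≤m+n (72 * m) _) (≤-trans (≤-reflexive (l m)) large)
      where
      l : ∀ m → 72 * m + (576 * m * m + 1656 * m) ≡ 2 * (48 * m + 144) * (6 * m)
      l = solve-∀

    excluded : Fin n → List (Fin n) → Fin n → Bool
    excluded a [] x = false
    excluded a (u ∷ us) x = (⌊ x ≟ u ⌋ ∨ bad a u x) ∨ excluded a us x

    few-excluded : ∀ a us → k₀ * # V (excluded a us) ≤ length us * (k₀ + 2 * n)
    few-excluded a [] = ≤-trans (≤-reflexive (trans (cong (k₀ *_) (trans (∑-n 0) (*-zeroʳ n))) (*-zeroʳ k₀))) z≤n
    few-excluded a (u ∷ us) = lin 0 (+-mono-≤ (*-monoʳ-≤ k₀ split) (+-mono-≤ (*-monoʳ-≤ k₀ (#-≡ V u (allFin⁺ n)))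
        (+-mono-≤ (few-bad a u) (few-excluded a us))))
      (l k₀ n (# V (excluded a (u ∷ us))) (# V (λ x → ⌊ x ≟ u ⌋)) (# V (bad a u)) (# V (excluded a us)) (length us))
      where
      split : # V (excluded a (u ∷ us)) ≤ # V (λ x → ⌊ x ≟ u ⌋) + (# V (bad a u) + # V (excluded a us))
      split = ≤-trans (∑-mono V (λ x → ≤ᵇ⇒≤ _ _ (check₃ (λ p q r → ⟦ (p ∨ q) ∨ r ⟧ ≤ᵇ ⟦ p ⟧ + (⟦ q ⟧ + ⟦ r ⟧)) tt ⌊ x ≟ u ⌋ (bad a u x) (excluded a us x))))
        (≤-reflexive (trans (∑-+ V _ _) (cong (# V (λ x → ⌊ x ≟ u ⌋) +_) (∑-+ V _ _))))
      l : ∀ k n e q b x s → k * e + (k * (q + (b + x)) + (k * 1 + (2 * n + s * (k + 2 * n)))) + 0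
        ≡ (k + 2 * n + s * (k + 2 * n)) + (k * e + (k * q + (k * b + k * x)))
      l = solve-∀

    excluded-sound : ∀ a us x → T (not (excluded a us x)) → All (λ u → (x ≢ u) × ¬ T (bad a u x)) us
    excluded-sound a [] x _ = []
    excluded-sound a (u ∷ us) x h = (neq u _ _ h , ¬or {⌊ x ≟ u ⌋} h) ∷ excluded-sound a us x (¬or′ h)
      where
      neq : ∀ u q r → T (not ((⌊ x ≟ u ⌋ ∨ q) ∨ r)) → x ≢ u
      neq u q r h with x ≟ u
      ... | no ne = ne
      ... | yes _ = ⊥-elim h
      ¬or : ∀ {p q r} → T (not ((p ∨ q) ∨ r)) → ¬ T q
      ¬or {false} {false} _ ()
      ¬or′ : ∀ {p r} → T (not (p ∨ r)) → T (not r)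
      ¬or′ {false} h = h

    Matching : Fin n → ℕ → Set
    Matching a j = ∃ λ (X : Vec (Fin n × Fin n) j) → Unique (a ∷ vertsᵛ (pt ⊗ pt) X) ×
      (∀ i → T (bad a (proj₁ (Vec.lookup X i)) (proj₂ (Vec.lookup X i))))

    matching : ∀ a κ → (∀ x → T (colour κ x) → x ≢ a → 0 < # V (bad a x)) → ∀ j → j ≤ m → Matching a j
    matching a κ h zero _ = [] , ([] ∷ []) , λ ()
    matching a κ h (suc j) j<m = extend (matching a κ h j (<⇒≤ j<m))
      where
      extend : Matching a j → Matching a (suc j)
      extend (X , uX , hX) = with-x (#-find V (λ x → colour κ x ∧ not (excluded a us x)) room)
        where
        us : List (Fin n)
        us = a ∷ vertsᵛ (pt ⊗ pt) X
        split : # V (colour κ) ≤ # V (λ x → colour κ x ∧ not (excluded a us x)) + # V (excluded a us)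
        split = ≤-trans (∑-mono V (λ x → ≤ᵇ⇒≤ _ _ (check₂ (λ p q → ⟦ p ⟧ ≤ᵇ ⟦ p ∧ not q ⟧ + ⟦ q ⟧) tt (colour κ x) (excluded a us x)))) (≤-reflexive (∑-+ V _ _))
        us-small : length us ≤ 2 * m
        us-small = ≤-trans (≤-reflexive (cong suc (length-vertsᵛ (pt ⊗ pt) X))) (≤-trans (n≤1+n _) (≤-trans (*-monoˡ-≤ 2 j<m) (≤-reflexive (*-comm m 2))))
        room : 0 < # V (λ x → colour κ x ∧ not (excluded a us x))
        room = ≰⇒> λ none → <⇒≱ (≤-trans (m<m+n n n>0) (≤-reflexive (cong (n +_) (sym (+-identityʳ n)))))
          (*-cancelˡ-≤ (16 * m) (lin 0
            (+-mono-≤ (*-monoʳ-≤ (48 * m) (colour-large κ)) (+-mono-≤ (*-monoʳ-≤ (6 * (48 * m)) (≤-trans split (+-monoˡ-≤ _ none)))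
              (+-mono-≤ (*-monoʳ-≤ 6 (few-excluded a us)) (+-mono-≤ (*-monoʳ-≤ 6 (*-monoˡ-≤ (k₀ + 2 * n) us-small)) (*-monoʳ-≤ (8 * m) m-small)))))
            (l m n (# V (colour κ)) (# V (excluded a us)) (length us * (k₀ + 2 * n)))))
          where
          l : ∀ m n c x y → 16 * m * (2 * n) + (48 * m * (6 * c) + (6 * (48 * m) * x + (6 * y + (6 * (2 * m * (48 * m + 2 * n)) + 8 * m * n)))) + 0
            ≡ 16 * m * n + (48 * m * n + (6 * (48 * m) * c + (6 * (48 * m * x) + (6 * y + 8 * m * (72 * m)))))
          l = solve-∀
        with-x : (∃ λ x → x ∈ V × T (colour κ x ∧ not (excluded a us x))) → Matching a (suc j)
        with-x (x , _ , hx) = with-z (#-find V (bad a x) (h x (∧-fst hx) (proj₁ (All.head fresh))))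
          where
          fresh : All (λ u → (x ≢ u) × ¬ T (bad a u x)) us
          fresh = excluded-sound a us x (∧-snd {colour κ x} hx)
          with-z : (∃ λ z → z ∈ V × T (bad a x z)) → Matching a (suc j)
          with-z (z , _ , hz) = (x , z) ∷ X ,
            Unique-↭ (shift a (x ∷ z ∷ []) (vertsᵛ (pt ⊗ pt) X))
              ((proj₁ (proj₂ (bad-≢ a x z hz)) ∷ All.map proj₁ fresh) ∷ (z-fresh ∷ uX)) ,
            λ { zero → hz ; (suc i) → hX i }
            where
            z-fresh : All (z ≢_) us
            z-fresh = All.map (λ { (_ , ¬b) refl → ¬b (bad-sym a x z hz) }) fresh

    module _ (a : Fin n) (χa : χ a ≡ false) where

      bad-pair : ∀ x z → T (bad a x z) → (x ≢ z) × (pairParity (x , z) ≡ true) × T (adj a (x , z))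
      bad-pair x z h = proj₁ (proj₂ (bad-≢ a x z h)) , par (χ x) (χ z) (subst (λ b → T (χ z xor (b xor χ x))) χa (∧-snd {edge H a x z} h)) ,
        subst T (trans (sym₁₂ H a x z) (sym₂₃ H x a z)) (∧-fst h)
        where
        par : ∀ b c → T (c xor b) → b xor c ≡ true
        par true false _ = refl
        par false true _ = refl

      another : ∃ λ a′ → (a ≢ a′) × χ a′ ≡ false
      another = found (#-find V (λ y → not (χ y) ∧ not ⌊ y ≟ a ⌋) two)
        where
        split : # V (not ∘ χ) ≤ # V (λ y → not (χ y) ∧ not ⌊ y ≟ a ⌋) + 1
        split = ≤-trans (∑-mono V (λ x → ≤ᵇ⇒≤ _ _ (check₂ (λ p q → ⟦ p ⟧ ≤ᵇ ⟦ p ∧ not q ⟧ + ⟦ q ⟧) tt (not (χ x)) ⌊ x ≟ a ⌋)))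
          (≤-trans (≤-reflexive (∑-+ V _ _)) (+-monoʳ-≤ _ (#-≡ V a (allFin⁺ n))))
        two : 0 < # V (λ y → not (χ y) ∧ not ⌊ y ≟ a ⌋)
        two = ≰⇒> λ none → <⇒≱ {6} {72} (m≤m+n 7 65) (≤-trans (*-monoʳ-≤ 72 (s≤s (z≤n {m′})))
          (≤-trans m-small (≤-trans many-false (*-monoʳ-≤ 6 (≤-trans split (+-monoˡ-≤ 1 none))))))
        found : (∃ λ y → y ∈ V × T (not (χ y) ∧ not ⌊ y ≟ a ⌋)) → ∃ λ a′ → (a ≢ a′) × χ a′ ≡ false
        found (y , _ , h) = y , neq , ¬T⇒≡ (λ t → clash t (∧-fst h))
          where
          neq : a ≢ y
          neq eq with y ≟ a | ∧-snd {not (χ y)} h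
          ... | no ne | _ = ne (sym eq)

      -- The pair (x , z) has both colours, so almost all of its roughly n/2 or more neighbours are
      -- true. There are hardly more than n/2 true vertices in all, because the pair of false
      -- vertices a, a′ has about n/2 neighbours, almost all of them false.
      missing : ∀ x z → T (bad a x z) → k₀ * # V (λ y → χ y ∧ not (adj y (x , z))) ≤ 3 * k₀ + 4 * n
      missing x z h = bound (bad-pair x z h) another
        where
        bound : (x ≢ z) × (pairParity (x , z) ≡ true) × T (adj a (x , z)) → (∃ λ a′ → (a ≢ a′) × χ a′ ≡ false) →
          k₀ * # V (λ y → χ y ∧ not (adj y (x , z))) ≤ 3 * k₀ + 4 * n
        bound (x≢z , par , _) (a′ , a≢ , χa′) = *-cancelˡ-≤ 2 (lin 0
            (+-mono-≤ (*-monoʳ-≤ k₀ (+-mono-≤ (*-monoʳ-≤ 2 parts) (+-mono-≤ (deg x z x≢z) (+-mono-≤ (*-monoʳ-≤ 2 good-xz)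
              (+-mono-≤ (deg a a′ a≢) (+-mono-≤ (*-monoʳ-≤ 2 good-aa′) (*-monoʳ-≤ 2 (≤-reflexive (trans (#-not V χ) (length-allFin n)))))))))) (+-mono-≤ (*-monoʳ-≤ 2 (few-bad x z)) (*-monoʳ-≤ 2 (few-bad a a′))))
            (l k₀ n (# V χ) (# V (not ∘ χ)) (# V (λ y → χ y ∧ not (adj y (x , z)))) (# V (λ y → χ y ∧ adj y (x , z)))
              (# V (edge H x z)) (# V (edge H a a′)) (# V (bad x z)) (# V (bad a a′))))
          where
          parts : # V (λ y → χ y ∧ not (adj y (x , z))) + # V (λ y → χ y ∧ adj y (x , z)) ≤ # V χ
          parts = ≤-reflexive (trans (sym (∑-+ V _ _)) (∑-cong V (λ y → pw (χ y) (adj y (x , z)))))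
            where
            pw : ∀ p q → ⟦ p ∧ not q ⟧ + ⟦ p ∧ q ⟧ ≡ ⟦ p ⟧
            pw true true = refl
            pw true false = refl
            pw false _ = refl
          good-xz : # V (edge H x z) ≤ # V (λ y → χ y ∧ adj y (x , z)) + # V (bad x z)
          good-xz = ≤-trans (∑-mono V pw) (≤-reflexive (∑-+ V _ _))
            where
            pw : ∀ y → ⟦ edge H x z y ⟧ ≤ ⟦ χ y ∧ adj y (x , z) ⟧ + ⟦ bad x z y ⟧
            pw y rewrite par = ≤ᵇ⇒≤ _ _ (check₂ (λ p q → ⟦ q ⟧ ≤ᵇ ⟦ p ∧ q ⟧ + ⟦ q ∧ (p xor true) ⟧) tt (χ y) (edge H x z y))
          good-aa′ : # V (edge H a a′) ≤ # V (bad a a′) + # V (not ∘ χ)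
          good-aa′ = ≤-trans (∑-mono V pw) (≤-reflexive (∑-+ V _ _))
            where
            pw : ∀ y → ⟦ edge H a a′ y ⟧ ≤ ⟦ bad a a′ y ⟧ + ⟦ not (χ y) ⟧
            pw y rewrite χa | χa′ = ≤ᵇ⇒≤ _ _ (check₂ (λ p q → ⟦ q ⟧ ≤ᵇ ⟦ q ∧ (p xor false) ⟧ + ⟦ not p ⟧) tt (χ y) (edge H a a′ y))
          l : ∀ k n B A M G c c′ b b′ → 2 * (k * M) + (k * (2 * B + ((2 * c + 3) + (2 * (G + b) + ((2 * c′ + 3) + (2 * (b′ + A) + 2 * n))))) + (2 * (2 * n) + 2 * (2 * n))) + 0
            ≡ 2 * (3 * k + 4 * n) + (k * (2 * (M + G) + (n + (2 * c + (n + (2 * c′ + 2 * (B + A)))))) + (2 * (k * b) + 2 * (k * b′)))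
          l = solve-∀

      all-joined : ∀ {j} (X : Vec (Fin n × Fin n) j) → (∀ i → T (bad a (proj₁ (Vec.lookup X i)) (proj₂ (Vec.lookup X i)))) →
        k₀ * # V χ ≤ k₀ * # V (λ y → χ y ∧ allᵛ (adj y) X) + j * (3 * k₀ + 4 * n)
      all-joined [] _ = ≤-trans (*-monoʳ-≤ k₀ (#-mono V (λ y h → ∧-intro h tt))) (≤-reflexive (sym (+-identityʳ _)))
      all-joined {suc j} (p ∷ X) h = lin 0 (+-mono-≤ (all-joined X (h ∘ suc)) (+-mono-≤ (*-monoʳ-≤ k₀ split) (missing (proj₁ p) (proj₂ p) (h zero))))
          (l k₀ (# V χ) (# V (λ y → χ y ∧ allᵛ (adj y) X)) (# V (λ y → χ y ∧ (adj y p ∧ allᵛ (adj y) X))) (# V (λ y → χ y ∧ not (adj y p))) (3 * k₀ + 4 * n) j)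
        where
        split : # V (λ y → χ y ∧ allᵛ (adj y) X) ≤ # V (λ y → χ y ∧ (adj y p ∧ allᵛ (adj y) X)) + # V (λ y → χ y ∧ not (adj y p))
        split = ≤-trans (∑-mono V (λ y → ≤ᵇ⇒≤ _ _ (check₃ (λ a b c → ⟦ a ∧ c ⟧ ≤ᵇ ⟦ a ∧ (b ∧ c) ⟧ + ⟦ a ∧ not b ⟧) tt (χ y) (adj y p) (allᵛ (adj y) X)))) (≤-reflexive (∑-+ V _ _))
        l : ∀ k B g g′ q d j → k * B + ((k * g + j * d) + (k * (g′ + q) + d)) + 0 ≡ (k * g′ + (d + j * d)) + (k * B + (k * g + k * q))
        l = solve-∀

      -- The m pairs of the matching contain one true vertex each. Together with a and m′ true
      -- common neighbours as Y they span a tile with m + m′ true vertices, an odd number.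
      no-matching : ¬ Matching a m
      no-matching (X@(p ∷ xs) , uX , hX) = contra (choose (vec pt m′) 24 (allᵛ (λ y → χ y ∧ allᵛ (adj y) X)) (a ∷ vertsᵛ (pt ⊗ pt) X) uX
          (large′ (≤-trans (m≤m+n 24 120) (m≤n+m 144 k₀)) small) (many-all pt m′ (most⁺ enough)))
        where
        small : length (a ∷ vertsᵛ (pt ⊗ pt) X) + m′ * 1 ≤ 6 * m
        small = ≤-trans (≤-reflexive (cong (λ z → suc z + m′ * 1) (length-vertsᵛ (pt ⊗ pt) X))) (≤-trans (m≤m+n _ (3 * m)) (≤-reflexive (l m′)))
          where
          l : ∀ a → (1 + ((1 + a) * 2)) + a * 1 + 3 * (1 + a) ≡ 6 * (1 + a)
          l = solve-∀
        enough : n ≤ 24 * # V (λ y → χ y ∧ allᵛ (adj y) X)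
        enough = *-cancelˡ-≤ (12 * m) (lin 0
            (+-mono-≤ (*-monoʳ-≤ (48 * m) many-true) (+-mono-≤ (*-monoʳ-≤ 6 (all-joined X hX)) (*-monoʳ-≤ (12 * m) m-small)))
            (l m n (# V χ) (# V (λ y → χ y ∧ allᵛ (adj y) X))))
          where
          l : ∀ m n B G → 12 * m * n + (48 * m * (6 * B) + (6 * (48 * m * G + m * (3 * (48 * m) + 4 * n)) + 12 * m * n)) + 0
            ≡ 12 * m * (24 * G) + (48 * m * n + (6 * (48 * m * B) + 12 * m * (72 * m)))
          l = solve-∀
        contra : (∃ λ (ys : Vec (Fin n) m′) → Unique (vertsᵛ pt ys ++ a ∷ vertsᵛ (pt ⊗ pt) X) × T (allᵛ (λ y → χ y ∧ allᵛ (adj y) X) ys)) → ⊥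
        contra (ys , u , h) = true≢false (trans (sym par) (noBad (a ∷ ys , X) joins unique))
          where
          true≢false : true ≡ false → ⊥
          true≢false ()
          hᵢ : ∀ i → T (χ (Vec.lookup ys i) ∧ allᵛ (adj (Vec.lookup ys i)) X)
          hᵢ = allᵛ-lookup (λ y → χ y ∧ allᵛ (adj y) X) ys h
          joins : T (joined (a ∷ ys , X))
          joins = allᵛ-tabulate (λ p → adj a p ∧ allᵛ (λ y → adj y p) ys) X (λ i → ∧-intro (proj₂ (proj₂ (bad-pair _ _ (hX i))))
            (allᵛ-tabulate (λ y → adj y (Vec.lookup X i)) ys (λ i′ → allᵛ-lookup (adj (Vec.lookup ys i′)) X (∧-snd {χ (Vec.lookup ys i′)} (hᵢ i′)) i)))
          unique : Unique (verts (tile m) (a ∷ ys , X))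
          unique = Unique-↭ (shift a (vertsᵛ pt ys) (vertsᵛ (pt ⊗ pt) X)) u
          par : parity (verts (tile m) (a ∷ ys , X)) ≡ true
          par = parity-bad p a ys xs (cong₂ _xor_ χa (proj₁ (proj₂ (bad-pair _ _ (hX zero))))) (λ i → T⇒≡ (∧-fst (hᵢ i))) (λ i → proj₁ (proj₂ (bad-pair _ _ (hX (suc i)))))

    -- Fix a false vertex a. If α ≤ t + 1, every other false x has at most t - 1 false vertices
    -- besides a and x, so a, x lies in a wrong edge. If β ≤ t, the same holds for every true x,
    -- with at most t - 1 true vertices left. Both contradict `no-matching`, and otherwise α + β = n
    -- ≤ 2t + 3 forces β = t + 1.
    parity-even : ∀ t → (∀ x x′ → x ≢ x′ → t ≤ # V (edge H x x′)) → n ≤ 2 * t + 3 →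
      (2 * t + 3 ≤ n → times (suc t) true ≡ false) → parity V ≡ false
    parity-even t codeg n≤ even = with-a (#-find V (not ∘ χ) (factor-pos {c = 6} n>0 many-false))
      where
      open ≤-Reasoning
      α β : ℕ
      α = # V (not ∘ χ)
      β = # V χ
      total : β + α ≡ n
      total = trans (#-not V χ) (length-allFin n)
      parity-# : ∀ l → parity l ≡ times (# l χ) true
      parity-# [] = refl
      parity-# (x ∷ l) with χ x
      ... | true = cong not (parity-# l)
      ... | false = parity-# l
      self : ∀ x → 1 ≤ # V (λ y → ⌊ y ≟ x ⌋)
      self x = one V (∈-allFin x)
        where
        one : ∀ l → x ∈ l → 1 ≤ # l (λ y → ⌊ y ≟ x ⌋)
        one (y ∷ l) (here refl) with x ≟ x
        ... | yes _ = s≤s z≤n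
        ... | no ne = ⊥-elim (ne refl)
        one (y ∷ l) (there x∈) = ≤-trans (one l x∈) (m≤n+m _ ⟦ ⌊ y ≟ x ⌋ ⟧)
      edge-a : ∀ x y → ¬ T (edge H x y x)
      edge-a x y h = proj₂ (proj₂ (distinct H x y x (T⇒≡ h))) refl
      edge-x : ∀ x y → ¬ T (edge H x y y)
      edge-x x y h = proj₁ (proj₂ (distinct H x y y (T⇒≡ h))) refl
      with-a : (∃ λ a → a ∈ V × T (not (χ a))) → parity V ≡ false
      with-a (a , _ , ha) = cases (α ≤? suc t) (β ≤? t)
        where
        χa : χ a ≡ false
        χa = ¬T⇒≡ (λ t → clash t ha)
        same-class : α ≤ suc t → ∀ x → T (colour false x) → x ≢ a → 0 < # V (bad a x)
        same-class α≤ x cx x≢a = +-cancelʳ-≤ (suc t) _ _ (begin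
          1 + suc t  ≡⟨ +-comm 2 t ⟩
          t + 2  ≤⟨ +-mono-≤ (codeg a x (x≢a ∘ sym)) (+-mono-≤ (self a) (self x)) ⟩
          # V (edge H a x) + (# V (λ y → ⌊ y ≟ a ⌋) + # V (λ y → ⌊ y ≟ x ⌋))  ≡⟨ trans (∑-+ V _ _) (cong (# V (edge H a x) +_) (∑-+ V _ _)) ⟨
          ∑ V (λ y → ⟦ edge H a x y ⟧ + (⟦ ⌊ y ≟ a ⌋ ⟧ + ⟦ ⌊ y ≟ x ⌋ ⟧))  ≤⟨ ∑-mono V pw ⟩
          ∑ V (λ y → ⟦ bad a x y ⟧ + ⟦ not (χ y) ⟧)  ≡⟨ ∑-+ V _ _ ⟩
          # V (bad a x) + α  ≤⟨ +-monoʳ-≤ (# V (bad a x)) α≤ ⟩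
          # V (bad a x) + suc t  ∎)
          where
          χx : χ x ≡ false
          χx = colour-≡ x cx
          pw : ∀ y → ⟦ edge H a x y ⟧ + (⟦ ⌊ y ≟ a ⌋ ⟧ + ⟦ ⌊ y ≟ x ⌋ ⟧) ≤ ⟦ bad a x y ⟧ + ⟦ not (χ y) ⟧
          pw y with y ≟ a | y ≟ x
          ... | yes refl | yes refl = ⊥-elim (x≢a refl)
          ... | yes refl | no _ rewrite ¬T⇒≡ (edge-a a x) | χa = ≤-refl
          ... | no _ | yes refl rewrite ¬T⇒≡ (edge-x a x) | χx = ≤-refl
          ... | no _ | no _ rewrite χa | χx = ≤ᵇ⇒≤ _ _ (check₂ (λ p q → ⟦ p ⟧ + 0 ≤ᵇ ⟦ p ∧ (q xor false) ⟧ + ⟦ not q ⟧) tt (edge H a x y) (χ y))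
        other-class : β ≤ t → ∀ x → T (colour true x) → x ≢ a → 0 < # V (bad a x)
        other-class β≤ x cx x≢a = +-cancelʳ-≤ t _ _ (begin
          1 + t  ≡⟨ +-comm 1 t ⟩
          t + 1  ≤⟨ +-mono-≤ (codeg a x (x≢a ∘ sym)) (self x) ⟩
          # V (edge H a x) + # V (λ y → ⌊ y ≟ x ⌋)  ≡⟨ ∑-+ V _ _ ⟨
          ∑ V (λ y → ⟦ edge H a x y ⟧ + ⟦ ⌊ y ≟ x ⌋ ⟧)  ≤⟨ ∑-mono V pw ⟩
          ∑ V (λ y → ⟦ bad a x y ⟧ + ⟦ χ y ⟧)  ≡⟨ ∑-+ V _ _ ⟩
          # V (bad a x) + β  ≤⟨ +-monoʳ-≤ (# V (bad a x)) β≤ ⟩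
          # V (bad a x) + t  ∎)
          where
          χx : χ x ≡ true
          χx = colour-≡ x cx
          pw : ∀ y → ⟦ edge H a x y ⟧ + ⟦ ⌊ y ≟ x ⌋ ⟧ ≤ ⟦ bad a x y ⟧ + ⟦ χ y ⟧
          pw y with y ≟ x
          ... | yes refl rewrite ¬T⇒≡ (edge-x a x) | χx = ≤-refl
          ... | no _ rewrite χa | χx = ≤ᵇ⇒≤ _ _ (check₂ (λ p q → ⟦ p ⟧ + 0 ≤ᵇ ⟦ p ∧ (q xor true) ⟧ + ⟦ q ⟧) tt (edge H a x y) (χ y))
        cases : Dec (α ≤ suc t) → Dec (β ≤ t) → parity V ≡ false
        cases (yes α≤) _ = ⊥-elim (no-matching a χa (matching a false (same-class α≤) m ≤-refl))
        cases (no _) (yes β≤) = ⊥-elim (no-matching a χa (matching a true (other-class β≤) m ≤-refl))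
        cases (no α≰) (no β≰) = trans (parity-# V) (trans (cong (λ b → times b true) β≡) (even (begin
            2 * t + 3  ≡⟨ l t ⟩
            suc t + suc (suc t)  ≤⟨ +-mono-≤ (≰⇒> β≰) (≰⇒> α≰) ⟩
            β + α  ≡⟨ total ⟩
            n  ∎)))
          where
          l : ∀ t → 2 * t + 3 ≡ (1 + t) + (1 + (1 + t))
          l = solve-∀
          β≡ : β ≡ suc t
          β≡ = ≤-antisym (+-cancelʳ-≤ (suc (suc t)) _ _ (begin
            β + suc (suc t)  ≤⟨ +-monoʳ-≤ β (≰⇒> α≰) ⟩
            β + α  ≡⟨ total ⟩
            n  ≤⟨ n≤ ⟩
            2 * t + 3  ≡⟨ l t ⟩
            suc t + suc (suc t)  ∎)) (≰⇒> β≰)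

-- The degree condition: 2t + 3 ≥ n, with equality only for n ≡ 1 (mod 4), when t + 1 is even.

threshold-1 : ∀ n → n % 4 ≡ 1 → threshold n ≡ (n / 2) ∸ 1
threshold-1 n eq with n % 4
threshold-1 n refl | 1 = refl

threshold-≢1 : ∀ n → n % 4 ≢ 1 → threshold n ≡ ((n + 1) / 2) ∸ 1
threshold-≢1 n ne with n % 4
... | 0 = refl
... | 1 = ⊥-elim (ne refl)
... | suc (suc _) = refl

half : ∀ r q → (r + q * 4) / 2 ≡ r / 2 + q * 2
half r q = trans (cong (λ z → (r + z) / 2) (l q)) (trans (+-distrib-/-∣ʳ r (divides (q * 2) refl)) (cong (r / 2 +_) (m*n/n≡m (q * 2) 2)))
  where
  l : ∀ q → q * 4 ≡ q * 2 * 2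
  l = solve-∀

times-even : ∀ q → times (q * 2) true ≡ false
times-even zero = refl
times-even (suc q) = trans (not-involutive (times (q * 2) true)) (times-even q)

ThresholdFacts : ℕ → ℕ → Set
ThresholdFacts n t = n ≤ 2 * t + 3 × (2 * t + 3 ≤ n → times (suc t) true ≡ false)

threshold-facts : ∀ n → ThresholdFacts n (threshold n)
threshold-facts n = subst (λ z → ThresholdFacts z (threshold z)) (sym (m≡m%n+[m/n]*n n 4)) (residue (n % 4) (n / 4) (m%n<n n 4))
  where
  loose : ∀ n t → n < 2 * t + 3 → ThresholdFacts n t
  loose n t lt = <⇒≤ lt , λ ge → ⊥-elim (<⇒≱ lt ge)
  residue : ∀ r q → r < 4 → ThresholdFacts (r + q * 4) (threshold (r + q * 4))
  value : ∀ r q t → r % 4 ≢ 1 → (suc r / 2 + q * 2) ∸ 1 ≡ t → threshold (r + q * 4) ≡ t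
  value r q t ne eq = trans (threshold-≢1 (r + q * 4) (λ h → ne (trans (sym ([m+kn]%n≡m%n r q 4)) h)))
    (trans (cong (λ z → z / 2 ∸ 1) (+-comm (r + q * 4) 1)) (trans (cong (_∸ 1) (half (suc r) q)) eq))
  -- For n = 0 and n = 1 the truncated subtraction gives threshold 0 where -1 would be expected, so
  -- these values are treated apart.
  residue 0 zero _ = loose 0 0 (s≤s z≤n)
  residue 0 (suc p) _ = subst (ThresholdFacts (suc p * 4)) (sym (value 0 (suc p) (suc (p * 2)) (λ ()) refl)) (loose (suc p * 4) (suc (p * 2)) (≤-reflexive (l p)))
    where
    l : ∀ p → 1 + (1 + p) * 4 ≡ 2 * (1 + p * 2) + 3
    l = solve-∀
  residue 1 zero _ = loose 1 0 (s≤s (s≤s z≤n))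
  residue 1 (suc p) _ = subst (ThresholdFacts (1 + suc p * 4))
    (sym (trans (threshold-1 (1 + suc p * 4) ([m+kn]%n≡m%n 1 (suc p) 4)) (cong (_∸ 1) (half 1 (suc p)))))
    (≤-reflexive (l p) , λ _ → times-even (suc p))
    where
    l : ∀ p → 1 + (1 + p) * 4 ≡ 2 * (1 + p * 2) + 3
    l = solve-∀
  residue 2 q _ = subst (ThresholdFacts (2 + q * 4)) (sym (value 2 q (q * 2) (λ ()) refl)) (loose (2 + q * 4) (q * 2) (≤-reflexive (l q)))
    where
    l : ∀ p → 1 + (2 + p * 4) ≡ 2 * (p * 2) + 3
    l = solve-∀
  residue 3 q _ = subst (ThresholdFacts (3 + q * 4)) (sym (value 3 q (suc (q * 2)) (λ ()) refl)) (loose (3 + q * 4) (suc (q * 2)) (≤-trans (n≤1+n _) (≤-reflexive (l q))))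
    where
    l : ∀ p → 1 + (1 + (3 + p * 4)) ≡ 2 * (1 + p * 2) + 3
    l = solve-∀
  residue (suc (suc (suc (suc r)))) q (s≤s (s≤s (s≤s (s≤s ()))))

-- Assembling the factor

codeg-# : ∀ {n} (H : ThreeGraph n) x y → codeg H x y ≡ # (allFin n) (edge H x y)
codeg-# {n} H x y = count (edge H x y)
  where
  count : ∀ {n} (f : Fin n → Bool) → Subset.∣ Vec.tabulate f ∣ ≡ # (allFin n) f
  count {zero} f = refl
  count {suc n} f = trans (head (f zero) (Vec.tabulate (f ∘ suc))) (cong (⟦ f zero ⟧ +_) (trans (count (f ∘ suc)) (shift-∑ f)))
    where
    head : ∀ b (v : Vec Bool n) → Subset.∣ b ∷ v ∣ ≡ ⟦ b ⟧ + Subset.∣ v ∣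
    head true v = refl
    head false v = refl
    shift-∑ : ∀ f → # (allFin n) (f ∘ suc) ≡ ∑ (tabulate suc) (λ x → ⟦ f x ⟧)
    shift-∑ f = trans (∑-map (allFin n)) (cong (λ l → ∑ l (λ x → ⟦ f x ⟧)) (map-tabulate id suc))
      where
      ∑-map : ∀ l → # l (f ∘ suc) ≡ ∑ (map suc l) (λ x → ⟦ f x ⟧)
      ∑-map [] = refl
      ∑-map (x ∷ l) = cong (⟦ f (suc x) ⟧ +_) (∑-map l)

multiple : ∀ w b s K → w + b * s ≡ K * s → w ≡ (K ∸ b) * s
multiple w b s K eq = trans (sym (m+n∸n≡m w (b * s))) (trans (cong (_∸ b * s) eq) (sym (*-distribʳ-∸ s K b)))

times-even⁻¹ : ∀ j → times j true ≡ false → ∃ λ b → j ≡ b * 2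
times-even⁻¹ zero _ = 0 , refl
times-even⁻¹ (suc (suc j)) eq with b , e ← times-even⁻¹ j (trans (sym (not-involutive (times j true))) eq) = suc b , cong (λ z → suc (suc z)) e

flat-All : ∀ {A : Set} {P : A → Set} (ps : List (A × A)) → All P (flat ps) → All (λ (x , x′) → P x × P x′) ps
flat-All [] _ = []
flat-All (_ ∷ ps) (p ∷ p′ ∷ a) = (p , p′) ∷ flat-All ps a

module Finish (m′ : ℕ) {n : ℕ} (H : ThreeGraph n) (k C : ℕ) where
  open Cutting H

  private
    m s : ℕ
    m = suc m′
    s = size (tile m)

  finish : ∀ F W (ts us : List (El (tile m))) → Absorbs m′ k C F → allFin n ↭ (W ++ tilesVerts ts) ++ F →
    All (T ∘ joined) ts → tilesVerts us ↭ W → All (T ∘ suits m′ k) us → length us ≤ C → Tileable m (allFin n)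
  finish F W ts us abs perm joins uperm suit len = tileable-↭ (↭-sym (↭-trans perm (↭-trans (++⁺ʳ F (++⁺ʳ (tilesVerts ts) (↭-sym uperm)))
      (solve 3 (λ u t f → (u ⊕ t) ⊕ f ⊜ (u ⊕ f) ⊕ t) ↭-refl (tilesVerts us) (tilesVerts ts) F))))
    (tileable-++ (abs us suit len) (tileable-list ts joins))
    where open ↭-Solver (Fin n)

  -- All other parts of the vertex set have sizes divisible by s, including the absorber, which is
  -- tileable when it has nothing to absorb.
  rest-multiple : ∀ K → n ≡ K * s → ∀ F W (ts : List (El (tile m))) → Tileable m F → allFin n ↭ (W ++ tilesVerts ts) ++ F →
    ∃ λ j → length W ≡ j * s
  rest-multiple K n≡ F W ts til perm = from (length-tileable til)
    where
    from : (∃ λ a → length F ≡ a * s) → ∃ λ j → length W ≡ j * s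
    from (a , eq) = K ∸ (length ts + a) , multiple (length W) (length ts + a) s K (begin
      length W + (length ts + a) * s  ≡⟨ cong (length W +_) (*-distribʳ-+ s (length ts) a) ⟩
      length W + (length ts * s + a * s)  ≡⟨ cong₂ (λ x y → length W + (x + y)) (length-tilesVerts ts) eq ⟨
      length W + (length (tilesVerts ts) + length F) ≡⟨ +-assoc (length W) _ _ ⟨
      length W + length (tilesVerts ts) + length F  ≡⟨ cong (_+ length F) (length-++ W) ⟨
      length (W ++ tilesVerts ts) + length F  ≡⟨ length-++ (W ++ tilesVerts ts) ⟨
      length ((W ++ tilesVerts ts) ++ F)  ≡⟨ ↭-length perm ⟨
      length (allFin n)  ≡⟨ length-allFin n ⟩
      n  ≡⟨ n≡ ⟩
      K * s  ∎)
      where open ≡-Reasoning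

  j≤len : ∀ j → j ≤ j * s
  j≤len j = m≤m*n j s

  triples : ∀ j → j * s ≡ j * m + j * m * 2
  triples j = trans (cong (j *_) (size-tile m)) (l j m)
    where
    l : ∀ j m → j * (3 * m) ≡ j * m + j * m * 2
    l = solve-∀

  finish-near : ∀ K → n ≡ K * s → (∀ w → T (suits m′ k w)) → ∀ F W (ts : List (El (tile m))) → Absorbs m′ k C F →
    allFin n ↭ (W ++ tilesVerts ts) ++ F → All (T ∘ joined) ts → length W ≤ C → Tileable m (allFin n)
  finish-near K n≡ suit F W ts abs perm joins lenW = cut (rest-multiple K n≡ F W ts (abs [] [] z≤n) perm)
    where
    cut : (∃ λ j → length W ≡ j * s) → Tileable m (allFin n)
    cut (j , lj) = ys-ps (splitAt′ (j * m) W (≤-trans (m≤m+n _ _) (≤-reflexive (sym (trans lj (triples j))))))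
      where
      ys-ps : (∃ λ ys → ∃ λ R → W ≡ ys ++ R × length ys ≡ j * m) → Tileable m (allFin n)
      ys-ps (ys , R , refl , ly) = paired (pairUp (j * m) R (+-cancelˡ-≡ (j * m) _ _ (trans (cong (_+ length R) (sym ly))
          (trans (sym (length-++ ys)) (trans lj (triples j))))))
        where
        paired : (∃ λ ps → length ps ≡ j * m × flat ps ≡ R) → Tileable m (allFin n)
        paired (ps , lp , refl) = tiled (tilesOf m j ys ps ly lp)
          where
          tiled : (∃ λ (us : List (El (tile m))) → length us ≡ j × tilesVerts us ↭ ys ++ flat ps × All (Within ys ps) us) → Tileable m (allFin n)
          tiled (us , lu , uperm , _) = finish F (ys ++ flat ps) ts us abs perm joins uperm (All.tabulate (λ {w} _ → suit w))
            (≤-trans (≤-reflexive lu) (≤-trans (j≤len j) (≤-trans (≤-reflexive (sym lj)) lenW)))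

module FinishColoured (m′ : ℕ) {n : ℕ} (H : ThreeGraph n) (n>0 : 0 < n)
  (deg : ∀ x x′ → x ≢ x′ → n ≤ 2 * # (allFin n) (edge H x x′) + 3)
  (k Kb : ℕ) (k≥144 : 144 ≤ k) (Kb-large : 5000 * suc m′ ≤ Kb) (Col : Coloured k Kb H) (c : ℕ)
  (large : 2 * (48 * suc m′ + 144) * (6 * suc m′) ≤ n)
  (K : ℕ) (n≡ : n ≡ K * size (tile (suc m′))) where
  open Structure m′ H n>0 deg k Kb k≥144 Kb-large Col
  open Cutting H

  private
    m s C : ℕ
    m = suc m′
    s = size (tile m)
    -- The absorber must cope with the uncovered vertices W, the false reserve Z and the vertices of
    -- one dissolved tile.
    C = c + s * c + s

  parity-↭ : ∀ {l l′} → l ↭ l′ → parity l ≡ parity l′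
  parity-↭ _↭_.refl = refl
  parity-↭ (prep x p) = cong (χ x xor_) (parity-↭ p)
  parity-↭ (swap {l} {l′} x y p) = trans (sym (xor-assoc (χ x) (χ y) (parity l)))
    (trans (cong₂ _xor_ (xor-comm (χ x) (χ y)) (parity-↭ p)) (xor-assoc (χ y) (χ x) (parity l′)))
  parity-↭ (_↭_.trans p q) = trans (parity-↭ p) (parity-↭ q)

  parity-true : ∀ {l} → All (T ∘ χ) l → parity l ≡ times (length l) true
  parity-true [] = refl
  parity-true (p ∷ a) = cong₂ _xor_ (T⇒≡ p) (parity-true a)

  parity-false : ∀ {l} → All (T ∘ not ∘ χ) l → parity l ≡ false
  parity-false [] = refl
  parity-false {x ∷ l} (p ∷ a) = trans (cong (_xor parity l) (¬T⇒≡ (λ t → clash t p))) (parity-false a)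

  -- Let |W| = 3jm. Once jm false vertices are set aside as the sets Y, 2jm vertices remain; the
  -- true ones among them are even in number, hence so are the false ones, and both kinds can be
  -- paired within their colour.
  finish-even : ∀ F W (ts : List (El (tile m))) → Absorbs m′ k C F →
    allFin n ↭ (W ++ tilesVerts ts) ++ F → All (T ∘ joined) ts → length W ≤ C → parity W ≡ false →
    length W ≤ 3 * # W (not ∘ χ) → Tileable m (allFin n)
  finish-even F W ts abs perm joins lenW even enough = cut (Finish.rest-multiple m′ H k C K n≡ F W ts (abs [] [] z≤n) perm)
    where
    A B : List (Fin n)
    A = keep (not ∘ χ) W
    B = keep (not ∘ not ∘ χ) W
    A-false : All (T ∘ not ∘ χ) A
    A-false = keep-all (not ∘ χ) W
    B-true : All (T ∘ χ) B
    B-true = All.map (λ {x} → subst T (not-involutive (χ x))) (keep-all (not ∘ not ∘ χ) W)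
    W↭ : W ↭ A ++ B
    W↭ = keep-↭ (not ∘ χ) W
    B-even : times (length B) true ≡ false
    B-even = begin
      times (length B) true  ≡⟨ parity-true B-true ⟨
      parity B  ≡⟨ cong (_xor parity B) (parity-false A-false) ⟨
      parity A xor parity B  ≡⟨ parity-++ A B ⟨
      parity (A ++ B)  ≡⟨ parity-↭ W↭ ⟨
      parity W  ≡⟨ even ⟩
      false  ∎
      where open ≡-Reasoning
    cut : (∃ λ j → length W ≡ j * s) → Tileable m (allFin n)
    cut (j , lj) = halves (times-even⁻¹ (length B) B-even)
      where
      open ≤-Reasoning
      A-large : j * m ≤ length A
      A-large = *-cancelˡ-≤ 3 (begin
        3 * (j * m)  ≡⟨ l j m ⟩
        j * (3 * m)  ≡⟨ cong (j *_) (size-tile m) ⟨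
        j * s  ≡⟨ lj ⟨
        length W  ≤⟨ enough ⟩
        3 * # W (not ∘ χ)  ≡⟨ cong (3 *_) (length-keep (not ∘ χ) W) ⟨
        3 * length A  ∎)
        where
        l : ∀ j m → 3 * (j * m) ≡ j * (3 * m)
        l = solve-∀
      halves : (∃ λ b → length B ≡ b * 2) → Tileable m (allFin n)
      halves (b , lb) = ys-ps (splitAt′ (j * m) A A-large)
        where
        ys-ps : (∃ λ ys → ∃ λ R → A ≡ ys ++ R × length ys ≡ j * m) → Tileable m (allFin n)
        ys-ps (ys , R , A≡ , ly) = paired (pairUp (j * m ∸ b) R (multiple (length R) b 2 (j * m) rest)) (pairUp b B lb)
          where
          rest : length R + b * 2 ≡ j * m * 2
          rest = +-cancelˡ-≡ (j * m) _ _ (begin-equality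
            j * m + (length R + b * 2)  ≡⟨ cong₂ (λ x y → x + (length R + y)) ly lb ⟨
            length ys + (length R + length B)  ≡⟨ +-assoc (length ys) _ _ ⟨
            length ys + length R + length B  ≡⟨ cong (_+ length B) (length-++ ys) ⟨
            length (ys ++ R) + length B  ≡⟨ cong (λ z → length z + length B) A≡ ⟨
            length A + length B  ≡⟨ length-++ A ⟨
            length (A ++ B)  ≡⟨ ↭-length W↭ ⟨
            length W  ≡⟨ trans lj (Finish.triples m′ H k C j) ⟩
            j * m + j * m * 2  ∎)
          A-false′ : All (T ∘ not ∘ χ) (ys ++ R)
          A-false′ = subst (All (T ∘ not ∘ χ)) A≡ A-false
          false≡ : ∀ {x} → T (not (χ x)) → χ x ≡ false
          false≡ h = ¬T⇒≡ (λ t → clash t h)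
          paired : (∃ λ ps → length ps ≡ j * m ∸ b × flat ps ≡ R) → (∃ λ qs → length qs ≡ b × flat qs ≡ B) → Tileable m (allFin n)
          paired (ps , lp , fp) (qs , lq , fq) = tiled (tilesOf m j ys (ps ++ qs) ly lpq)
            where
            flat-pq : flat (ps ++ qs) ≡ R ++ B
            flat-pq = trans (concatMap-++ _ ps qs) (cong₂ _++_ fp fq)
            lpq : length (ps ++ qs) ≡ j * m
            lpq = *-cancelʳ-≡ _ _ 2 (trans (sym (length-flat (ps ++ qs))) (trans (cong length flat-pq)
              (trans (length-++ R) (trans (cong (length R +_) lb) rest))))
            mono : All (λ p → χ (proj₁ p) ≡ χ (proj₂ p)) (ps ++ qs)
            mono = Allₚ.++⁺
              (All.map (λ (h , h′) → trans (false≡ h) (sym (false≡ h′))) (flat-All ps (subst (All (T ∘ not ∘ χ)) (sym fp) (Allₚ.++⁻ʳ ys A-false′))))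
              (All.map (λ (h , h′) → trans (T⇒≡ h) (sym (T⇒≡ h′))) (flat-All qs (subst (All (T ∘ χ)) (sym fq) B-true)))
            tiled : (∃ λ (us : List (El (tile m))) → length us ≡ j × tilesVerts us ↭ ys ++ flat (ps ++ qs) × All (Within ys (ps ++ qs)) us) →
              Tileable m (allFin n)
            tiled (us , lu , uperm , within) = Finish.finish m′ H k C F W ts us abs perm joins
              (↭-trans uperm (↭-trans (↭-reflexive (trans (cong (ys ++_) flat-pq) (trans (sym (++-assoc ys R B)) (cong (_++ B) (sym A≡))))) (↭-sym W↭)))
              (All.map (λ {w} (a , b) → suits-shaped w (All.map (λ y∈ → false≡ (All.lookup (Allₚ.++⁻ˡ ys A-false′) y∈)) a , All.map (All.lookup mono) b)) within)
              (begin
                length us  ≡⟨ lu ⟩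
                j  ≤⟨ Finish.j≤len m′ H k C j ⟩
                j * s  ≡⟨ lj ⟨
                length W  ≤⟨ lenW ⟩
                C  ∎)

  parity-tiles : NoBadTile → ∀ (ts : List (El (tile m))) → All (T ∘ joined) ts → Unique (tilesVerts ts) → parity (tilesVerts ts) ≡ false
  parity-tiles noBad [] _ _ = refl
  parity-tiles noBad (t ∷ ts) (j ∷ js) u = trans (parity-++ (verts (tile m) t) (tilesVerts ts))
    (cong₂ _xor_ (noBad t j (Unique-++ˡ (verts (tile m) t) u)) (parity-tiles noBad ts js (Unique-++ʳ (verts (tile m) t) u)))

  Prepared : List (Fin n) → Set
  Prepared P = ∃ λ F → ∃ λ (Z : List (Fin n)) → ∃ λ W → ∃ λ (ts : List (El (tile m))) →
    Absorbs m′ k C F × (allFin n ↭ (W ++ tilesVerts ts) ++ (F ++ (Z ++ P))) × All (T ∘ joined) ts ×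
    length W < c × All (T ∘ not ∘ χ) Z × length Z ≡ s * c

  module _ (g : ℕ) (absorb : Absorbing m′ k (2 * g) C H)
    (almost : ∀ F → Unique F → g * length F ≤ n → AlmostTiled m′ c H F)
    (room₁ : 4 * spreads m′ k * (s * c + s) ≤ n) (room₂ : 2 * g * (s * c + s) ≤ n) (room₃ : 12 * (s + s * c) ≤ n) where

    -- Z ensures that at least a third of the leftover is coloured false, as the Y-parts of the last tiles require.
    prepare : ∀ P → Unique P → length P ≤ s → Prepared P
    prepare P uP lP = with-Z (choose (vec pt (s * c)) 6 (allᵛ (not ∘ χ)) P uP
        (≤-trans (*-monoʳ-≤ 12 (+-mono-≤ lP (≤-reflexive (*-identityʳ (s * c))))) room₃)
        (many-all pt (s * c) (most⁺ many-false)))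
      where
      with-Z : (∃ λ (Z : Vec (Fin n) (s * c)) → Unique (vertsᵛ pt Z ++ P) × T (allᵛ (not ∘ χ) Z)) → Prepared P
      with-Z (Z , uZ , hZ) = with-F (absorb Q uZ (≤-trans (*-monoʳ-≤ (4 * spreads m′ k) lQ) room₁))
        where
        Q : List (Fin n)
        Q = vertsᵛ pt Z ++ P
        lZ : length (vertsᵛ pt Z) ≡ s * c
        lZ = trans (length-vertsᵛ pt Z) (*-identityʳ (s * c))
        lQ : length Q ≤ s * c + s
        lQ = ≤-trans (≤-reflexive (length-++ (vertsᵛ pt Z))) (+-mono-≤ (≤-reflexive lZ) lP)
        Z-false : ∀ {j} (Z : Vec (Fin n) j) → T (allᵛ (not ∘ χ) Z) → All (T ∘ not ∘ χ) (vertsᵛ pt Z)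
        Z-false [] _ = []
        Z-false (z ∷ Z) h = ∧-fst h ∷ Z-false Z (∧-snd {not (χ z)} h)
        with-F : (∃ λ F → Unique (F ++ Q) × 2 * g * length F ≤ n × Absorbs m′ k C F) → Prepared P
        with-F (F , uF , lF , abs) = with-ts (almost (F ++ Q) uF (*-cancelˡ-≤ 2 (begin
            2 * (g * length (F ++ Q))  ≡⟨ cong (λ z → 2 * (g * z)) (length-++ F) ⟩
            2 * (g * (length F + length Q))  ≡⟨ l g (length F) (length Q) ⟩
            2 * g * length F + 2 * g * length Q  ≤⟨ +-mono-≤ lF (≤-trans (*-monoʳ-≤ (2 * g) lQ) room₂) ⟩
            n + n  ≡⟨ cong (n +_) (+-identityʳ n) ⟨
            2 * n  ∎)))
          where
          open ≤-Reasoning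
          l : ∀ g a b → 2 * (g * (a + b)) ≡ 2 * g * a + 2 * g * b
          l = solve-∀
          with-ts : AlmostTiled m′ c H (F ++ Q) → Prepared P
          with-ts (ts , W , joins , perm , lW) = F , vertsᵛ pt Z , W , ts , abs , perm , joins , lW , Z-false Z hZ , lZ

    private
      1≤s : 1 ≤ s
      1≤s = s≤s z≤n

      -- Both W and R have at most s · c = |Z| vertices, so Z alone is a third of the leftover.
      count-Z : ∀ (W Z R : List (Fin n)) → All (T ∘ not ∘ χ) Z → length W < c → length Z ≡ s * c → length R ≤ s →
        (length ((W ++ Z) ++ R) ≤ C) × (length ((W ++ Z) ++ R) ≤ 3 * # ((W ++ Z) ++ R) (not ∘ χ))
      count-Z W Z R hZ lW lZ lR = ≤-trans total (≤-reflexive refl) , (begin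
          length ((W ++ Z) ++ R)  ≤⟨ total ⟩
          c + s * c + s  ≤⟨ +-mono-≤ (+-monoˡ-≤ (s * c) (≤-trans (≤-reflexive (sym (*-identityˡ c))) (*-monoˡ-≤ c 1≤s)))
                                                   (≤-trans (≤-reflexive (sym (*-identityʳ s))) (*-monoʳ-≤ s 1≤c)) ⟩
          s * c + s * c + s * c  ≡⟨ l (s * c) ⟩
          3 * (s * c)  ≡⟨ cong (3 *_) lZ ⟨
          3 * length Z  ≡⟨ cong (3 *_) (#-all (not ∘ χ) hZ) ⟨
          3 * # Z (not ∘ χ)  ≤⟨ *-monoʳ-≤ 3 (≤-trans (m≤n+m _ (# W (not ∘ χ))) (≤-trans (m≤m+n _ (# R (not ∘ χ)))
                                                   (≤-reflexive (sym (trans (∑-++ (W ++ Z) R _) (cong (_+ # R (not ∘ χ)) (∑-++ W Z _))))))) ⟩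
          3 * # ((W ++ Z) ++ R) (not ∘ χ)  ∎)
        where
        open ≤-Reasoning
        1≤c : 1 ≤ c
        1≤c = ≤-trans (s≤s z≤n) lW
        l : ∀ a → a + a + a ≡ 3 * a
        l = solve-∀
        total : length ((W ++ Z) ++ R) ≤ c + s * c + s
        total = ≤-trans (≤-reflexive (trans (length-++ (W ++ Z)) (cong (_+ length R) (length-++ W))))
          (+-mono-≤ (+-mono-≤ (<⇒≤ lW) (≤-reflexive lZ)) lR)

    open ↭-Solver (Fin n) using (solve; _⊕_; _⊜_) renaming (id to nil)

    -- The tiles are even, and so is the absorber, being tileable by itself; hence the leftover
    -- inherits the parity of the whole vertex set.
    factor-no-bad : NoBadTile → parity (allFin n) ≡ false → Tileable m (allFin n)
    factor-no-bad noBad even = use (prepare [] [] z≤n)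
      where
      use : Prepared [] → Tileable m (allFin n)
      use (F , Z , W , ts , abs , perm , joins , lW , hZ , lZ) = with-F (abs [] [] z≤n)
        where
        perm′ : allFin n ↭ (((W ++ Z) ++ []) ++ tilesVerts ts) ++ F
        perm′ = ↭-trans perm (solve 4 (λ w t f z → (w ⊕ t) ⊕ (f ⊕ (z ⊕ nil)) ⊜ (((w ⊕ z) ⊕ nil) ⊕ t) ⊕ f) ↭-refl W (tilesVerts ts) F Z)
        uAll : Unique ((((W ++ Z) ++ []) ++ tilesVerts ts) ++ F)
        uAll = Unique-↭ perm′ (allFin⁺ n)
        with-F : Tileable m F → Tileable m (allFin n)
        with-F (ts′ , joins′ , permF) = finish-even F ((W ++ Z) ++ []) ts abs perm′ joins (proj₁ counts) parity-W (proj₂ counts)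
          where
          counts = count-Z W Z [] hZ lW lZ z≤n
          parity-F : parity F ≡ false
          parity-F = trans (parity-↭ permF) (parity-tiles noBad ts′ joins′ (Unique-↭ permF (Unique-++ʳ (((W ++ Z) ++ []) ++ tilesVerts ts) uAll)))
          parity-ts : parity (tilesVerts ts) ≡ false
          parity-ts = parity-tiles noBad ts joins (Unique-++ʳ ((W ++ Z) ++ []) (Unique-++ˡ (((W ++ Z) ++ []) ++ tilesVerts ts) uAll))
          xor-false : ∀ b → b xor false ≡ b
          xor-false true = refl
          xor-false false = refl
          parity-W : parity ((W ++ Z) ++ []) ≡ false
          parity-W = begin
            parity ((W ++ Z) ++ [])  ≡⟨ trans (sym (xor-false _)) (sym (xor-false _)) ⟩
            (parity ((W ++ Z) ++ []) xor false) xor false  ≡⟨ cong₂ (λ a b → (parity ((W ++ Z) ++ []) xor a) xor b) parity-ts parity-F ⟨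
            (parity ((W ++ Z) ++ []) xor parity (tilesVerts ts)) xor parity F  ≡⟨ trans (parity-++ (((W ++ Z) ++ []) ++ tilesVerts ts) F) (cong (_xor parity F) (parity-++ ((W ++ Z) ++ []) (tilesVerts ts))) ⟨
            parity ((((W ++ Z) ++ []) ++ tilesVerts ts) ++ F)  ≡⟨ parity-↭ perm′ ⟨
            parity (allFin n)  ≡⟨ even ⟩
            false  ∎
            where open ≡-Reasoning

    -- A tile of the wrong parity is either kept as a tile or dissolved, whichever makes the leftover even.
    factor-bad : ∀ t → T (joined t) → Unique (verts (tile m) t) → parity (verts (tile m) t) ≡ true → Tileable m (allFin n)
    factor-bad t jt ut odd = use (prepare P ut (≤-reflexive (length-verts (tile m) t)))
      where
      P : List (Fin n)
      P = verts (tile m) t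
      use : Prepared P → Tileable m (allFin n)
      use (F , Z , W , ts , abs , perm , joins , lW , hZ , lZ) = decide (parity (W ++ Z)) refl
        where
        decide : ∀ b → parity (W ++ Z) ≡ b → Tileable m (allFin n)
        decide false even = finish-even F ((W ++ Z) ++ []) (t ∷ ts) abs
          (↭-trans perm (solve 5 (λ w t f z p → (w ⊕ t) ⊕ (f ⊕ (z ⊕ p)) ⊜ (((w ⊕ z) ⊕ nil) ⊕ (p ⊕ t)) ⊕ f) ↭-refl W (tilesVerts ts) F Z P))
          (jt ∷ joins) (proj₁ counts) (trans (cong parity (++-identityʳ (W ++ Z))) even) (proj₂ counts)
          where counts = count-Z W Z [] hZ lW lZ z≤n
        decide true odd′ = finish-even F ((W ++ Z) ++ P) ts abs
          (↭-trans perm (solve 5 (λ w t f z p → (w ⊕ t) ⊕ (f ⊕ (z ⊕ p)) ⊜ (((w ⊕ z) ⊕ p) ⊕ t) ⊕ f) ↭-refl W (tilesVerts ts) F Z P))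
          joins (proj₁ counts) (trans (parity-++ (W ++ Z) P) (cong₂ _xor_ odd′ odd)) (proj₂ counts)
          where counts = count-Z W Z P hZ lW lZ (≤-reflexive (length-verts (tile m) t))

    factor-coloured : (∀ x x′ → x ≢ x′ → threshold n ≤ # (allFin n) (edge H x x′)) → Tileable m (allFin n)
    factor-coloured codeg≥ = decide (Any.any? (λ t → T? (joined t) ×-dec (allPairs? (λ x y → ¬? (x ≟ y)) (verts (tile m) t) ×-dec T? (parity (verts (tile m) t)))) (enum (tile m)))
      where
      Bad : El (tile m) → Set
      Bad t = T (joined t) × Unique (verts (tile m) t) × T (parity (verts (tile m) t))
      decide : Dec (Any Bad (enum (tile m))) → Tileable m (allFin n)
      decide (yes bad) with t , j , u , p ← Any.satisfied bad = factor-bad t j u (T⇒≡ p)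
      decide (no none) = factor-no-bad noBad (parity-even noBad large (threshold n) codeg≥ (proj₁ (threshold-facts n)) (proj₂ (threshold-facts n)))
        where
        noBad : NoBadTile
        noBad t j u = ¬T⇒≡ (λ p → none (Any.map (λ { refl → j , u , p }) (∈-enum (tile m) t)))

coloured-up : ∀ {k k′ Kb n} {H : ThreeGraph n} → k ≤ k′ → Coloured k Kb H → Coloured k′ Kb H
coloured-up {k} {k′} {H = H} k≤ C = record
  { χ = χ ; typ = typ ; e = e ; e-small = e-small ; few-atypical = few-atypical ; typical = typical
  ; many-true = many-true ; many-false = many-false
  ; same-colour = λ w w′ eq → Reachability.reach-up H {k} {k′} {w} {w′} k≤ (same-colour w w′ eq) }
  where open Coloured C

-- The constant k₀ comes from `dichotomy`. In the reachable case `many-joined` finds copies of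
-- K³_{m,m} with constant `spreads m k₀`, which is therefore taken as k; the multiple of m in Kb is
-- what the coloured case demands.
module Main (m′ Kb k₀ k g c N₁ N₂ : ℕ) (Kb-def : Kb ≡ 5000 * suc m′) (k₀-def : k₀ ≡ spread (4 * Kb)) (k-def : k ≡ spreads (suc m′) k₀)
  (almost : ∀ n → N₁ ≤ n → (H : ThreeGraph n) → (∀ x x′ → x ≢ x′ → n ≤ 2 * # (allFin n) (edge H x x′) + 3) →
    ∀ F → Unique F → g * length F ≤ n → AlmostTiled m′ c H F)
  (absorb : ∀ n → N₂ ≤ n → (H : ThreeGraph n) → 0 < n → (∀ x x′ → x ≢ x′ → T (Tuples.many n pt 3 (edge H x x′))) →
    Absorbing m′ k (2 * g) (c + size (tile (suc m′)) * c + size (tile (suc m′))) H) where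

  private
    m s : ℕ
    m = suc m′
    s = size (tile m)

    b₁ b₂ b₃ b₄ b₅ : ℕ
    b₁ = 4 * spreads m′ k * (s * c + s)
    b₂ = 2 * g * (s * c + s)
    b₃ = 12 * (s + s * c)
    b₄ = 2 * (48 * m + 144) * (6 * m)
    b₅ = 4 * Kb

  bound : ℕ
  bound = N₁ + (N₂ + (b₁ + (b₂ + (b₃ + (b₄ + (b₅ + 9))))))

  factorise : ∀ n → bound ≤ n → (3 * m) ∣ n → (H : ThreeGraph n) → minCodegAtLeast H (threshold n) → KmmFactor m H
  factorise n big (divides K n≡₀) H codeg≥₀ = Tilings.factor H (cases (Dichotomy.dichotomy H n>0 deg e Kb e≥4 Kb≥400 e-small e-large n≥9))
    where
    open ≤-Reasoning
    after : ∀ a {b} → a + b ≤ n → b ≤ n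
    after a {b} le = ≤-trans (m≤n+m b a) le
    q₂ = after N₁ big
    q₃ = after N₂ q₂
    q₄ = after b₁ q₃
    q₅ = after b₂ q₄
    q₆ = after b₃ q₅
    q₇ = after b₄ q₆
    n≥9 : 9 ≤ n
    n≥9 = after b₅ q₇
    n>0 : 0 < n
    n>0 = ≤-trans (s≤s z≤n) n≥9
    n≡ : n ≡ K * s
    n≡ = trans n≡₀ (cong (K *_) (sym (size-tile m)))
    codeg≥ : ∀ x x′ → x ≢ x′ → threshold n ≤ # (allFin n) (edge H x x′)
    codeg≥ x x′ x≢ = ≤-trans (codeg≥₀ x x′ x≢) (≤-reflexive (codeg-# H x x′))
    deg : ∀ x x′ → x ≢ x′ → n ≤ 2 * # (allFin n) (edge H x x′) + 3
    deg x x′ x≢ = ≤-trans (proj₁ (threshold-facts n)) (+-monoˡ-≤ 3 (*-monoʳ-≤ 2 (codeg≥ x x′ x≢)))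
    deg3 : ∀ x x′ → x ≢ x′ → T (Tuples.many n pt 3 (edge H x x′))
    deg3 x x′ x≢ = Tuples.most⁺ n {3} (*-cancelˡ-≤ 2 (lin 0 (+-mono-≤ (*-monoʳ-≤ 3 (deg x x′ x≢)) n≥9) (l n (# (allFin n) (edge H x x′)))))
      where
      l : ∀ n c → 2 * n + (3 * (2 * c + 3) + n) + 0 ≡ 2 * (3 * c) + (3 * n + 9)
      l = solve-∀
    Kb-large : 5000 * m ≤ Kb
    Kb-large = ≤-reflexive (sym Kb-def)
    Kb≥5000 : 5000 ≤ Kb
    Kb≥5000 = ≤-trans (m≤m*n 5000 m) Kb-large
    Kb≥400 : 400 ≤ Kb
    Kb≥400 = ≤-trans (m≤m+n 400 4600) Kb≥5000
    instance
      Kb≢0 : NonZero Kb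
      Kb≢0 = >-nonZero (≤-trans (m≤m+n 1 4999) Kb≥5000)
    e : ℕ
    e = n / Kb
    e-small : Kb * e ≤ n
    e-small = ≤-trans (≤-reflexive (*-comm Kb e)) (m/n*n≤m n Kb)
    e≥4 : 4 ≤ e
    e≥4 = ≤-trans (≤-reflexive (sym (m*n/n≡m 4 Kb))) (/-monoˡ-≤ Kb (≤-trans (m≤m+n (4 * Kb) 9) q₇))
    e-large : n ≤ 2 * Kb * e
    e-large = begin
      n  ≡⟨ m≡m%n+[m/n]*n n Kb ⟩
      n % Kb + e * Kb  ≤⟨ +-monoˡ-≤ (e * Kb) (<⇒≤ (m%n<n n Kb)) ⟩
      Kb + e * Kb  ≤⟨ +-monoˡ-≤ (e * Kb) (≤-trans (≤-reflexive (sym (*-identityˡ Kb))) (*-monoˡ-≤ Kb (≤-trans (s≤s z≤n) e≥4))) ⟩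
      e * Kb + e * Kb  ≡⟨ l e Kb ⟩
      2 * Kb * e  ∎
      where
      l : ∀ a b → a * b + a * b ≡ 2 * b * a
      l = solve-∀
    k₀≥144 : 144 ≤ spread (4 * Kb)
    k₀≥144 = ≤-trans (m≤m+n 144 256) (≤-trans Kb≥400 (≤-trans (m≤m+n Kb _) (k≤spread (4 * Kb))))
    k₀≤k : spread (4 * Kb) ≤ k
    k₀≤k = ≤-trans (≤-reflexive (sym k₀-def)) (≤-trans (k≤spreads m k₀) (≤-reflexive (sym k-def)))
    k≥144 : 144 ≤ k
    k≥144 = ≤-trans k₀≥144 k₀≤k
    absorb′ : Absorbing m′ k (2 * g) (c + s * c + s) H
    absorb′ = absorb n (≤-trans (m≤m+n N₂ _) q₂) H n>0 deg3
    almost′ : ∀ F → Unique F → g * length F ≤ n → AlmostTiled m′ c H F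
    almost′ = almost n (≤-trans (m≤m+n N₁ _) big) H deg
    cases : (∀ u v → T (Reachability.reach H (spread (4 * Kb)) u v)) ⊎ Coloured (spread (4 * Kb)) Kb H → Tilings.Tileable H m (allFin n)
    cases (inj₂ col) = FinishColoured.factor-coloured m′ H n>0 deg k Kb k≥144 Kb-large (coloured-up k₀≤k col) c
      (≤-trans (m≤m+n b₄ _) q₆) K n≡ g absorb′ almost′ (≤-trans (m≤m+n b₁ _) q₃) (≤-trans (m≤m+n b₂ _) q₄) (≤-trans (m≤m+n b₃ _) q₅) codeg≥
    cases (inj₁ near) = with-F (absorb′ [] [] (≤-trans (≤-reflexive (*-zeroʳ (4 * spreads m′ k))) z≤n))
      where
      open Reachability H
      v₀ : Fin n
      v₀ = proj₁ (#-find (allFin n) (λ _ → true) (≤-trans n>0 (≤-reflexive (sym (trans (#-all {xs = allFin n} (λ _ → true) (All.tabulate (λ _ → tt))) (length-allFin n))))))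
      tiles-many : ∀ a → T (similar (spread (4 * Kb)) v₀ a) → T (many (tile m) k joined)
      tiles-many a sim = subst (λ z → T (many (tile m) z joined)) (trans (cong (spreads m) (sym k₀-def)) (sym k-def))
        (manyᵛ-mono pt m (λ ys h → many-mono (vec (pt ⊗ pt) m) {spreads m (spread (4 * Kb))} {allᵛ (λ p → Q p ∧ allᵛ (λ y → adj y p) ys)} {λ xs → joined (ys , xs)}
            (λ xs → allᵛ-mono {P = λ p → Q p ∧ allᵛ (λ y → adj y p) ys} xs (λ p → ∧-snd {Q p})) (many-all (pt ⊗ pt) m h))
          (many-joined n>0 m (spread (4 * Kb)) Q sim (λ p q → many-up pt (≤-trans (m≤m+n 3 141) k₀≥144)
            (deg3 (proj₁ p) (proj₂ p) (proj₁ (distinct H _ _ v₀ (T⇒≡ (∧-fst {adj v₀ p} q))))))))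
        where
        Q : Fin n × Fin n → Bool
        Q p = adj v₀ p ∧ adj a p
      suit : ∀ w → T (suits m′ k w)
      suit w = many-mono (tile m) {k} {joined} {λ K → joined K ∧ reachAll (tile m) k w K} (λ K j → ∧-intro j (reachAny (tile m) w K))
        -- Reachability of v₀ from itself provides some vertex a similar to v₀; their common pairs
        -- are the dense set out of which many copies are built.
        (from (#-find (allFin n) _ (factor-pos {c = spread (4 * Kb)} n>0 (most⁻ (near v₀ v₀)))))
        where
        from : (∃ λ a → a ∈ allFin n × T (similar (spread (4 * Kb)) v₀ a ∧ similar (spread (4 * Kb)) v₀ a)) → T (many (tile m) k joined)
        from (a , _ , h) = tiles-many a (∧-fst h)
        reachAny : ∀ t (x y : El t) → T (reachAll t k x y)
        reachAnyᵛ : ∀ t {j} (x y : Vec (El t) j) → T (reachAllᵛ t k x y)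
        reachAny pt x y = reach-up k₀≤k (near x y)
        reachAny (t ⊗ t′) (x , x′) (y , y′) = ∧-intro (reachAny t x y) (reachAny t′ x′ y′)
        reachAny (vec t j) x y = reachAnyᵛ t x y
        reachAnyᵛ t [] [] = tt
        reachAnyᵛ t (x ∷ xs) (y ∷ ys) = ∧-intro (reachAny t x y) (reachAnyᵛ t xs ys)
      with-F : (∃ λ F → Unique (F ++ []) × 2 * g * length F ≤ n × Absorbs m′ k (c + s * c + s) F) → Tileable m (allFin n)
      with-F (F , uF , lF , abs) = with-ts (almost′ F (Unique-++ˡ F uF) (≤-trans (*-monoˡ-≤ (length F) (m≤m+n g _)) lF))
        where
        with-ts : AlmostTiled m′ c H F → Tileable m (allFin n)
        with-ts (ts , W , joins , perm , lW) = Finish.finish-near m′ H k (c + s * c + s) K n≡ suit F W ts abs perm joins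
          (≤-trans (<⇒≤ lW) (≤-trans (m≤m+n c (s * c)) (m≤m+n (c + s * c) s)))

theorem1p5 : (m : ℕ) → 0 < m → Σ ℕ λ N → ∀ (n : ℕ) → n ≥ N → (3 * m) ∣ n →
    (H : ThreeGraph n) → minCodegAtLeast H (threshold n) → KmmFactor m H
theorem1p5 (suc m′) _ = assemble (5000 * suc m′) (spread (4 * (5000 * suc m′))) (spreads (suc m′) (spread (4 * (5000 * suc m′)))) refl refl refl (almostTiling m′)
  where
  m = suc m′
  assemble : ∀ Kb k₀ k → Kb ≡ 5000 * m → k₀ ≡ spread (4 * Kb) → k ≡ spreads m k₀ →
    (Σ ℕ λ g → Σ ℕ λ c → Σ ℕ λ N → ∀ n → N ≤ n → (H : ThreeGraph n) →
      (∀ x x′ → x ≢ x′ → n ≤ 2 * # (allFin n) (edge H x x′) + 3) → ∀ F → Unique F → g * length F ≤ n → AlmostTiled m′ c H F) →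
    Σ ℕ λ N → ∀ (n : ℕ) → n ≥ N → (3 * m) ∣ n → (H : ThreeGraph n) → minCodegAtLeast H (threshold n) → KmmFactor m H
  assemble Kb k₀ k Kb-def k₀-def k-def (g , c , N₁ , almost) = with-absorb (absorbing m′ k k≥3 (2 * g) (c + size (tile m) * c + size (tile m)))
    where
    k≥3 : 3 ≤ k
    k≥3 = ≤-trans (≤-trans (m≤m+n 3 4997) (≤-trans (m≤m*n 5000 m) (≤-trans (≤-reflexive (sym Kb-def)) (m≤m+n Kb _))))
      (≤-trans (k≤spread (4 * Kb)) (≤-trans (≤-reflexive (sym k₀-def)) (≤-trans (k≤spreads m k₀) (≤-reflexive (sym k-def)))))
    with-absorb : (Σ ℕ λ N₂ → ∀ n → N₂ ≤ n → (H : ThreeGraph n) → 0 < n → (∀ x x′ → x ≢ x′ → T (Tuples.many n pt 3 (edge H x x′))) →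
        Absorbing m′ k (2 * g) (c + size (tile m) * c + size (tile m)) H) →
      Σ ℕ λ N → ∀ (n : ℕ) → n ≥ N → (3 * m) ∣ n → (H : ThreeGraph n) → minCodegAtLeast H (threshold n) → KmmFactor m H
    with-absorb (N₂ , absorb) = Main.bound m′ Kb k₀ k g c N₁ N₂ Kb-def k₀-def k-def almost absorb ,
      Main.factorise m′ Kb k₀ k g c N₁ N₂ Kb-def k₀-def k-def almost absorb
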